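{- Let $k$ be a positive even integer, let $m\in\mathbb{N}$, $m\ge 1$, and put $i=\frac{m}{2}$. Let $q$ be a complex number with $0<|q|<1$, and define $$S_n(q) := q^{2i-1}\,\frac{\left(q^{\frac{k}{4}-(4i-2)},\,q^{\frac{3k}{4}+(4i-2)};\,q^{k}\right)_\infty}{\left(q^{\frac{k}{4}+(4i-2)},\,q^{\frac{3k}{4}-(4i-2)};\,q^{k}\right)_\infty}=q^{2i-1}\,\frac{f\left(-q^{\frac{k}{4}-(4i-2)},-q^{\frac{3k}{4}+(4i-2)}\right)}{f\left(-q^{\frac{k}{4}+(4i-2)},-q^{\frac{3k}{4}-(4i-2)}\right)},$$ where it is assumed that the numerator and the denominator of this quotient are nonzero. Then $$\frac{1}{S_n(q)}-S_n(q)=\frac{\phi\left(q^{\frac{k}{4}}\right) f\left(-q^{4i-2},-q^{\frac{k}{2}-(4i-2)}\right)}{q^{2i-1}\,\psi\left(q^{\frac{k}{2}}\right) f\left(-q^{\frac{k}{4}-(4i-2)},-q^{\frac{k}{4}+(4i-2)}\right)}$$ and $$\frac{1}{S_n(q)}+S_n(q)=\frac{\phi\left(-q^{\frac{k}{4}}\right) f\left(q^{4i-2},q^{\frac{k}{2}-(4i-2)}\right)}{q^{2i-1}\,\psi\left(q^{\frac{k}{2}}\right) f\left(-q^{\frac{k}{4}-(4i-2)},-q^{\frac{k}{4}+(4i-2)}\right)}.$$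
   Context: For complex $\lambda$ and $|q|<1$, $(\lambda;q)_\infty=\prod_{n\ge 0}(1-\lambda q^n)$ and $(\lambda_1,\dots,\lambda_r;q)_\infty=\prod_{j=1}^r(\lambda_j;q)_\infty$. Ramanujan's general theta function is $f(a,b)=\sum_{n=-\infty}^{\infty}a^{n(n+1)/2}b^{n(n-1)/2}$ for $|ab|<1$; by Jacobi's triple product identity $f(a,b)=(-a;ab)_\infty(-b;ab)_\infty(ab;ab)_\infty$. Special cases: $\phi(q)=f(q,q)=\sum_{n=-\infty}^\infty q^{n^2}$ and $\psi(q)=f(q,q^3)=\sum_{n=0}^\infty q^{n(n+1)/2}$. A fourth root $q^{1/4}$ of $q$ is fixed once and for all, and every power $q^{r/4}$ with $r\in\mathbb{Z}$ means $(q^{1/4})^r$. The subscript $n$ in $S_n$ is only a label; the function depends on $k$ and $i$. -}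

module Defs where

open import Data.Nat as ℕ using (ℕ; zero; suc)
import Data.Nat.Properties as ℕₚ
open import Data.Nat.DivMod using () renaming (_/_ to _/ℕ_)
open import Data.Integer as ℤ using (ℤ; +_; -[1+_])
open import Data.Rational
open import Data.Rational.Properties
open import Tactic.RingSolver using (solve-∀)
open import Tactic.RingSolver.Core.AlmostCommutativeRing
  using (AlmostCommutativeRing; fromCommutativeRing)
open import Data.Product using (Σ; _×_; _,_; ∃-syntax)
open import Data.Sum using (inj₁; inj₂)
open import Data.Empty using (⊥-elim)
open import Relation.Binary using (tri<; tri≈; tri>)
open import Relation.Nullary using (yes; no)
open import Relation.Nullary.Decidable using (dec⇒maybe)
open import Relation.Binary.PropositionalEquality
  using (_≡_; _≢_; refl; sym; trans; cong; cong₂; subst)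

------------------------------------------------------------------------
-- Rational estimates

ℚ-ring : AlmostCommutativeRing _ _
ℚ-ring = fromCommutativeRing +-*-commutativeRing (λ a → dec⇒maybe (0ℚ ≟ a))

id-split : ∀ a b c d → a * b + - (c * d) ≡ a * (b + - d) + (a + - c) * d
id-split = solve-∀ ℚ-ring

id-total : ∀ B C e r → B * (e * r) + (e * r) * C ≡ e * ((B + C) * r)
id-total = solve-∀ ℚ-ring

id-cancel : ∀ a b → (a + - b) + b ≡ a
id-cancel = solve-∀ ℚ-ring

id-sum : ∀ a b c d → (a + - c) + (b + - d) ≡ (a + b) + - (c + d)
id-sum = solve-∀ ℚ-ring

id-neg : ∀ a b → - (a + - b) ≡ - a + - (- b)
id-neg = solve-∀ ℚ-ring

id-flip : ∀ a b → - (b + - a) ≡ a + - b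
id-flip = solve-∀ ℚ-ring

id-recip : ∀ a b r s → (r + - s) * (a * b) ≡ (a * r) * b + - ((b * s) * a)
id-recip = solve-∀ ℚ-ring

id-norm : ∀ a b c d →
  (a * c + - (b * d)) * (a * c + - (b * d)) + (a * d + b * c) * (a * d + b * c)
    ≡ (a * a + b * b) * (c * c + d * d)
id-norm = solve-∀ ℚ-ring

id-half : ∀ h → (h + h) + - h ≡ h
id-half = solve-∀ ℚ-ring

id-move : ∀ a b z → (b + - z) + - (b + - a) ≡ a + - z
id-move = solve-∀ ℚ-ring

half+half : ∀ ε → ½ * ε + ½ * ε ≡ ε
half+half ε = trans (sym (*-distribʳ-+ ε ½ ½)) (*-identityˡ ε)

0<½* : ∀ {ε} → 0ℚ < ε → 0ℚ < ½ * ε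
0<½* {ε} 0<ε = subst (_< ½ * ε) (*-zeroʳ ½) (*-monoʳ-<-pos ½ 0<ε)

∣+∣< : ∀ {a b ε} → ∣ a ∣ < ½ * ε → ∣ b ∣ < ½ * ε → ∣ a + b ∣ < ε
∣+∣< {a} {b} {ε} p q = ≤-<-trans (∣p+q∣≤∣p∣+∣q∣ a b)
  (subst (∣ a ∣ + ∣ b ∣ <_) (half+half ε) (+-mono-< p q))

0≤∣∣ : ∀ a → 0ℚ ≤ ∣ a ∣
0≤∣∣ a = nonNegative⁻¹ ∣ a ∣ {{∣-∣-nonNeg a}}

*-mono-<₀ : ∀ {a b c d} → 0ℚ ≤ a → 0ℚ ≤ c → a < b → c < d → a * c < b * d
*-mono-<₀ {a} {b} {c} {d} 0≤a 0≤c a<b c<d = ≤-<-trans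
  (*-monoˡ-≤-nonNeg a {{nonNegative 0≤a}} (<⇒≤ c<d))
  (*-monoˡ-<-pos d {{positive (≤-<-trans 0≤c c<d)}} a<b)

*-mono-≤₀ : ∀ {a b c d} → 0ℚ ≤ c → 0ℚ ≤ b → a ≤ b → c ≤ d → a * c ≤ b * d
*-mono-≤₀ {a} {b} {c} {d} 0≤c 0≤b a≤b c≤d = ≤-trans
  (*-monoʳ-≤-nonNeg c {{nonNegative 0≤c}} a≤b)
  (*-monoˡ-≤-nonNeg b {{nonNegative 0≤b}} c≤d)

0<* : ∀ {a b} → 0ℚ < a → 0ℚ < b → 0ℚ < a * b
0<* {a} {b} 0<a 0<b = subst (_< a * b) (*-zeroʳ a)
  (*-monoʳ-<-pos a {{positive 0<a}} 0<b)

0≤² : ∀ a → 0ℚ ≤ a * a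
0≤² a with ≤-total 0ℚ a
... | inj₁ 0≤a = subst (_≤ a * a) (*-zeroʳ a) (*-monoˡ-≤-nonNeg a {{nonNegative 0≤a}} 0≤a)
... | inj₂ a≤0 = subst (_≤ a * a) (*-zeroʳ a) (*-monoˡ-≤-nonPos a {{nonPositive a≤0}} a≤0)

-- The reciprocal, with the junk value 0 at 0.
recip : ℚ → ℚ
recip a with a ≟ 0ℚ
... | yes _   = 0ℚ
... | no  a≢0 = 1/_ a {{≢-nonZero a≢0}}

0<⇒≢0 : ∀ {a} → 0ℚ < a → a ≢ 0ℚ
0<⇒≢0 0<a a≡0 = <⇒≢ 0<a (sym a≡0)

recip-inverse : ∀ {a} → a ≢ 0ℚ → a * recip a ≡ 1ℚ
recip-inverse {a} a≢0 with a ≟ 0ℚ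
... | yes a≡0 = ⊥-elim (a≢0 a≡0)
... | no  _   = *-inverseʳ a {{≢-nonZero a≢0}}

0<recip : ∀ {a} → 0ℚ < a → 0ℚ < recip a
0<recip {a} 0<a with <-cmp 0ℚ (recip a)
... | tri< p _ _ = p
... | tri≈ _ p _ = ⊥-elim (<⇒≢ (positive⁻¹ 1ℚ)
        (trans (sym (trans (cong (a *_) (sym p)) (*-zeroʳ a))) (recip-inverse (0<⇒≢0 0<a))))
... | tri> _ _ p = ⊥-elim (<-asym (positive⁻¹ 1ℚ)
        (subst (_< 0ℚ) (recip-inverse (0<⇒≢0 0<a))
          (subst (a * recip a <_) (*-zeroʳ a) (*-monoʳ-<-pos a {{positive 0<a}} p))))

-- Abstract because unfolding these makes type checking intractable.
abstract
  -- The tolerance ε / (B + C).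
  tol : ℚ → ℚ → ℚ → ℚ
  tol B C ε = ε * recip (B + C)

  0<tol : ∀ {B C ε} → 0ℚ < B → 0ℚ < C → 0ℚ < ε → 0ℚ < tol B C ε
  0<tol 0<B 0<C 0<ε = 0<* 0<ε (0<recip (+-mono-< 0<B 0<C))

  *-close : ∀ {a b c d B C ε} → 0ℚ < B → 0ℚ < C → ∣ a ∣ < B → ∣ d ∣ < C →
            ∣ a - c ∣ < tol B C ε → ∣ b - d ∣ < tol B C ε → ∣ a * b - c * d ∣ < ε
  *-close {a} {b} {c} {d} {B} {C} {ε} 0<B 0<C a<B d<C ac bd =
    subst (λ t → ∣ t ∣ < ε) (sym (id-split a b c d))
      (≤-<-trans (∣p+q∣≤∣p∣+∣q∣ (a * (b - d)) ((a - c) * d))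
        (subst (∣ a * (b - d) ∣ + ∣ (a - c) * d ∣ <_) total (+-mono-< first second)))
    where
    first : ∣ a * (b - d) ∣ < B * tol B C ε
    first = subst (_< B * tol B C ε) (sym (∣p*q∣≡∣p∣*∣q∣ a (b - d)))
              (*-mono-<₀ (0≤∣∣ a) (0≤∣∣ (b - d)) a<B bd)
    second : ∣ (a - c) * d ∣ < tol B C ε * C
    second = subst (_< tol B C ε * C) (sym (∣p*q∣≡∣p∣*∣q∣ (a - c) d))
              (*-mono-<₀ (0≤∣∣ (a - c)) (0≤∣∣ d) ac d<C)
    total : B * tol B C ε + tol B C ε * C ≡ ε
    total = trans (id-total B C ε (recip (B + C)))
      (trans (cong (ε *_) (recip-inverse (0<⇒≢0 (+-mono-< 0<B 0<C)))) (*-identityʳ ε))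

------------------------------------------------------------------------
-- Real numbers: Cauchy sequences of rationals.  Only the tail of a sequence
-- matters, so the ring operations act termwise.

record ℝ : Set where
  constructor mkℝ
  field
    seq    : ℕ → ℚ
    cauchy : ∀ ε → 0ℚ < ε → ∃[ N ] (∀ m n → N ℕ.≤ m → N ℕ.≤ n → ∣ seq m - seq n ∣ < ε)

open ℝ

infix 4 _≈ℝ_ _<ℝ_

_≈ℝ_ : ℝ → ℝ → Set
x ≈ℝ y = ∀ ε → 0ℚ < ε → ∃[ N ] (∀ n → N ℕ.≤ n → ∣ seq x n - seq y n ∣ < ε)

_<ℝ_ : ℝ → ℝ → Set
x <ℝ y = ∃[ δ ] (0ℚ < δ × ∃[ N ] (∀ n → N ℕ.≤ n → δ ≤ seq y n - seq x n))

abstract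
  bound : ∀ x → ∃[ B ] (0ℚ < B × ∃[ N ] (∀ n → N ℕ.≤ n → ∣ seq x n ∣ < B))
  bound x with cauchy x 1ℚ (positive⁻¹ 1ℚ)
  ... | N , close = 1ℚ + ∣ seq x N ∣ , +-mono-<-≤ (positive⁻¹ 1ℚ) (0≤∣∣ (seq x N)) , N , λ n N≤n →
        ≤-<-trans
          (subst (λ t → ∣ t ∣ ≤ ∣ seq x n - seq x N ∣ + ∣ seq x N ∣) (id-cancel (seq x n) (seq x N))
            (∣p+q∣≤∣p∣+∣q∣ (seq x n - seq x N) (seq x N)))
          (+-monoˡ-< ∣ seq x N ∣ (close n N N≤n ℕₚ.≤-refl))

⊔ˡ : ∀ {M N n} → M ℕ.⊔ N ℕ.≤ n → M ℕ.≤ n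
⊔ˡ {M} {N} = ℕₚ.≤-trans (ℕₚ.m≤m⊔n M N)

⊔ʳ : ∀ {M N n} → M ℕ.⊔ N ℕ.≤ n → N ℕ.≤ n
⊔ʳ {M} {N} = ℕₚ.≤-trans (ℕₚ.m≤n⊔m M N)

module _ (M N M′ N′ : ℕ) {n : ℕ} (p : (M ℕ.⊔ N) ℕ.⊔ (M′ ℕ.⊔ N′) ℕ.≤ n) where
  ⊔₁ : M ℕ.≤ n
  ⊔₁ = ⊔ˡ {M} {N} (⊔ˡ {M ℕ.⊔ N} {M′ ℕ.⊔ N′} p)
  ⊔₂ : N ℕ.≤ n
  ⊔₂ = ⊔ʳ {M} {N} (⊔ˡ {M ℕ.⊔ N} {M′ ℕ.⊔ N′} p)
  ⊔₃ : M′ ℕ.≤ n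
  ⊔₃ = ⊔ˡ {M′} {N′} (⊔ʳ {M ℕ.⊔ N} {M′ ℕ.⊔ N′} p)
  ⊔₄ : N′ ℕ.≤ n
  ⊔₄ = ⊔ʳ {M′} {N′} (⊔ʳ {M ℕ.⊔ N} {M′ ℕ.⊔ N′} p)

ratℝ : ℚ → ℝ
seq (ratℝ a) _ = a
cauchy (ratℝ a) ε 0<ε = 0 , λ _ _ _ _ → subst (λ t → ∣ t ∣ < ε) (sym (+-inverseʳ a)) 0<ε

0ℝ 1ℝ : ℝ
0ℝ = ratℝ 0ℚ
1ℝ = ratℝ 1ℚ

infixl 6 _+ℝ_
infixl 7 _*ℝ_
infix  8 -ℝ_

_+ℝ_ : ℝ → ℝ → ℝ
seq (x +ℝ y) n = seq x n + seq y n
cauchy (x +ℝ y) ε 0<ε with cauchy x (½ * ε) (0<½* 0<ε) | cauchy y (½ * ε) (0<½* 0<ε)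
... | M , cx | N , cy = M ℕ.⊔ N , λ m n p q →
  subst (λ t → ∣ t ∣ < ε)
    (id-sum (seq x m) (seq y m) (seq x n) (seq y n))
    (∣+∣< {seq x m - seq x n} {seq y m - seq y n}
      (cx m n (⊔ˡ p) (⊔ˡ q)) (cy m n (⊔ʳ {M} p) (⊔ʳ {M} q)))

-ℝ_ : ℝ → ℝ
seq (-ℝ x) n = - seq x n
cauchy (-ℝ x) ε 0<ε with cauchy x ε 0<ε
... | N , cx = N , λ m n p q →
  subst (_< ε)
    (trans (sym (∣-p∣≡∣p∣ (seq x m - seq x n)))
      (cong ∣_∣ (id-neg (seq x m) (seq x n))))
    (cx m n p q)

*-cauchy : ∀ x y ε → 0ℚ < ε → ∃[ N ] (∀ m n → N ℕ.≤ m → N ℕ.≤ n →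
           ∣ seq x m * seq y m - seq x n * seq y n ∣ < ε)
*-cauchy x y ε 0<ε with bound x | bound y
... | B , 0<B , M , bx | C , 0<C , N , by
  with cauchy x (tol B C ε) (0<tol 0<B 0<C 0<ε) | cauchy y (tol B C ε) (0<tol 0<B 0<C 0<ε)
... | M′ , cx | N′ , cy = (M ℕ.⊔ N) ℕ.⊔ (M′ ℕ.⊔ N′) , λ m n p q →
  *-close {seq x m} {seq y m} {seq x n} {seq y n} {B} {C} {ε} 0<B 0<C
    (bx m (⊔₁ M N M′ N′ p)) (by n (⊔₂ M N M′ N′ q))
    (cx m n (⊔₃ M N M′ N′ p) (⊔₃ M N M′ N′ q))
    (cy m n (⊔₄ M N M′ N′ p) (⊔₄ M N M′ N′ q))

_*ℝ_ : ℝ → ℝ → ℝ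
x *ℝ y = mkℝ (λ n → seq x n * seq y n) (*-cauchy x y)

infixr 8 _^ℚ_
_^ℚ_ : ℚ → ℕ → ℚ
a ^ℚ zero  = 1ℚ
a ^ℚ suc n = a * a ^ℚ n

-- The reciprocal of a positive real.  The terms do not depend on the proof of
-- positivity, which only serves to show that they form a Cauchy sequence.
invℝ : ∀ x → 0ℝ <ℝ x → ℝ
seq (invℝ x _) n = recip (seq x n)
cauchy (invℝ x (δ , 0<δ , M , pos)) ε 0<ε
  with cauchy x (ε * (δ * δ)) (0<* 0<ε (0<* 0<δ 0<δ))
... | N , cx = M ℕ.⊔ N , λ m n p q →
  recip-close (≤x m (⊔ˡ p)) (≤x n (⊔ˡ q)) (cx m n (⊔ʳ {M} p) (⊔ʳ {M} q))
  where
  ≤x : ∀ n → M ℕ.≤ n → δ ≤ seq x n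
  ≤x n M≤n = subst (δ ≤_) (+-identityʳ (seq x n)) (pos n M≤n)
  recip-close : ∀ {a b} → δ ≤ a → δ ≤ b → ∣ a - b ∣ < ε * (δ * δ) → ∣ recip a - recip b ∣ < ε
  recip-close {a} {b} δ≤a δ≤b ab =
    *-cancelʳ-<-nonNeg (a * b) {{nonNegative (<⇒≤ 0<ab)}}
      (<-≤-trans (subst (_< ε * (δ * δ)) (sym scaled) ab)
        (*-monoˡ-≤-nonNeg ε {{nonNegative (<⇒≤ 0<ε)}}
          (*-mono-≤₀ (<⇒≤ 0<δ) (<⇒≤ 0<a) δ≤a δ≤b)))
    where
    0<a = <-≤-trans 0<δ δ≤a
    0<b = <-≤-trans 0<δ δ≤b
    0<ab = 0<* 0<a 0<b
    difference : (recip a - recip b) * (a * b) ≡ b - a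
    difference = trans (id-recip a b (recip a) (recip b))
      (trans (cong₂ (λ s t → s * b - t * a) (recip-inverse (0<⇒≢0 0<a)) (recip-inverse (0<⇒≢0 0<b)))
        (cong₂ _-_ (*-identityˡ b) (*-identityˡ a)))
    scaled : ∣ recip a - recip b ∣ * (a * b) ≡ ∣ a - b ∣
    scaled = trans (cong (∣ recip a - recip b ∣ *_) (sym (0≤p⇒∣p∣≡p (<⇒≤ 0<ab))))
      (trans (sym (∣p*q∣≡∣p∣*∣q∣ (recip a - recip b) (a * b)))
        (trans (cong ∣_∣ difference)
          (trans (sym (∣-p∣≡∣p∣ (b - a)))
            (cong ∣_∣ (id-flip a b)))))

+ℝ-cong : ∀ {x x′ y y′} → x ≈ℝ x′ → y ≈ℝ y′ → x +ℝ y ≈ℝ x′ +ℝ y′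
+ℝ-cong {x} {x′} {y} {y′} xx yy ε 0<ε with xx (½ * ε) (0<½* 0<ε) | yy (½ * ε) (0<½* 0<ε)
... | M , cx | N , cy = M ℕ.⊔ N , λ n p →
  subst (λ t → ∣ t ∣ < ε)
    (id-sum (seq x n) (seq y n) (seq x′ n) (seq y′ n))
    (∣+∣< {seq x n - seq x′ n} {seq y n - seq y′ n} (cx n (⊔ˡ p)) (cy n (⊔ʳ {M} p)))

*ℝ-cong : ∀ {x x′ y y′} → x ≈ℝ x′ → y ≈ℝ y′ → x *ℝ y ≈ℝ x′ *ℝ y′
*ℝ-cong {x} {x′} {y} {y′} xx yy ε 0<ε with bound x | bound y′
... | B , 0<B , M , bx | C , 0<C , N , by
  with xx (tol B C ε) (0<tol 0<B 0<C 0<ε) | yy (tol B C ε) (0<tol 0<B 0<C 0<ε)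
... | M′ , cx | N′ , cy = (M ℕ.⊔ N) ℕ.⊔ (M′ ℕ.⊔ N′) , λ n p →
  *-close {seq x n} {seq y n} {seq x′ n} {seq y′ n} {B} {C} {ε} 0<B 0<C
    (bx n (⊔₁ M N M′ N′ p)) (by n (⊔₂ M N M′ N′ p))
    (cx n (⊔₃ M N M′ N′ p)) (cy n (⊔₄ M N M′ N′ p))

------------------------------------------------------------------------
-- Complex numbers

record ℂ : Set where
  constructor _+i_
  field
    re im : ℝ

open ℂ

infix 4 _≈_

_≈_ : ℂ → ℂ → Set
z ≈ w = re z ≈ℝ re w × im z ≈ℝ im w

0ℂ 1ℂ : ℂ
0ℂ = 0ℝ +i 0ℝ
1ℂ = 1ℝ +i 0ℝ

infixl 6 _+ℂ_ _-ℂ_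
infixl 7 _*ℂ_
infix  8 -ℂ_
infixr 8 _^_

_+ℂ_ _-ℂ_ _*ℂ_ : ℂ → ℂ → ℂ
(a +i b) +ℂ (c +i d) = (a +ℝ c) +i (b +ℝ d)
(a +i b) -ℂ (c +i d) = (a +ℝ -ℝ c) +i (b +ℝ -ℝ d)
(a +i b) *ℂ (c +i d) = (a *ℝ c +ℝ -ℝ (b *ℝ d)) +i (a *ℝ d +ℝ b *ℝ c)

-ℂ_ : ℂ → ℂ
-ℂ (a +i b) = (-ℝ a) +i (-ℝ b)

_^_ : ℂ → ℕ → ℂ
z ^ zero  = 1ℂ
z ^ suc n = z *ℂ z ^ n

∣_∣² : ℂ → ℝ
∣ a +i b ∣² = a *ℝ a +ℝ b *ℝ b

-- |z| < r for a rational r > 0, phrased without a square root.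
infix 4 ∣_∣<_
∣_∣<_ : ℂ → ℚ → Set
∣ z ∣< r = ∣ z ∣² <ℝ ratℝ (r * r)

-- 0 < |z|, i.e. z is apart from 0.  This, and not the mere denial of z ≈ 0ℂ,
-- is the constructive meaning of "nonzero" under which z can be inverted.
infix 4 _≉0
_≉0 : ℂ → Set
z ≉0 = 0ℝ <ℝ ∣ z ∣²

inv : ∀ z → z ≉0 → ℂ
inv z@(a +i b) z≉0 = (a *ℝ r) +i (-ℝ b *ℝ r)
  where r = invℝ ∣ z ∣² z≉0

infixr 8 _^[_]_
_^[_]_ : ∀ z → z ≉0 → ℤ → ℂ
z ^[ _ ] (+ n)        = z ^ n
z ^[ z≉0 ] (-[1+ n ]) = inv z z≉0 ^ suc n

∣∣²-cong : ∀ {z w} → z ≈ w → ∣ z ∣² ≈ℝ ∣ w ∣²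
∣∣²-cong {a +i b} {c +i d} (p , q) =
  +ℝ-cong {a *ℝ a} {c *ℝ c} {b *ℝ b} {d *ℝ d} (*ℝ-cong {a} {c} {a} {c} p p)
    (*ℝ-cong {b} {d} {b} {d} q q)

∣^∣² : ∀ z k n → seq ∣ z ^ k ∣² n ≡ seq ∣ z ∣² n ^ℚ k
∣^∣² z zero    n = refl
∣^∣² z (suc k) n = trans
  (id-norm (seq (re z) n) (seq (im z) n) (seq (re (z ^ k)) n) (seq (im (z ^ k)) n))
  (cong (seq ∣ z ∣² n *_) (∣^∣² z k n))

p≤∣p∣ : ∀ p → p ≤ ∣ p ∣
p≤∣p∣ p with ≤-total 0ℚ p
... | inj₁ 0≤p = ≤-reflexive (sym (0≤p⇒∣p∣≡p 0≤p))
... | inj₂ p≤0 = ≤-trans p≤0 (0≤∣∣ p)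

0<-cong : ∀ {x y} → x ≈ℝ y → 0ℝ <ℝ y → 0ℝ <ℝ x
0<-cong {x} {y} xy (δ , 0<δ , M , pos) with xy (½ * δ) (0<½* 0<δ)
... | N , close = ½ * δ , 0<½* 0<δ , M ℕ.⊔ N , λ n p →
  subst (_≤ seq x n - 0ℚ) half
    (subst (δ + - (½ * δ) ≤_) (rearrange (seq x n) (seq y n))
      (+-mono-≤ (pos n (⊔ˡ p))
        (neg-antimono-≤ (≤-trans (below (seq x n) (seq y n)) (<⇒≤ (close n (⊔ʳ {M} p)))))))
  where
  half : δ + - (½ * δ) ≡ ½ * δ
  half = trans (cong (_+ - (½ * δ)) (sym (half+half δ))) (id-half (½ * δ))
  rearrange : ∀ a b → (b - 0ℚ) + - (b - a) ≡ a - 0ℚ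
  rearrange a b = id-move a b 0ℚ
  below : ∀ a b → b - a ≤ ∣ a - b ∣
  below a b = subst (b - a ≤_)
    (trans (sym (∣-p∣≡∣p∣ (b - a)))
      (cong ∣_∣ (id-flip a b)))
    (p≤∣p∣ (b - a))

^ℚ≤1 : ∀ {a} → 0ℚ ≤ a → a ≤ 1ℚ → ∀ k → a ^ℚ k ≤ 1ℚ
^ℚ≤1 0≤a a≤1 zero = ≤-refl
^ℚ≤1 {a} 0≤a a≤1 (suc k) = ≤-trans
  (*-monoˡ-≤-nonNeg a {{nonNegative 0≤a}} (^ℚ≤1 0≤a a≤1 k))
  (subst (_≤ 1ℚ) (sym (*-identityʳ a)) a≤1)

⊓1≤ : ∀ {a δ} k → 0ℚ ≤ a → δ ≤ a ^ℚ suc k → δ ⊓ 1ℚ ≤ a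
⊓1≤ {a} {δ} k 0≤a δ≤ with ≤-total a 1ℚ
... | inj₁ a≤1 = ≤-trans (p⊓q≤p δ 1ℚ) (≤-trans δ≤
        (subst (a * a ^ℚ k ≤_) (*-identityʳ a)
          (*-monoˡ-≤-nonNeg a {{nonNegative 0≤a}} (^ℚ≤1 0≤a a≤1 k))))
... | inj₂ 1≤a = ≤-trans (p⊓q≤q δ 1ℚ) 1≤a

0<⊓1 : ∀ {δ} → 0ℚ < δ → 0ℚ < δ ⊓ 1ℚ
0<⊓1 {δ} 0<δ with ⊓-sel δ 1ℚ
... | inj₁ e = subst (0ℚ <_) (sym e) 0<δ
... | inj₂ e = subst (0ℚ <_) (sym e) (positive⁻¹ 1ℚ)

0<-root : ∀ x y k → (∀ n → 0ℚ ≤ seq x n) → (∀ n → seq y n ≡ seq x n ^ℚ suc k) → 0ℝ <ℝ y → 0ℝ <ℝ x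
0<-root x y k 0≤x y≡x^k (δ , 0<δ , N , pos) = δ ⊓ 1ℚ , 0<⊓1 0<δ , N , λ n N≤n →
  subst (δ ⊓ 1ℚ ≤_) (sym (+-identityʳ (seq x n)))
    (⊓1≤ k (0≤x n)
      (subst (δ ≤_) (trans (+-identityʳ (seq y n)) (y≡x^k n)) (pos n N≤n)))

0≤∣∣² : ∀ z n → 0ℚ ≤ seq ∣ z ∣² n
0≤∣∣² z n = +-mono-≤ (0≤² (seq (re z) n)) (0≤² (seq (im z) n))

root≉0 : ∀ z w k → z ^ suc k ≈ w → w ≉0 → z ≉0
root≉0 z w k zw w≉0 = 0<-root ∣ z ∣² ∣ z ^ suc k ∣² k (0≤∣∣² z) (∣^∣² z (suc k))
  (0<-cong {∣ z ^ suc k ∣²} {∣ w ∣²} (∣∣²-cong {z ^ suc k} {w} zw) w≉0)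

------------------------------------------------------------------------
-- Infinite sums and products

∑< ∏< : ℕ → (ℕ → ℂ) → ℂ
∑< zero    u = 0ℂ
∑< (suc n) u = ∑< n u +ℂ u n
∏< zero    u = 1ℂ
∏< (suc n) u = ∏< n u *ℂ u n

-- ∏_{n≥0} u n = L
HasProd : (ℕ → ℂ) → ℂ → Set
HasProd u L = ∀ ε → 0ℚ < ε → ∃[ N ] (∀ n → N ℕ.≤ n → ∣ ∏< n u -ℂ L ∣< ε)

-- ∑_{-M ≤ n < N} u n
∑[-_,_⟩ : ℕ → ℕ → (ℤ → ℂ) → ℂ
∑[- M , N ⟩ u = ∑< N (λ n → u (+ n)) +ℂ ∑< M (λ n → u -[1+ n ])

-- ∑_{n∈ℤ} u n = L; the two ends of the sum tend to infinity independently.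
HasSum : (ℤ → ℂ) → ℂ → Set
HasSum u L = ∀ ε → 0ℚ < ε →
  ∃[ K ] (∀ M N → K ℕ.≤ M → K ℕ.≤ N → ∣ ∑[- M , N ⟩ u -ℂ L ∣< ε)

------------------------------------------------------------------------
-- Expressions that need not have a value.
--
-- An infinite sum or product denotes a number only if it converges, and a
-- quotient only if its denominator is nonzero.  An expression is represented
-- by the predicate "z is its value"; each predicate built below holds of at
-- most one z, up to _≈_.

Expr : Set₁
Expr = ℂ → Set

⌜_⌝ : ℂ → Expr
⌜ z ⌝ w = w ≈ z

infixl 6 _⊕_ _⊖_
infixl 7 _⊗_ _⊘_
infix  4 _≐_

_⊕_ _⊖_ _⊗_ _⊘_ : Expr → Expr → Expr
(X ⊕ Y) z = ∃[ x ] ∃[ y ] (X x × Y y × z ≈ x +ℂ y)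
(X ⊖ Y) z = ∃[ x ] ∃[ y ] (X x × Y y × z ≈ x -ℂ y)
(X ⊗ Y) z = ∃[ x ] ∃[ y ] (X x × Y y × z ≈ x *ℂ y)
(X ⊘ Y) z = ∃[ x ] ∃[ y ] (X x × Y y × Σ (y ≉0) λ y≉0 → z ≈ x *ℂ inv y y≉0)

-- Both sides have a value, and the values agree.
_≐_ : Expr → Expr → Set
X ≐ Y = ∃[ z ] (X z × Y z)

Nonzero : Expr → Set
Nonzero X = ∀ z → X z → z ≉0

------------------------------------------------------------------------
-- q-series

-- (a; q)_∞
poch : ℂ → ℂ → Expr
poch a q = HasProd (λ n → 1ℂ -ℂ a *ℂ q ^ n)

-- (a, b; q)_∞
poch₂ : ℂ → ℂ → ℂ → Expr
poch₂ a b q = poch a q ⊗ poch b q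

-- n (n + 1) / 2 and n (n - 1) / 2, which are natural numbers for all n ∈ ℤ.
tri⁺ tri⁻ : ℤ → ℕ
tri⁺ n = ℤ.∣ n ℤ.* (n ℤ.+ + 1) ∣ /ℕ 2
tri⁻ n = ℤ.∣ n ℤ.* (n ℤ.- + 1) ∣ /ℕ 2

-- Ramanujan's f(a, b)
θ : ℂ → ℂ → Expr
θ a b = HasSum (λ n → a ^ tri⁺ n *ℂ b ^ tri⁻ n)

φ ψ : ℂ → Expr
φ q = θ q q
ψ q = θ q (q ^ 3)

{-# OPTIONS --safe #-}

-- Write p = q^{k/4}, a = q^{4i-2} and s = q^{2i-1}, so that a = s².  Splitting the defining series by parity gives
-- f(x, y) = f(x³y, xy³) + x f(y/x, x⁵y³).  For x = s and y = -p/s the two functions on the right are the theta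
-- functions in the denominator and in the numerator of S, so f(x, y) f(-x, -y) is their difference of squares
-- f(-pa, -p³/a)² - s² f(-p/a, -p³a)².  By the triple product f(x, y) f(-x, -y) is also φ(-xy) f(-x², -y²), which is
-- the numerator on the right of the first identity.  For x = √-1 s and y = -√-1 p/s the same argument gives the sum of
-- the squares and the second identity.  The common denominator is ψ(p²) f(-p/a, -pa), which by the triple product
-- equals f(-p/a, -p³a) f(-pa, -p³/a).
--
-- The triple product itself is the limit a = b → ∞ of the q-binomial theorem, in the form
-- (P)_{a+b} ∑_k R(a-k) R(b+k) x^{k(k+1)/2} y^{k(k-1)/2} = (P)_∞² (-x; P)_a (-y; P)_b, where P = xy and
-- R(i) = (P^{i+1}; P)_∞.
module Submission where

open import Algebra.Bundles using (CommutativeRing; RawRing; Semiring)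
import Algebra.Definitions.RawMonoid as RawMonoidDefinitions
import Algebra.Definitions.RawSemiring as RawSemiringDefinitions
open import Algebra.Structures using (IsCommutativeRing)
open import Data.Bool using (Bool; true; false; T)
open import Data.Nat as ℕ using (ℕ; zero; suc)
import Data.Nat.DivMod as ℕ
import Data.Nat.Properties as ℕₚ
import Data.Nat.Tactic.RingSolver as ℕ
open import Data.Integer as ℤ using (ℤ; +_; -[1+_])
import Data.Integer.Properties as ℤₚ
import Data.Integer.Tactic.RingSolver as ℤ
import Data.Rational as ℚ
open import Data.Maybe using (nothing)
open import Data.Product using (_×_; _,_; ∃-syntax; proj₁; proj₂)
open import Data.Sum using (inj₁; inj₂)
open import Data.Empty using (⊥-elim)
open import Level using (0ℓ)
open import Relation.Nullary using (yes; no)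
open import Relation.Binary.PropositionalEquality as ≡ using (_≡_)
open import Tactic.RingSolver.Core.AlmostCommutativeRing using (AlmostCommutativeRing; fromCommutativeRing)
open import Tactic.RingSolver.Core.Polynomial.Parameters using (Homomorphism)
open import Defs using (tri⁺; tri⁻)

-- Ring solver with integer coefficients

-- Three obstacles shape the proof. Norms of complex numbers are only compared with rational bounds,
-- and a limit must come with a modulus, so every convergence claim is reduced to domination by an
-- explicit geometric sequence. Nonzero means apart from zero, so each denominator needs an actual
-- inverse: for (P; P)_∞ it comes from a far tail close to 1, and for the right-hand sides from a
-- factorisation into such products and the two products assumed nonzero. Finally, the arguments of
-- the theta functions can be large, since k/4 - (4i-2) may be negative; only the nome, the product
-- of the two arguments, is small. Terms are therefore written as x^n P^(n(n-1)/2), and estimates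
-- use the nome for decay and an arbitrary bound on x. In the finite identity Gaussian binomials
-- give way to products of values of `R`. This needs no division, R(i) = 0 for i < 0 confines the
-- sum to -b ≤ k ≤ a without a range condition, and each coefficient tends to 1, so the sum tends to
-- the theta series itself.

module IntegerRingSolver (R : CommutativeRing 0ℓ 0ℓ) where
  open import Tactic.RingSolver.Core.Expression using (Expr; Κ; Ι; _⊕_; _⊗_; _⊛_; ⊝_; module Eval)
  open CommutativeRing R
  open import Algebra.Properties.Ring ring
  open import Algebra.Properties.Monoid.Mult +-monoid using (×-homo-+) renaming (_×_ to _·_)
  open import Algebra.Properties.Semiring.Mult semiring using (×1-homo-*)
  open import Algebra.Properties.AbelianGroup +-abelianGroup using (⁻¹-∙-comm)
  open import Algebra.Properties.Semiring.Exp.TCOptimised semiring using (^-congˡ)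
  open import Relation.Binary.Reasoning.Setoid setoid

  ⟦_⟧ℤ : ℤ → Carrier
  ⟦ + n ⟧ℤ      = n · 1#
  ⟦ -[1+ n ] ⟧ℤ = - (suc n · 1#)

  ⊖-homo : ∀ m n → ⟦ m ℤ.⊖ n ⟧ℤ ≈ m · 1# - n · 1#
  ⊖-homo m       zero    = sym (trans (+-congˡ -0#≈0#) (+-identityʳ _))
  ⊖-homo zero    (suc n) = sym (+-identityˡ _)
  ⊖-homo (suc m) (suc n) = begin
    ⟦ suc m ℤ.⊖ suc n ⟧ℤ                      ≡⟨ ≡.cong ⟦_⟧ℤ (ℤₚ.[1+m]⊖[1+n]≡m⊖n m n) ⟩
    ⟦ m ℤ.⊖ n ⟧ℤ                              ≈⟨ ⊖-homo m n ⟩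
    m · 1# - n · 1#                         ≈⟨ +-congʳ (+-identityʳ _) ⟨
    m · 1# + 0# - n · 1#                    ≈⟨ +-congʳ (+-congˡ (-‿inverseʳ 1#)) ⟨
    m · 1# + (1# - 1#) - n · 1#             ≈⟨ +-congʳ (+-assoc _ _ _) ⟨
    m · 1# + 1# - 1# - n · 1#               ≈⟨ +-congʳ (+-congʳ (+-comm _ _)) ⟩
    1# + m · 1# - 1# - n · 1#               ≈⟨ +-assoc _ _ _ ⟩
    1# + m · 1# + (- 1# - n · 1#)           ≈⟨ +-congˡ (⁻¹-∙-comm _ _) ⟩
    1# + m · 1# - (1# + n · 1#)             ∎

  +-homo : ∀ i j → ⟦ i ℤ.+ j ⟧ℤ ≈ ⟦ i ⟧ℤ + ⟦ j ⟧ℤ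
  +-homo (+ m)      (+ n)      = ×-homo-+ 1# m n
  +-homo (+ m)      -[1+ n ]   = ⊖-homo m (suc n)
  +-homo -[1+ m ]   (+ n)      = trans (⊖-homo n (suc m)) (+-comm _ _)
  +-homo -[1+ m ]   -[1+ n ]   = begin
    - (suc (suc (m ℕ.+ n)) · 1#)     ≡⟨ ≡.cong (λ k → - (suc k · 1#)) (ℕₚ.+-suc m n) ⟨
    - ((suc m ℕ.+ suc n) · 1#)       ≈⟨ -‿cong (×-homo-+ 1# (suc m) (suc n)) ⟩
    - (suc m · 1# + suc n · 1#)      ≈⟨ ⁻¹-∙-comm _ _ ⟨
    - (suc m · 1#) - suc n · 1#      ∎

  -‿homo : ∀ i → ⟦ ℤ.- i ⟧ℤ ≈ - ⟦ i ⟧ℤ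
  -‿homo (+ zero)  = sym -0#≈0#
  -‿homo (+ suc n) = refl
  -‿homo -[1+ n ]  = sym (-‿involutive _)

  *-homo⁺ : ∀ m n → ⟦ + m ℤ.* + n ⟧ℤ ≈ ⟦ + m ⟧ℤ * ⟦ + n ⟧ℤ
  *-homo⁺ m n = trans (reflexive (≡.cong ⟦_⟧ℤ (≡.sym (ℤₚ.pos-* m n)))) (×1-homo-* m n)

  *-homoˡ : ∀ i n → ⟦ i ℤ.* + n ⟧ℤ ≈ ⟦ i ⟧ℤ * ⟦ + n ⟧ℤ
  *-homoˡ (+ m)    n = *-homo⁺ m n
  *-homoˡ -[1+ m ] n = begin
    ⟦ -[1+ m ] ℤ.* + n ⟧ℤ        ≡⟨ ≡.cong ⟦_⟧ℤ (ℤₚ.neg-distribˡ-* (+ suc m) (+ n)) ⟨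
    ⟦ ℤ.- (+ suc m ℤ.* + n) ⟧ℤ   ≈⟨ -‿homo (+ suc m ℤ.* + n) ⟩
    - ⟦ + suc m ℤ.* + n ⟧ℤ       ≈⟨ -‿cong (*-homo⁺ (suc m) n) ⟩
    - (suc m · 1# * n · 1#)      ≈⟨ -‿distribˡ-* _ _ ⟩
    - (suc m · 1#) * n · 1#      ∎

  *-homo : ∀ i j → ⟦ i ℤ.* j ⟧ℤ ≈ ⟦ i ⟧ℤ * ⟦ j ⟧ℤ
  *-homo i (+ n)    = *-homoˡ i n
  *-homo i -[1+ n ] = begin
    ⟦ i ℤ.* -[1+ n ] ⟧ℤ          ≡⟨ ≡.cong ⟦_⟧ℤ (ℤₚ.neg-distribʳ-* i (+ suc n)) ⟨
    ⟦ ℤ.- (i ℤ.* + suc n) ⟧ℤ     ≈⟨ -‿homo (i ℤ.* + suc n) ⟩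
    - ⟦ i ℤ.* + suc n ⟧ℤ         ≈⟨ -‿cong (*-homoˡ i (suc n)) ⟩
    - (⟦ i ⟧ℤ * suc n · 1#)      ≈⟨ -‿distribʳ-* _ _ ⟩
    ⟦ i ⟧ℤ * - (suc n · 1#)      ∎

  ℤ-rawRing : RawRing 0ℓ 0ℓ
  ℤ-rawRing = record
    { Carrier = ℤ ; _≈_ = _≡_ ; _+_ = ℤ._+_ ; _*_ = ℤ._*_ ; -_ = ℤ.-_ ; 0# = + 0 ; 1# = + 1 }

  -- Unlike ⟦_⟧ℤ, sends 1 to 1# definitionally, so that the constant 1 of a polynomial is read as 1#.
  embed : ℤ → Carrier
  embed (+ 1) = 1#
  embed i     = ⟦ i ⟧ℤ

  embed≈ : ∀ i → embed i ≈ ⟦ i ⟧ℤ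
  embed≈ (+ 0)           = refl
  embed≈ (+ 1)           = sym (+-identityʳ 1#)
  embed≈ (+ suc (suc n)) = refl
  embed≈ -[1+ n ]        = refl

  -- Equality in the ring need not be decidable, so its own zero test always abstains. Vanishing
  -- coefficients are recognised in ℤ instead, by `isZero` in `homomorphism`.
  almostCommutativeRing : AlmostCommutativeRing 0ℓ 0ℓ
  almostCommutativeRing = fromCommutativeRing R (λ _ → nothing)

  homomorphism : Homomorphism 0ℓ 0ℓ 0ℓ 0ℓ
  homomorphism = record
    { from     = record { rawRing = ℤ-rawRing ; isZero = isZero }
    ; to       = almostCommutativeRing
    ; morphism = record
      { ⟦_⟧    = embed
      ; +-homo = λ i j → trans (embed≈ (i ℤ.+ j)) (trans (+-homo i j) (sym (+-cong (embed≈ i) (embed≈ j))))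
      ; *-homo = λ i j → trans (embed≈ (i ℤ.* j)) (trans (*-homo i j) (sym (*-cong (embed≈ i) (embed≈ j))))
      ; -‿homo = λ i → trans (embed≈ (ℤ.- i)) (trans (-‿homo i) (-‿cong (sym (embed≈ i))))
      ; 0-homo = refl
      ; 1-homo = refl
      }
    ; Zero-C⟶Zero-R = isZero⇒0
    }
    where
    isZero : ℤ → Bool
    isZero (+ 0) = true
    isZero _     = false
    isZero⇒0 : ∀ i → T (isZero i) → 0# ≈ embed i
    isZero⇒0 (+ 0) _ = refl

  open import Tactic.RingSolver.Core.Polynomial.Base (Homomorphism.from homomorphism)
  open import Tactic.RingSolver.Core.Polynomial.Semantics homomorphism renaming (⟦_⟧ to ⟦_⟧ₚ)
  open import Tactic.RingSolver.Core.Polynomial.Homomorphism homomorphism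
  open Eval (AlmostCommutativeRing.rawRing almostCommutativeRing) embed renaming (⟦_⟧ to ⟦_⟧ₑ)

  normalise : ∀ {n} → Expr ℤ n → Poly n
  normalise (Κ i)   = κ i
  normalise (Ι x)   = ι x
  normalise (x ⊕ y) = normalise x ⊞ normalise y
  normalise (x ⊗ y) = normalise x ⊠ normalise y
  normalise (⊝ x)   = ⊟ normalise x
  normalise (x ⊛ i) = normalise x ⊡ i

  correct : ∀ {n} (e : Expr ℤ n) ρ → ⟦ normalise e ⟧ₚ ρ ≈ ⟦ e ⟧ₑ ρ
  correct (Κ i)   ρ = κ-hom i ρ
  correct (Ι x)   ρ = ι-hom x ρ
  correct (x ⊕ y) ρ = trans (⊞-hom (normalise x) (normalise y) ρ) (+-cong (correct x ρ) (correct y ρ))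
  correct (x ⊗ y) ρ = trans (⊠-hom (normalise x) (normalise y) ρ) (*-cong (correct x ρ) (correct y ρ))
  correct (⊝ x)   ρ = trans (⊟-hom (normalise x) ρ) (-‿cong (correct x ρ))
  correct (x ⊛ i) ρ = trans (⊡-hom (normalise x) i ρ) (^-congˡ i (correct x ρ))

  open import Relation.Binary.Reflection setoid Ι ⟦_⟧ₑ (λ e → ⟦ normalise e ⟧ₚ) correct public
    using (solve)

module PolynomialSyntax where
  open import Tactic.RingSolver.Core.Expression using (Expr; Κ; _⊕_; _⊗_; ⊝_)

  infix  4 _:=_
  infixl 6 _:+_ _:-_
  infixl 7 _:*_
  infix  8 :-_

  _:=_ : ∀ {n} → Expr ℤ n → Expr ℤ n → Expr ℤ n × Expr ℤ n
  _:=_ = _,_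

  _:+_ _:-_ _:*_ : ∀ {n} → Expr ℤ n → Expr ℤ n → Expr ℤ n
  _:+_ = _⊕_
  _:*_ = _⊗_
  x :- y = x ⊕ ⊝ y

  :-_ : ∀ {n} → Expr ℤ n → Expr ℤ n
  :-_ = ⊝_

  :0 :1 : ∀ {n} → Expr ℤ n
  :0 = Κ (+ 0)
  :1 = Κ (+ 1)

-- Archimedean fields and complete normed rings

record ArchimedeanField : Set₁ where
  infixl 6 _+_
  infixl 7 _*_
  infix  8 -_
  infix  4 _≤_
  field
    Carrier           : Set
    _+_ _*_           : Carrier → Carrier → Carrier
    -_                : Carrier → Carrier
    0# 1#             : Carrier
    isCommutativeRing : IsCommutativeRing _≡_ _+_ _*_ -_ 0# 1#

  commutativeRing : CommutativeRing 0ℓ 0ℓ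
  commutativeRing = record { isCommutativeRing = isCommutativeRing }

  open CommutativeRing commutativeRing public using (_-_; *-comm; +-comm; +-identityʳ; *-identityˡ; *-identityʳ)
  open RawMonoidDefinitions (CommutativeRing.+-rawMonoid commutativeRing) using () renaming (_×_ to _·_) public
  open RawSemiringDefinitions (Semiring.rawSemiring (CommutativeRing.semiring commutativeRing)) using (_^_) public

  field
    _≤_         : Carrier → Carrier → Set
    ≤-refl      : ∀ {a} → a ≤ a
    ≤-trans     : ∀ {a b c} → a ≤ b → b ≤ c → a ≤ c
    +-monoˡ-≤   : ∀ c {a b} → a ≤ b → a + c ≤ b + c
    0≤*         : ∀ {a b} → 0# ≤ a → 0# ≤ b → 0# ≤ a * b
    Positive    : Carrier → Set
    positive⇒0≤ : ∀ {a} → Positive a → 0# ≤ a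
    positive-1  : Positive 1#
    positive-*  : ∀ {a b} → Positive a → Positive b → Positive (a * b)
    positive-≤  : ∀ {a b} → Positive a → a ≤ b → Positive b
    reciprocal  : ∀ {a} → Positive a → ∃[ b ] (Positive b × a * b ≡ 1#)
    archimedean : ∀ a → ∃[ n ] a ≤ n · 1#

-- Estimates in an Archimedean ordered field

module ArchimedeanFieldProperties (F : ArchimedeanField) where
  open ArchimedeanField F
  open IntegerRingSolver commutativeRing
  open PolynomialSyntax

  opaque
    ≤-reflexive : ∀ {a b} → a ≡ b → a ≤ b
    ≤-reflexive ≡.refl = ≤-refl

    ≤-by : ∀ {a b c} → 0# ≤ c → a + c ≡ b → a ≤ b
    ≤-by {a} {b} {c} 0≤c a+c≡b = ≤-trans (≤-reflexive (solve 1 (λ a → a := :0 :+ a) ≡.refl a))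
      (≤-trans (+-monoˡ-≤ a 0≤c) (≤-reflexive (≡.trans (+-comm c a) a+c≡b)))

    0≤- : ∀ {a b} → a ≤ b → 0# ≤ b - a
    0≤- {a} {b} a≤b = ≤-trans (≤-reflexive (solve 1 (λ a → :0 := a :- a) ≡.refl a)) (+-monoˡ-≤ (- a) a≤b)

    +-mono-≤ : ∀ {a b c d} → a ≤ b → c ≤ d → a + c ≤ b + d
    +-mono-≤ {a} {b} {c} {d} a≤b c≤d = ≤-trans (+-monoˡ-≤ c a≤b)
      (≤-trans (≤-reflexive (+-comm b c)) (≤-trans (+-monoˡ-≤ b c≤d) (≤-reflexive (+-comm d b))))

    0≤+ : ∀ {a b} → 0# ≤ a → 0# ≤ b → 0# ≤ a + b
    0≤+ 0≤a 0≤b = ≤-trans (≤-reflexive (≡.sym (+-identityʳ 0#))) (+-mono-≤ 0≤a 0≤b)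

    *-monoˡ-≤ : ∀ {a b c} → 0# ≤ c → a ≤ b → a * c ≤ b * c
    *-monoˡ-≤ {a} {b} {c} 0≤c a≤b = ≤-by (0≤* (0≤- a≤b) 0≤c)
      (solve 3 (λ a b c → a :* c :+ (b :- a) :* c := b :* c) ≡.refl a b c)

    *-monoʳ-≤ : ∀ {a b c} → 0# ≤ c → a ≤ b → c * a ≤ c * b
    *-monoʳ-≤ {a} {b} {c} 0≤c a≤b = ≡.subst₂ _≤_ (*-comm a c) (*-comm b c) (*-monoˡ-≤ 0≤c a≤b)

    *-mono-≤ : ∀ {a b c d} → 0# ≤ c → 0# ≤ b → a ≤ b → c ≤ d → a * c ≤ b * d
    *-mono-≤ 0≤c 0≤b a≤b c≤d = ≤-trans (*-monoˡ-≤ 0≤c a≤b) (*-monoʳ-≤ 0≤b c≤d)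

    0≤1 : 0# ≤ 1#
    0≤1 = positive⇒0≤ positive-1

    ≤+ : ∀ {a b} → 0# ≤ b → a ≤ a + b
    ≤+ 0≤b = ≤-by 0≤b ≡.refl

    +≤ : ∀ {a b} → 0# ≤ b → a ≤ b + a
    +≤ {a} {b} 0≤b = ≤-by 0≤b (+-comm a b)

    0≤^ : ∀ {a} → 0# ≤ a → ∀ n → 0# ≤ a ^ n
    0≤^ 0≤a zero    = 0≤1
    0≤^ 0≤a (suc n) = 0≤* 0≤a (0≤^ 0≤a n)

    0≤· : ∀ n → 0# ≤ n · 1#
    0≤· zero    = ≤-refl
    0≤· (suc n) = 0≤+ 0≤1 (0≤· n)

    ·-mono-≤ : ∀ {m n} → m ℕ.≤ n → m · 1# ≤ n · 1#
    ·-mono-≤ {n = n} ℕ.z≤n = 0≤· n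
    ·-mono-≤ (ℕ.s≤s m≤n) = +-mono-≤ ≤-refl (·-mono-≤ m≤n)

    positive-1+ : ∀ {a} → 0# ≤ a → Positive (a + 1#)
    positive-1+ 0≤a = positive-≤ positive-1 (+≤ 0≤a)

    half : ∀ {ε} → Positive ε → ∃[ δ ] (Positive δ × δ + δ ≡ ε)
    half {ε} 0<ε with reciprocal (positive-1+ 0≤1)
    ... | h , 0<h , 2h≡1 = ε * h , positive-* 0<ε 0<h , (begin
      ε * h + ε * h     ≡⟨ solve 2 (λ ε h → ε :* h :+ ε :* h := ε :* ((:1 :+ :1) :* h)) ≡.refl ε h ⟩
      ε * ((1# + 1#) * h) ≡⟨ ≡.cong (ε *_) 2h≡1 ⟩
      ε * 1#            ≡⟨ *-identityʳ ε ⟩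
      ε                 ∎)
      where open ≡.≡-Reasoning

    -- Dividing `ε` by A + 1 instead of A keeps the divisor positive when A vanishes.
    shrink : ∀ {A ε} → 0# ≤ A → Positive ε → ∃[ δ ] (Positive δ × δ * A ≤ ε)
    shrink {A} {ε} 0≤A 0<ε with reciprocal (positive-1+ 0≤A)
    ... | b , 0<b , [A+1]b≡1 = ε * b , positive-* 0<ε 0<b ,
      ≤-trans (*-monoʳ-≤ (positive⇒0≤ (positive-* 0<ε 0<b)) (≤+ 0≤1))
        (≤-reflexive (≡.trans (solve 3 (λ ε b c → ε :* b :* c := ε :* (c :* b)) ≡.refl ε b (A + 1#))
          (≡.trans (≡.cong (ε *_) [A+1]b≡1) (*-identityʳ ε))))

  Vanishing : (ℕ → Carrier) → Set
  Vanishing f = ∀ ε → Positive ε → ∃[ N ] (∀ n → N ℕ.≤ n → f n ≤ ε)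

  -- Besides lying below 1, the ratio is kept positive because `ratio-test` and `monomialBound`
  -- divide by it.
  record Contraction : Set where
    no-eta-equality
    field
      ratio     : Carrier
      positive  : Positive ratio
      below-1   : Positive (1# - ratio)

    nonneg : 0# ≤ ratio
    nonneg = positive⇒0≤ positive

  open Contraction

  opaque
    -- Bernoulli's inequality in inverted, division-free form. With h = 1 - r, the left side drops
    -- by exactly r^n (n+1) h² from n to n + 1.
    bernoulli : ∀ (ρ : Contraction) n → ratio ρ ^ n * (1# + n · 1# * (1# - ratio ρ)) ≤ 1#
    bernoulli ρ zero    = ≤-reflexive (solve 1 (λ r → :1 :* (:1 :+ :0 :* (:1 :- r)) := :1) ≡.refl (ratio ρ))
    bernoulli ρ (suc n) = ≤-trans
      (≤-by (0≤* (0≤^ (nonneg ρ) n) (0≤* (0≤· (suc n)) (0≤* 0≤h 0≤h)))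
        (solve 3 (λ r w ν → (r :* w) :* (:1 :+ (:1 :+ ν) :* (:1 :- r)) :+ w :* ((:1 :+ ν) :* ((:1 :- r) :* (:1 :- r)))
            := w :* (:1 :+ ν :* (:1 :- r))) ≡.refl (ratio ρ) (ratio ρ ^ n) (n · 1#)))
      (bernoulli ρ n)
      where
      0≤h : 0# ≤ 1# - ratio ρ
      0≤h = positive⇒0≤ (below-1 ρ)

    -- With h = 1 - r, the Archimedean property gives N ≥ A / (h ε). For n ≥ N then A ≤ n h ε, so A
    -- r^n ≤ r^n (1 + n h) ε, which `bernoulli` bounds by ε.
    geometric-vanishing : ∀ (ρ : Contraction) {A} → 0# ≤ A → Vanishing (λ n → A * ratio ρ ^ n)
    geometric-vanishing ρ {A} 0≤A ε 0<ε with reciprocal (positive-* (below-1 ρ) 0<ε)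
    ... | b , 0<b , hεb≡1 with archimedean (A * b)
    ... | N , Ab≤N = N , λ n N≤n →
      let h   = 1# - ratio ρ
          w   = ratio ρ ^ n
          ν   = n · 1#
          0≤w = 0≤^ (nonneg ρ) n
          0≤ε = positive⇒0≤ 0<ε
          0≤hε = positive⇒0≤ (positive-* (below-1 ρ) 0<ε)
          A≤νhε : A ≤ ν * (h * ε)
          A≤νhε = ≤-trans (≤-reflexive (≡.trans (≡.sym (*-identityʳ A)) (≡.trans (≡.cong (A *_) (≡.sym hεb≡1))
                    (solve 3 (λ A b c → A :* (c :* b) := A :* b :* c) ≡.refl A b (h * ε)))))
                    (*-monoˡ-≤ 0≤hε (≤-trans Ab≤N (·-mono-≤ N≤n)))
      in ≤-trans (*-monoˡ-≤ 0≤w A≤νhε)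
           (≤-trans (≤-by (0≤* 0≤w 0≤ε)
             (solve 4 (λ ν h ε w → ν :* (h :* ε) :* w :+ w :* ε := (w :* (:1 :+ ν :* h)) :* ε) ≡.refl ν h ε w))
             (≤-trans (*-monoˡ-≤ 0≤ε (bernoulli ρ n)) (≤-reflexive (*-identityˡ ε))))

    -- Induction on the index from which the quotients are small. Undoing a shift of the sequence
    -- divides the constant by the ratio and adds the first term.
    ratio-test : ∀ (ρ : Contraction) (c e : ℕ → Carrier) → (∀ n → 0# ≤ c n) → (∀ n → 0# ≤ e n) →
      (∀ n → e (suc n) ≡ c n * e n) → ∀ N → (∀ n → N ℕ.≤ n → c n ≤ ratio ρ) →
      ∃[ C ] (0# ≤ C × (∀ n → e n ≤ C * ratio ρ ^ n))
    ratio-test ρ c e 0≤c 0≤e step zero c≤ρ = e 0 , 0≤e 0 , bound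
      where
      bound : ∀ n → e n ≤ e 0 * ratio ρ ^ n
      bound zero    = ≤-reflexive (≡.sym (*-identityʳ (e 0)))
      bound (suc n) = ≤-trans (≤-reflexive (step n))
        (≤-trans (*-mono-≤ (0≤e n) (nonneg ρ) (c≤ρ n ℕ.z≤n) (bound n))
          (≤-reflexive (solve 3 (λ r a w → r :* (a :* w) := a :* (r :* w)) ≡.refl (ratio ρ) (e 0) (ratio ρ ^ n))))
    ratio-test ρ c e 0≤c 0≤e step (suc N) c≤ρ
      with ratio-test ρ (λ n → c (suc n)) (λ n → e (suc n)) (λ n → 0≤c (suc n)) (λ n → 0≤e (suc n))
             (λ n → step (suc n)) N (λ n N≤n → c≤ρ (suc n) (ℕ.s≤s N≤n))
         | reciprocal (positive ρ)
    ... | C , 0≤C , bound | b , 0<b , ρb≡1 = e 0 + C * b , 0≤+ (0≤e 0) 0≤Cb , λ where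
        zero    → ≤-trans (≤+ 0≤Cb) (≤-reflexive (≡.sym (*-identityʳ _)))
        (suc n) → ≤-trans (bound n) (≤-by (0≤* (0≤e 0) (0≤^ (nonneg ρ) (suc n)))
          (≡.trans (≡.cong (λ t → t + e 0 * (ratio ρ ^ suc n))
              (≡.trans (≡.sym (*-identityʳ _)) (≡.cong (C * ratio ρ ^ n *_) (≡.sym ρb≡1))))
            (solve 5 (λ a C b r w → (C :* w) :* (r :* b) :+ a :* (r :* w) := (a :+ C :* b) :* (r :* w))
              ≡.refl (e 0) C b (ratio ρ) (ratio ρ ^ n))))
      where
      0≤Cb : 0# ≤ C * b
      0≤Cb = 0≤* 0≤C (positive⇒0≤ 0<b)

  -- leaves room for perturbations of ρ
  relax : ∀ (ρ : Contraction) → ∃[ σ ] ∃[ δ ] (Positive δ × ratio ρ + δ ≡ ratio σ)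
  relax ρ with half (below-1 ρ)
  ... | δ , 0<δ , 2δ≡1-ρ = record
      { ratio    = ratio ρ + δ
      ; positive = positive-≤ (positive ρ) (≤+ (positive⇒0≤ 0<δ))
      ; below-1  = ≡.subst Positive (≡.sym complement) 0<δ
      } , δ , 0<δ , ≡.refl
    where
    complement : 1# - (ratio ρ + δ) ≡ δ
    complement = ≡.trans (solve 2 (λ r δ → :1 :- (r :+ δ) := (:1 :- r) :- δ) ≡.refl (ratio ρ) δ)
      (≡.trans (≡.cong (_- δ) (≡.sym 2δ≡1-ρ)) (solve 1 (λ δ → δ :+ δ :- δ := δ) ≡.refl δ))

  opaque
    below-1-* : ∀ {a b} → 0# ≤ a → Positive (1# - a) → Positive (1# - b) → Positive (1# - a * b)
    below-1-* {a} {b} 0≤a a<1 b<1 = positive-≤ a<1 (≤-by (0≤* 0≤a (positive⇒0≤ b<1))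
      (solve 2 (λ a b → (:1 :- a) :+ a :* (:1 :- b) := :1 :- a :* b) ≡.refl a b))

  _⊗_ : Contraction → Contraction → Contraction
  ρ ⊗ σ = record
    { ratio    = ratio ρ * ratio σ
    ; positive = positive-* (positive ρ) (positive σ)
    ; below-1  = below-1-* (nonneg ρ) (below-1 ρ) (below-1 σ)
    }

record CompleteNormedRing (F : ArchimedeanField) : Set₁ where
  open ArchimedeanField F using (_≤_; Positive)
    renaming (Carrier to K; _+_ to _+ᵏ_; _*_ to _*ᵏ_; 0# to 0ᵏ; 1# to 1ᵏ)
  field
    commutativeRing : CommutativeRing 0ℓ 0ℓ

  open CommutativeRing commutativeRing public

  infix 4 _≼_
  field
    -- x ≼ r means that the norm of x is at most r; the norm itself need not be an element of K.
    _≼_      : Carrier → K → Set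
    ≼-resp-≈ : ∀ {x y r} → x ≈ y → x ≼ r → y ≼ r
    ≼-mono   : ∀ {x r s} → x ≼ r → r ≤ s → x ≼ s
    ≼⇒0≤     : ∀ {x r} → x ≼ r → 0ᵏ ≤ r
    ≼-0      : 0# ≼ 0ᵏ
    ≼-1      : 1# ≼ 1ᵏ
    ≼-+      : ∀ {x y r s} → x ≼ r → y ≼ s → x + y ≼ r +ᵏ s
    ≼-*      : ∀ {x y r s} → x ≼ r → y ≼ s → x * y ≼ r *ᵏ s
    ≼-neg    : ∀ {x r} → x ≼ r → - x ≼ r
    ≼-closed : ∀ {x r} → 0ᵏ ≤ r → (∀ ε → Positive ε → x ≼ r +ᵏ ε) → x ≼ r
    ≼0⇒≈0    : ∀ {x} → x ≼ 0ᵏ → x ≈ 0#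
    bounded  : ∀ x → ∃[ r ] x ≼ r
    complete : (s : ℕ → Carrier) →
      (∀ ε → Positive ε → ∃[ N ] (∀ m n → N ℕ.≤ m → N ℕ.≤ n → s m - s n ≼ ε)) →
      ∃[ L ] (∀ ε → Positive ε → ∃[ N ] (∀ n → N ℕ.≤ n → s n - L ≼ ε))

-- Limits and series in a complete normed ring

module Analysis {F : ArchimedeanField} (𝔸 : CompleteNormedRing F) where
  open ArchimedeanField F public using
    (_≤_; ≤-refl; ≤-trans; Positive; positive⇒0≤; positive-1; positive-*; positive-≤; 0≤*; reciprocal)
    renaming (Carrier to K; _+_ to _+ᵏ_; _*_ to _*ᵏ_; _-_ to _-ᵏ_; 0# to 0ᵏ; 1# to 1ᵏ; _^_ to _^ᵏ_; *-identityʳ to *ᵏ-identityʳ)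
  open ArchimedeanFieldProperties F public
  open CompleteNormedRing 𝔸 public
  open Contraction public
  open IntegerRingSolver (ArchimedeanField.commutativeRing F) public using () renaming (solve to solveᵏ)
  open IntegerRingSolver commutativeRing public using (solve)
  open PolynomialSyntax public
  open import Algebra.Properties.Semiring.Exp semiring public using (_^_)
  open import Relation.Binary.Reasoning.Setoid setoid

  record Limit (s : ℕ → Carrier) (L : Carrier) : Set where
    constructor limit
    field close : ∀ ε → Positive ε → ∃[ N ] (∀ n → N ℕ.≤ n → s n - L ≼ ε)

  open Limit public

  Cauchy : (ℕ → Carrier) → Set
  Cauchy s = ∀ ε → Positive ε → ∃[ N ] (∀ m n → N ℕ.≤ m → N ℕ.≤ n → s m - s n ≼ ε)

  opaque
    ≼ε-0 : ∀ {x ε} → x ≈ 0# → 0ᵏ ≤ ε → x ≼ ε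
    ≼ε-0 x≈0 0≤ε = ≼-mono (≼-resp-≈ (sym x≈0) ≼-0) 0≤ε

    ≼-≡ : ∀ {x r s} → r ≡ s → x ≼ r → x ≼ s
    ≼-≡ ≡.refl x≼r = x≼r

    ≼-sub : ∀ {x y r s} → x ≼ r → y ≼ s → x - y ≼ r +ᵏ s
    ≼-sub x≼r y≼s = ≼-+ x≼r (≼-neg y≼s)

    ≼-^ : ∀ {x r} → x ≼ r → ∀ n → x ^ n ≼ r ^ᵏ n
    ≼-^ x≼r zero    = ≼-1
    ≼-^ x≼r (suc n) = ≼-* x≼r (≼-^ x≼r n)

    limit-const : ∀ x → Limit (λ _ → x) x
    close (limit-const x) ε 0<ε = 0 , λ _ _ → ≼ε-0 (-‿inverseʳ x) (positive⇒0≤ 0<ε)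

    limit-cong : ∀ {s t L M} → (∀ n → s n ≈ t n) → L ≈ M → Limit s L → Limit t M
    close (limit-cong s≈t L≈M s→L) ε 0<ε with close s→L ε 0<ε
    ... | N , near = N , λ n N≤n → ≼-resp-≈ (+-cong (s≈t n) (-‿cong L≈M)) (near n N≤n)

    limit-∘ : ∀ {s L} (f : ℕ → ℕ) → (∀ n → n ℕ.≤ f n) → Limit s L → Limit (λ n → s (f n)) L
    close (limit-∘ f n≤fn s→L) ε 0<ε with close s→L ε 0<ε
    ... | N , near = N , λ n N≤n → near (f n) (ℕₚ.≤-trans N≤n (n≤fn n))

    limit-+ : ∀ {s t L M} → Limit s L → Limit t M → Limit (λ n → s n + t n) (L + M)
    close (limit-+ {s} {t} {L} {M} s→L t→M) ε 0<ε with half 0<ε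
    ... | δ , 0<δ , 2δ≡ε with close s→L δ 0<δ | close t→M δ 0<δ
    ... | N₁ , near₁ | N₂ , near₂ = N₁ ℕ.⊔ N₂ , λ n N≤n → ≼-≡ 2δ≡ε
      (≼-resp-≈ (solve 4 (λ s t L M → (s :- L) :+ (t :- M) := s :+ t :- (L :+ M)) refl (s n) (t n) L M)
        (≼-+ (near₁ n (ℕₚ.≤-trans (ℕₚ.m≤m⊔n N₁ N₂) N≤n)) (near₂ n (ℕₚ.≤-trans (ℕₚ.m≤n⊔m N₁ N₂) N≤n))))

    limit-* : ∀ {s t L M} → Limit s L → Limit t M → Limit (λ n → s n * t n) (L * M)
    close (limit-* {s} {t} {L} {M} s→L t→M) ε 0<ε with bounded L | bounded M
    -- δ (1 + m + l) ≤ ε covers both terms of (s - L) t + L (t - M). The extra index `N₃`, at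
    -- tolerance 1, is what bounds `t n` by 1 + m.
    ... | l , L≼l | m , M≼m with shrink (0≤+ (0≤+ 0≤1 (≼⇒0≤ M≼m)) (≼⇒0≤ L≼l)) 0<ε
    ... | δ , 0<δ , δA≤ε with close s→L δ 0<δ | close t→M δ 0<δ | close t→M 1ᵏ positive-1
    ... | N₁ , near₁ | N₂ , near₂ | N₃ , near₃ = N₁ ℕ.⊔ (N₂ ℕ.⊔ N₃) , λ n N≤n →
      let ≤₁ = ℕₚ.≤-trans (ℕₚ.m≤m⊔n N₁ (N₂ ℕ.⊔ N₃)) N≤n
          ≤₂₃ = ℕₚ.≤-trans (ℕₚ.m≤n⊔m N₁ (N₂ ℕ.⊔ N₃)) N≤n
          ≤₂ = ℕₚ.≤-trans (ℕₚ.m≤m⊔n N₂ N₃) ≤₂₃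
          ≤₃ = ℕₚ.≤-trans (ℕₚ.m≤n⊔m N₂ N₃) ≤₂₃
          t≼ : t n ≼ 1ᵏ +ᵏ m
          t≼ = ≼-resp-≈ (solve 2 (λ t M → t :- M :+ M := t) refl (t n) M) (≼-+ (near₃ n ≤₃) M≼m)
      in ≼-mono
        (≼-resp-≈ (solve 4 (λ s t L M → (s :- L) :* t :+ L :* (t :- M) := s :* t :- L :* M) refl (s n) (t n) L M)
          (≼-+ (≼-* (near₁ n ≤₁) t≼) (≼-* L≼l (near₂ n ≤₂))))
        (≤-trans (≤-reflexive (solveᵏ 3
          (λ δ m l → δ :* (:1 :+ m) :+ l :* δ := δ :* (:1 :+ m :+ l)) ≡.refl δ m l)) δA≤ε)

    limit-scale : ∀ {s L} c → Limit s L → Limit (λ n → c * s n) (c * L)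
    limit-scale c = limit-* (limit-const c)

    -1* : ∀ x → - 1# * x ≈ - x
    -1* = solve 1 (λ x → :- :1 :* x := :- x) refl

    limit-sub : ∀ {s t L M} → Limit s L → Limit t M → Limit (λ n → s n - t n) (L - M)
    limit-sub {s} {t} {L} {M} s→L t→M = limit-cong (λ n → +-congˡ (-1* (t n))) (+-congˡ (-1* M))
      (limit-+ s→L (limit-scale (- 1#) t→M))

    limit-≼ : ∀ {s L r} → (∀ n → s n ≼ r) → Limit s L → L ≼ r
    limit-≼ {s} {L} s≼r s→L = ≼-closed (≼⇒0≤ (s≼r 0)) λ ε 0<ε →
      let N , near = close s→L ε 0<ε
      in ≼-resp-≈ (solve 2 (λ s L → s :- (s :- L) := L) refl (s N) L) (≼-sub (s≼r N) (near N ℕₚ.≤-refl))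

    limit-unique : ∀ {s L M} → Limit s L → Limit s M → L ≈ M
    limit-unique {s} {L} {M} s→L s→M = begin
      L          ≈⟨ solve 2 (λ L M → L := (L :- M) :+ M) refl L M ⟩
      L - M + M  ≈⟨ +-congʳ (≼0⇒≈0 (≼-closed ≤-refl λ ε 0<ε → let N , near = close difference ε 0<ε in
                     ≼-≡ (solveᵏ 1 (λ ε → ε := :0 :+ ε) ≡.refl ε)
                       (≼-resp-≈ (solve 3 (λ s L M → :- (s :- s :- (L :- M)) := L :- M) refl (s N) L M)
                         (≼-neg (near N ℕₚ.≤-refl))))) ⟩
      0# + M     ≈⟨ +-identityˡ M ⟩
      M          ∎
      where
      difference : Limit (λ n → s n - s n) (L - M)
      difference = limit-sub s→L s→M

    limit-vanishing : ∀ {s L f} → (∀ n → s n - L ≼ f n) → Vanishing f → Limit s L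
    close (limit-vanishing near f→0) ε 0<ε with f→0 ε 0<ε
    ... | N , f≤ε = N , λ n N≤n → ≼-mono (near n) (f≤ε n N≤n)

    limit⇒bounded : ∀ {s L} → Limit s L → ∃[ B ] ∃[ N ] (∀ n → N ℕ.≤ n → s n ≼ B)
    limit⇒bounded {s} {L} s→L with bounded L | close s→L 1ᵏ positive-1
    ... | l , L≼l | N , near = 1ᵏ +ᵏ l , N , λ n N≤n →
      ≼-resp-≈ (solve 2 (λ s L → s :- L :+ L := s) refl (s n) L) (≼-+ (near n N≤n) L≼l)

  ∑ ∏ : (ℕ → Carrier) → ℕ → Carrier
  ∑ u zero    = 0#
  ∑ u (suc n) = ∑ u n + u n
  ∏ u zero    = 1#
  ∏ u (suc n) = ∏ u n * u n

  Series Product : (ℕ → Carrier) → Carrier → Set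
  Series u  = Limit (∑ u)
  Product u = Limit (∏ u)

  opaque
    ∑-cong : ∀ {u v} → (∀ n → u n ≈ v n) → ∀ n → ∑ u n ≈ ∑ v n
    ∑-cong u≈v zero    = refl
    ∑-cong u≈v (suc n) = +-cong (∑-cong u≈v n) (u≈v n)

    ∏-cong : ∀ {u v} → (∀ n → u n ≈ v n) → ∀ n → ∏ u n ≈ ∏ v n
    ∏-cong u≈v zero    = refl
    ∏-cong u≈v (suc n) = *-cong (∏-cong u≈v n) (u≈v n)

    ∑-+ : ∀ u v n → ∑ u n + ∑ v n ≈ ∑ (λ k → u k + v k) n
    ∑-+ u v zero    = +-identityˡ 0#
    ∑-+ u v (suc n) = trans
      (solve 4 (λ a b c d → (a :+ b) :+ (c :+ d) := (a :+ c) :+ (b :+ d)) refl (∑ u n) (u n) (∑ v n) (v n))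
      (+-congʳ (∑-+ u v n))

    ∏-* : ∀ u v n → ∏ u n * ∏ v n ≈ ∏ (λ k → u k * v k) n
    ∏-* u v zero    = *-identityˡ 1#
    ∏-* u v (suc n) = trans
      (solve 4 (λ a b c d → (a :* b) :* (c :* d) := (a :* c) :* (b :* d)) refl (∏ u n) (u n) (∏ v n) (v n))
      (*-congʳ (∏-* u v n))

    ∑-scale : ∀ c u n → c * ∑ u n ≈ ∑ (λ k → c * u k) n
    ∑-scale c u zero    = zeroʳ c
    ∑-scale c u (suc n) = trans (distribˡ c _ _) (+-congʳ (∑-scale c u n))

    ∑-suc : ∀ u n → ∑ u (suc n) ≈ u 0 + ∑ (λ k → u (suc k)) n
    ∑-suc u zero    = +-comm 0# (u 0)
    ∑-suc u (suc n) = trans (+-congʳ (∑-suc u n)) (+-assoc _ _ _)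

    ∏-suc : ∀ u n → ∏ u (suc n) ≈ u 0 * ∏ (λ k → u (suc k)) n
    ∏-suc u zero    = *-comm 1# (u 0)
    ∏-suc u (suc n) = trans (*-congʳ (∏-suc u n)) (*-assoc _ _ _)

    ∑-even-odd : ∀ u n → ∑ u (n ℕ.+ n) ≈ ∑ (λ k → u (k ℕ.+ k)) n + ∑ (λ k → u (suc (k ℕ.+ k))) n
    ∑-even-odd u zero    = sym (+-identityˡ 0#)
    ∑-even-odd u (suc n) rewrite ℕₚ.+-suc n n = trans (+-congʳ (+-congʳ (∑-even-odd u n)))
      (solve 4 (λ a b x y → a :+ b :+ x :+ y := (a :+ x) :+ (b :+ y)) refl _ _ _ _)

    ∏-even-odd : ∀ u n → ∏ u (n ℕ.+ n) ≈ ∏ (λ k → u (k ℕ.+ k)) n * ∏ (λ k → u (suc (k ℕ.+ k))) n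
    ∏-even-odd u zero    = sym (*-identityˡ 1#)
    ∏-even-odd u (suc n) rewrite ℕₚ.+-suc n n = trans (*-congʳ (*-congʳ (∏-even-odd u n)))
      (solve 4 (λ a b x y → a :* b :* x :* y := (a :* x) :* (b :* y)) refl _ _ _ _)

    series-cong : ∀ {u v L M} → (∀ n → u n ≈ v n) → L ≈ M → Series u L → Series v M
    series-cong u≈v = limit-cong (∑-cong u≈v)

    series-+ : ∀ {u v L M} → Series u L → Series v M → Series (λ n → u n + v n) (L + M)
    series-+ {u} {v} Su Sv = limit-cong (∑-+ u v) refl (limit-+ Su Sv)

    series-scale : ∀ {u L} c → Series u L → Series (λ n → c * u n) (c * L)
    series-scale {u} c Su = limit-cong (∑-scale c u) refl (limit-scale c Su)

    series-tail : ∀ {u L} → Series u L → Series (λ n → u (suc n)) (L - u 0)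
    series-tail {u} Su = limit-cong
      (λ n → trans (+-congʳ (∑-suc u n)) (solve 2 (λ a b → a :+ b :- a := b) refl (u 0) _)) refl
      (limit-sub (limit-∘ suc ℕₚ.n≤1+n Su) (limit-const (u 0)))

    series-cons : ∀ {u L} → Series (λ n → u (suc n)) L → Series u (u 0 + L)
    close (series-cons {u} {L} Su) ε 0<ε with close Su ε 0<ε
    ... | N , near = suc N , λ where
      (suc n) (ℕ.s≤s N≤n) → ≼-resp-≈
        (trans (solve 3 (λ a b L → b :- L := (a :+ b) :- (a :+ L)) refl (u 0) _ L) (+-congʳ (sym (∑-suc u n))))
        (near n N≤n)

    series-0 : Series (λ _ → 0#) 0#
    series-0 = limit-cong ∑0 refl (limit-const 0#)
      where
      ∑0 : ∀ n → 0# ≈ ∑ (λ _ → 0#) n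
      ∑0 zero    = refl
      ∑0 (suc n) = trans (∑0 n) (sym (+-identityʳ _))

  module Geometric (ρ : Contraction) where
    -- 1 / (1 - ρ), the sum of the geometric series.
    κ : K
    κ = proj₁ (reciprocal (below-1 ρ))

    private
      inverse : (1ᵏ -ᵏ ratio ρ) *ᵏ κ ≡ 1ᵏ
      inverse = proj₂ (proj₂ (reciprocal (below-1 ρ)))

    0≤κ : 0ᵏ ≤ κ
    0≤κ = positive⇒0≤ (proj₁ (proj₂ (reciprocal (below-1 ρ))))

    module _ {C : K} {u : ℕ → Carrier} (0≤C : 0ᵏ ≤ C) (u≼ : ∀ n → u n ≼ C *ᵏ ratio ρ ^ᵏ n) where
      private
        r = ratio ρ
        0≤Cκ = 0≤* 0≤C 0≤κ

        opaque
          -- Since (1 - r) κ = 1, the bound C r^j on a term equals C κ (r^j - r^(j+1)), so the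
          -- bounds telescope.
          telescoped : ∀ d m → ∑ u (d ℕ.+ m) - ∑ u m ≼ C *ᵏ κ *ᵏ (r ^ᵏ m -ᵏ r ^ᵏ (d ℕ.+ m))
          telescoped zero    m = ≼ε-0 (-‿inverseʳ _)
            (≤-reflexive (solveᵏ 2 (λ c w → :0 := c :* (w :- w)) ≡.refl (C *ᵏ κ) (r ^ᵏ m)))
          telescoped (suc d) m = ≼-≡ step
            (≼-resp-≈ (solve 3 (λ a b x → a :- b :+ x := a :+ x :- b) refl _ (∑ u m) (u (d ℕ.+ m)))
              (≼-+ (telescoped d m) (u≼ (d ℕ.+ m))))
            where
            w₀ w : K
            w₀ = r ^ᵏ m
            w = r ^ᵏ (d ℕ.+ m)
            step : C *ᵏ κ *ᵏ (w₀ -ᵏ w) +ᵏ C *ᵏ w ≡ C *ᵏ κ *ᵏ (w₀ -ᵏ r *ᵏ w)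
            step = ≡.trans (≡.cong (λ t → C *ᵏ κ *ᵏ (w₀ -ᵏ w) +ᵏ t)
                     (≡.trans (≡.sym (*ᵏ-identityʳ _)) (≡.cong (C *ᵏ w *ᵏ_) (≡.sym inverse))))
                   (solveᵏ 5 (λ C κ w₀ w r → C :* κ :* (w₀ :- w) :+ C :* w :* ((:1 :- r) :* κ) := C :* κ :*
                     (w₀ :- r :* w))
                     ≡.refl C κ w₀ w r)

          from-N : ∀ {N n} → N ℕ.≤ n → ∑ u n - ∑ u N ≼ C *ᵏ κ *ᵏ r ^ᵏ N
          from-N {N} {n} N≤n = ≡.subst (λ k → ∑ u k - ∑ u N ≼ C *ᵏ κ *ᵏ r ^ᵏ N) (ℕₚ.m∸n+n≡m N≤n)
            (≼-mono (telescoped (n ℕ.∸ N) N)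
              (≤-by (0≤* 0≤Cκ (0≤^ (nonneg ρ) (n ℕ.∸ N ℕ.+ N)))
                (solveᵏ 3 (λ c a b → c :* (a :- b) :+ c :* b := c :* a) ≡.refl (C *ᵏ κ) (r ^ᵏ N)
                  (r ^ᵏ (n ℕ.∸ N ℕ.+ N)))))

          partial-sums-cauchy : Cauchy (∑ u)
          partial-sums-cauchy ε 0<ε with half 0<ε
          ... | δ , 0<δ , 2δ≡ε with geometric-vanishing ρ 0≤Cκ δ 0<δ
          ... | N , small = N , λ m n N≤m N≤n → ≼-≡ 2δ≡ε
            (≼-resp-≈ (solve 3 (λ a b c → (a :- c) :- (b :- c) := a :- b) refl (∑ u m) (∑ u n) (∑ u N))
              (≼-mono (≼-sub (from-N N≤m) (from-N N≤n)) (+-mono-≤ (small N ℕₚ.≤-refl) (small N ℕₚ.≤-refl))))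

      opaque
        convergent : ∃[ L ] Series u L
        convergent = let L , near = complete (∑ u) partial-sums-cauchy in L , limit near

        sum-≼ : ∀ {L} → Series u L → L ≼ C *ᵏ κ
        sum-≼ = limit-≼ λ n → ≼-≡ (*ᵏ-identityʳ _)
          (≼-resp-≈ (solve 1 (λ s → s :- :0 := s) refl (∑ u n)) (from-N {0} {n} ℕ.z≤n))

-- q-products

module QSeries {F : ArchimedeanField} (𝔸 : CompleteNormedRing F) where
  open Analysis 𝔸 public
  open import Relation.Binary.Reasoning.Setoid setoid
  open import Algebra.Properties.Semiring.Exp semiring using (^-homo-*; ^-congˡ)
  open import Algebra.Properties.CommutativeSemiring.Exp commutativeSemiring using (^-distrib-*)

  Invertible : Carrier → Set
  Invertible x = ∃[ y ] x * y ≈ 1#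

  opaque
    invertible-* : ∀ {x y} → Invertible x → Invertible y → Invertible (x * y)
    invertible-* {x} {y} (u , xu≈1) (v , yv≈1) = u * v , trans
      (solve 4 (λ x y u v → (x :* y) :* (u :* v) := (x :* u) :* (y :* v)) refl x y u v)
      (trans (*-cong xu≈1 yv≈1) (*-identityˡ 1#))

    invertible-≈ : ∀ {x y} → x ≈ y → Invertible x → Invertible y
    invertible-≈ x≈y (u , xu≈1) = u , trans (*-congʳ (sym x≈y)) xu≈1

    cancel : ∀ {x y z} → Invertible x → x * y ≈ x * z → y ≈ z
    cancel {x} {y} {z} (u , xu≈1) xy≈xz = begin
      y            ≈⟨ *-identityˡ y ⟨
      1# * y       ≈⟨ *-congʳ xu≈1 ⟨
      x * u * y    ≈⟨ solve 3 (λ x u y → x :* u :* y := u :* (x :* y)) refl x u y ⟩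
      u * (x * y)  ≈⟨ *-congˡ xy≈xz ⟩
      u * (x * z)  ≈⟨ solve 3 (λ x u y → u :* (x :* y) := x :* u :* y) refl x u z ⟩
      x * u * z    ≈⟨ *-congʳ xu≈1 ⟩
      1# * z       ≈⟨ *-identityˡ z ⟩
      z            ∎

    -- Neumann series: L = ∑ x^n converges, and comparing the series scaled by x with its own tail
    -- gives x L = L - 1.
    1-invertible : ∀ {x} (ρ : Contraction) → x ≼ ratio ρ → Invertible (1# - x)
    1-invertible {x} ρ x≼ρ = L , (begin
      (1# - x) * L   ≈⟨ solve 2 (λ x L → (:1 :- x) :* L := L :- x :* L) refl x L ⟩
      L - x * L      ≈⟨ +-congˡ (-‿cong (limit-unique (series-scale x Σxⁿ) (series-tail Σxⁿ))) ⟩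
      L - (L - 1#)   ≈⟨ solve 1 (λ L → L :- (L :- :1) := :1) refl L ⟩
      1#             ∎)
      where
      open Geometric ρ using (convergent)
      sum : ∃[ L ] Series (x ^_) L
      sum = convergent 0≤1 λ n → ≼-≡ (solveᵏ 1 (λ w → w := :1 :* w) ≡.refl (ratio ρ ^ᵏ n)) (≼-^ x≼ρ n)
      L : Carrier
      L = proj₁ sum
      Σxⁿ : Series (x ^_) L
      Σxⁿ = proj₂ sum

    ^≤1 : ∀ (ρ : Contraction) n → ratio ρ ^ᵏ n ≤ 1ᵏ
    ^≤1 ρ zero    = ≤-refl
    ^≤1 ρ (suc n) = ≤-trans (*-mono-≤ (0≤^ (nonneg ρ) n) 0≤1
      (≤-by (positive⇒0≤ (below-1 ρ)) (solveᵏ 1 (λ r → r :+ (:1 :- r) := :1) ≡.refl (ratio ρ)))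
      (^≤1 ρ n)) (≤-reflexive (*ᵏ-identityʳ 1ᵏ))

  -- The base of the q-products together with an explicit ratio below 1 that bounds it; the
  -- constants of the later estimates are built from this ratio.
  record Disc : Set where
    no-eta-equality
    field
      nome   : Carrier
      radius : Contraction
      nome≼  : nome ≼ ratio radius

    -- absorbs subexponential factors
    relaxed : Contraction
    relaxed = proj₁ (relax radius)

    slack : K
    slack = proj₁ (proj₂ (relax radius))

    0<slack : Positive slack
    0<slack = proj₁ (proj₂ (proj₂ (relax radius)))

    radius+slack : ratio radius +ᵏ slack ≡ ratio relaxed
    radius+slack = proj₂ (proj₂ (proj₂ (relax radius)))

    open Geometric relaxed public

  open Disc public

  square : Disc → Disc
  square D = record
    { nome   = nome D * nome D
    ; radius = radius D ⊗ radius D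
    ; nome≼  = ≼-* (nome≼ D) (nome≼ D)
    }

  factor : Disc → Carrier → ℕ → Carrier
  factor D x n = 1# - x * nome D ^ n

  -- This is x^n P^(n(n-1)/2). Written as a product it satisfies its recursion definitionally, and
  -- triangular exponents can wait until `monomial-closed`.
  monomial : Disc → Carrier → ℕ → Carrier
  monomial D x = ∏ (λ j → x * nome D ^ j)

  module _ (D : Disc) where
    private
      P = nome D
      r = ratio (radius D)
      s = ratio (relaxed D)
      0≤r = nonneg (radius D)

      -- Bounds P (1 - x P^n), the quotient of consecutive values of P^n (x; P)_n, for x of norm at
      -- most A. It tends to r, hence falls below the relaxed ratio eventually.
      growth : K → ℕ → K
      growth A n = r *ᵏ (1ᵏ +ᵏ A *ᵏ r ^ᵏ n)

      majorant : K → ℕ → K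
      majorant A zero    = 1ᵏ
      majorant A (suc n) = growth A n *ᵏ majorant A n

      opaque
        0≤growth : ∀ {A} → 0ᵏ ≤ A → ∀ n → 0ᵏ ≤ growth A n
        0≤growth 0≤A n = 0≤* 0≤r (0≤+ 0≤1 (0≤* 0≤A (0≤^ 0≤r n)))

        0≤majorant : ∀ {A} → 0ᵏ ≤ A → ∀ n → 0ᵏ ≤ majorant A n
        0≤majorant 0≤A zero    = 0≤1
        0≤majorant 0≤A (suc n) = 0≤* (0≤growth 0≤A n) (0≤majorant 0≤A n)

        majorant-geometric : ∀ {A} → 0ᵏ ≤ A → ∃[ C ] (0ᵏ ≤ C × (∀ n → majorant A n ≤ C *ᵏ s ^ᵏ n))
        majorant-geometric {A} 0≤A =
          let N , small = geometric-vanishing (radius D) (0≤* 0≤r 0≤A) (slack D) (0<slack D)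
          in ratio-test (relaxed D) (growth A) (majorant A) (0≤growth 0≤A) (0≤majorant 0≤A) (λ _ → ≡.refl) N
            λ n N≤n → ≤-trans (≤-reflexive
              (solveᵏ 3 (λ r A w → r :* (:1 :+ A :* w) := r :+ r :* A :* w) ≡.refl r A (r ^ᵏ n)))
              (≤-trans (+-mono-≤ ≤-refl (small n N≤n)) (≤-reflexive (radius+slack D)))

        partial-product-≼ : ∀ {A x} → x ≼ A → ∀ n → P ^ n * ∏ (factor D x) n ≼ majorant A n
        partial-product-≼ x≼A zero    = ≼-resp-≈ (sym (*-identityˡ 1#)) ≼-1
        partial-product-≼ {A} {x} x≼A (suc n) = ≼-resp-≈
          (solve 4 (λ P w x p → P :* (:1 :- x :* w) :* (w :* p) := P :* w :* (p :* (:1 :- x :* w))) refl P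
            (P ^ n) x (∏ (factor D x) n))
          (≼-* (≼-* (nome≼ D) (≼-sub ≼-1 (≼-* x≼A (≼-^ (nome≼ D) n)))) (partial-product-≼ x≼A n))

        -- The partial products grow by -x P^n (x; P)_n, so the product is 1 plus a series dominated
        -- through `majorant`. The constant M depends on A alone, and the prefactor `a` survives
        -- from the factor x of each increment; `E-near-1` needs both.
        product-exists : ∀ A → 0ᵏ ≤ A → ∃[ M ] (0ᵏ ≤ M × (∀ {x a} → x ≼ a → a ≤ A →
          ∃[ E ] (Product (factor D x) E × E - 1# ≼ a *ᵏ M)))
        product-exists A 0≤A = M , 0≤* 0≤C (0≤κ D) , λ {x} {a} x≼a a≤A →
          let increment : ℕ → Carrier
              increment n = - x * (P ^ n * ∏ (factor D x) n)
              0≤a = ≼⇒0≤ x≼a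
              increment-≼ : ∀ n → increment n ≼ a *ᵏ C *ᵏ s ^ᵏ n
              increment-≼ n = ≼-mono (≼-* (≼-neg x≼a) (partial-product-≼ (≼-mono x≼a a≤A) n))
                (≤-trans (*-monoʳ-≤ 0≤a (proj₂ (proj₂ geo) n))
                  (≤-reflexive (solveᵏ 3 (λ a C w → a :* (C :* w) := a :* C :* w) ≡.refl a C (s ^ᵏ n))))
              0≤aC = 0≤* 0≤a 0≤C
              L , ∑→L = convergent D 0≤aC increment-≼
          in 1# + L ,
             limit-cong (λ n → telescope x n) refl (limit-+ (limit-const 1#) ∑→L) ,
             ≼-resp-≈ (solve 1 (λ L → L := :1 :+ L :- :1) refl L)
               (≼-≡ (solveᵏ 3 (λ a C κ → a :* C :* κ := a :* (C :* κ)) ≡.refl a C (κ D))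
                 (sum-≼ D 0≤aC increment-≼ ∑→L))
          where
          geo : ∃[ C ] (0ᵏ ≤ C × (∀ n → majorant A n ≤ C *ᵏ s ^ᵏ n))
          geo = majorant-geometric 0≤A
          C M : K
          C = proj₁ geo
          M = C *ᵏ κ D
          0≤C : 0ᵏ ≤ C
          0≤C = proj₁ (proj₂ geo)
          telescope : ∀ x n → 1# + ∑ (λ n → - x * (P ^ n * ∏ (factor D x) n)) n ≈ ∏ (factor D x) n
          telescope x zero    = +-identityʳ 1#
          telescope x (suc n) = trans (sym (+-assoc _ _ _)) (trans (+-congʳ (telescope x n))
            (solve 3 (λ x w p → p :+ :- x :* (w :* p) := p :* (:1 :- x :* w)) refl x (P ^ n) (∏ (factor D x) n)))

    opaque
      -- (x; P)_∞
      E : Carrier → Carrier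
      E x = let a , x≼a = bounded x in proj₁ (proj₂ (proj₂ (product-exists a (≼⇒0≤ x≼a))) x≼a ≤-refl)

      E-product : ∀ x → Product (factor D x) (E x)
      E-product x = let a , x≼a = bounded x in proj₁ (proj₂ (proj₂ (proj₂ (product-exists a (≼⇒0≤ x≼a))) x≼a ≤-refl))

      -- One constant for the whole unit ball. It supplies the far tail in `E-invertible` and the
      -- rate of convergence in `R-near-1`.
      E-near-1 : ∃[ M ] (0ᵏ ≤ M × (∀ {x a} → x ≼ a → a ≤ 1ᵏ → E x - 1# ≼ a *ᵏ M))
      E-near-1 = let M , 0≤M , f = product-exists 1ᵏ 0≤1 in M , 0≤M , λ {x} x≼a a≤1 →
        let E′ , prod , near = f x≼a a≤1
        in ≼-resp-≈ (+-congʳ (limit-unique prod (E-product x))) near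

  module _ {D D′ : Disc} (P≈P′ : nome D ≈ nome D′) {x x′ : Carrier} (x≈x′ : x ≈ x′) where
    opaque
      factor-cong : ∀ n → factor D x n ≈ factor D′ x′ n
      factor-cong n = +-congˡ (-‿cong (*-cong x≈x′ (^-congˡ n P≈P′)))

      E-cong : E D x ≈ E D′ x′
      E-cong = limit-unique (limit-cong (∏-cong factor-cong) refl (E-product D x)) (E-product D′ x′)

  module _ (D : Disc) where
    private
      P = nome D
      P² = nome (square D)

    opaque
      factor-suc : ∀ x k → factor D x (suc k) ≈ factor D (x * P) k
      factor-suc x k = +-congˡ (-‿cong (sym (*-assoc x P (P ^ k))))

      ∏-factor-suc : ∀ x n → ∏ (factor D x) (suc n) ≈ (1# - x) * ∏ (factor D (x * P)) n
      ∏-factor-suc x n = begin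
        ∏ (factor D x) (suc n)                                 ≈⟨ ∏-suc (factor D x) n ⟩
        (1# - x * 1#) * ∏ (λ k → factor D x (suc k)) n         ≈⟨ *-congʳ (+-congˡ (-‿cong (*-identityʳ x))) ⟩
        (1# - x) * ∏ (λ k → factor D x (suc k)) n              ≈⟨ *-congˡ (∏-cong (factor-suc x) n) ⟩
        (1# - x) * ∏ (factor D (x * P)) n                      ∎

      E-step : ∀ x → E D x ≈ (1# - x) * E D (x * P)
      E-step x = limit-unique {λ n → ∏ (factor D x) (suc n)} (limit-∘ suc ℕₚ.n≤1+n (E-product D x))
        (limit-cong {λ n → (1# - x) * ∏ (factor D (x * P)) n} (λ n → sym (∏-factor-suc x n)) refl
          (limit-scale (1# - x) (E-product D (x * P))))

      P²^ : ∀ n → P² ^ n ≈ P ^ (n ℕ.+ n)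
      P²^ n = trans (^-distrib-* P P n) (sym (^-homo-* P n n))

      factor-even : ∀ x k → factor D x (k ℕ.+ k) ≈ factor (square D) x k
      factor-even x k = +-congˡ (-‿cong (*-congˡ (sym (P²^ k))))

      ∏-factor-bisect : ∀ x n → ∏ (factor D x) (n ℕ.+ n) ≈ ∏ (factor (square D) x) n * ∏ (factor (square D) (x * P)) n
      ∏-factor-bisect x n = trans (∏-even-odd (factor D x) n)
        (*-cong (∏-cong (factor-even x) n) (∏-cong (λ k → trans (factor-suc x (k ℕ.+ k)) (factor-even (x * P) k)) n))

      E-bisect : ∀ x → E D x ≈ E (square D) x * E (square D) (x * P)
      E-bisect x = limit-unique {λ n → ∏ (factor D x) (n ℕ.+ n)}
        (limit-∘ (λ n → n ℕ.+ n) (λ n → ℕₚ.m≤m+n n n) (E-product D x))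
        (limit-cong {λ n → ∏ (factor (square D) x) n * ∏ (factor (square D) (x * P)) n}
          (λ n → sym (∏-factor-bisect x n)) refl
          (limit-* (E-product (square D) x) (E-product (square D) (x * P))))

      factor-± : ∀ x k → factor D x k * factor D (- x) k ≈ factor (square D) (x * x) k
      factor-± x k = trans
        (solve 2 (λ x w → (:1 :- x :* w) :* (:1 :- :- x :* w) := :1 :- x :* x :* (w :* w)) refl x (P ^ k))
        (+-congˡ (-‿cong (*-congˡ (sym (^-distrib-* P P k)))))

      E-square : ∀ x → E D x * E D (- x) ≈ E (square D) (x * x)
      E-square x = limit-unique {∏ (factor (square D) (x * x))}
        (limit-cong {λ n → ∏ (factor D x) n * ∏ (factor D (- x)) n}
          (λ n → trans (∏-* (factor D x) (factor D (- x)) n) (∏-cong (factor-± x) n)) refl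
          (limit-* (E-product D x) (E-product D (- x))))
        (E-product (square D) (x * x))

      -- For large N the tail (P^(N+1); P)_∞ differs from 1 by at most r, so it is inverted by a
      -- Neumann series. `E-step` then restores the finitely many missing factors 1 - P^(n+1), each
      -- invertible for the same reason.
      E-invertible : Invertible (E D P)
      E-invertible = invertible-≈ (E-cong {D} {D} refl (*-identityʳ P)) (descend N far)
        where
        M : K
        M = proj₁ (E-near-1 D)
        r : K
        r = ratio (radius D)
        0≤M : 0ᵏ ≤ M
        0≤M = proj₁ (proj₂ (E-near-1 D))
        N : ℕ
        N = proj₁ (geometric-vanishing (radius D) 0≤M r (positive (radius D)))
        far : Invertible (E D (P ^ suc N))
        far = invertible-≈ (solve 1 (λ e → :1 :- (:- (e :- :1)) := e) refl (E D (P ^ suc N)))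
          (1-invertible (radius D) (≼-neg (≼-mono
            (proj₂ (proj₂ (E-near-1 D)) (≼-^ (nome≼ D) (suc N)) (^≤1 (radius D) (suc N)))
            (≤-trans (≤-reflexive (solveᵏ 2 (λ w M → w :* M := M :* w) ≡.refl (r ^ᵏ suc N) M))
              (proj₂ (geometric-vanishing (radius D) 0≤M r (positive (radius D))) (suc N) (ℕₚ.n≤1+n N))))))
        P^≼ : ∀ n → P ^ suc n ≼ r
        P^≼ n = ≼-mono (≼-^ (nome≼ D) (suc n)) (≤-trans (*-monoʳ-≤ (nonneg (radius D)) (^≤1 (radius D) n))
          (≤-reflexive (*ᵏ-identityʳ r)))
        descend : ∀ n → Invertible (E D (P ^ suc n)) → Invertible (E D (P ^ 1))
        descend zero    inv = inv
        descend (suc n) inv = descend n (invertible-≈ (sym (E-step (P ^ suc n)))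
          (invertible-* (1-invertible (radius D) (P^≼ n))
            (invertible-≈ (E-cong {D} {D} refl (*-comm P (P ^ suc n))) inv)))

-- Theta functions

module PartialTheta {F : ArchimedeanField} (𝔸 : CompleteNormedRing F) where
  open QSeries 𝔸 public
  open import Relation.Binary.Reasoning.Setoid setoid
  open import Algebra.Properties.Semiring.Exp semiring using (^-homo-*; ^-congˡ)

  module _ (D : Disc) where
    private
      P = nome D
      r = ratio (radius D)
      s = ratio (relaxed D)
      0≤r = nonneg (radius D)

    -- A factor r^n is kept apart from `bound`: `weighted` spends it on the rate of convergence,
    -- while what remains is still summable. One bound serves every x of norm at most X.
    record MonomialBound (X : K) : Set where
      field
        bound     : ℕ → K
        constant  : K
        0≤bound   : ∀ n → 0ᵏ ≤ bound n
        0≤constant : 0ᵏ ≤ constant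
        geometric : ∀ n → bound n ≤ constant *ᵏ s ^ᵏ n
        monomial≼ : ∀ {x} → x ≼ X → ∀ n → monomial D x n ≼ r ^ᵏ n *ᵏ bound n

    opaque
      monomialBound : ∀ X → 0ᵏ ≤ X → MonomialBound X
      monomialBound X 0≤X = record
        { bound = e ; constant = proj₁ geo ; 0≤bound = 0≤e ; 0≤constant = proj₁ (proj₂ geo)
        ; geometric = proj₂ (proj₂ geo) ; monomial≼ = bounds }
        where
        r⁻¹ : K
        r⁻¹ = proj₁ (reciprocal (positive (radius D)))
        0≤Xr⁻¹ : 0ᵏ ≤ X *ᵏ r⁻¹
        0≤Xr⁻¹ = 0≤* 0≤X (positive⇒0≤ (proj₁ (proj₂ (reciprocal (positive (radius D))))))
        c e : ℕ → K
        -- Consecutive monomials differ by a factor of norm at most X r^n; the division by r pays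
        -- for the factor r split off at each step. These quotients tend to 0, so `ratio-test`
        -- applies.
        c n = X *ᵏ r⁻¹ *ᵏ r ^ᵏ n
        e zero    = 1ᵏ
        e (suc n) = c n *ᵏ e n
        0≤c : ∀ n → 0ᵏ ≤ c n
        0≤c n = 0≤* 0≤Xr⁻¹ (0≤^ 0≤r n)
        0≤e : ∀ n → 0ᵏ ≤ e n
        0≤e zero    = 0≤1
        0≤e (suc n) = 0≤* (0≤c n) (0≤e n)
        geo : ∃[ C ] (0ᵏ ≤ C × (∀ n → e n ≤ C *ᵏ s ^ᵏ n))
        geo = let N , small = geometric-vanishing (radius D) 0≤Xr⁻¹ s (positive (relaxed D))
              in ratio-test (relaxed D) c e 0≤c 0≤e (λ _ → ≡.refl) N small
        bounds : ∀ {x} → x ≼ X → ∀ n → monomial D x n ≼ r ^ᵏ n *ᵏ e n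
        bounds x≼X zero    = ≼-≡ (≡.sym (*ᵏ-identityʳ 1ᵏ)) ≼-1
        bounds x≼X (suc n) = ≼-≡
          (≡.trans (≡.sym (*ᵏ-identityʳ _))
            (≡.trans (≡.cong (λ t → r ^ᵏ n *ᵏ e n *ᵏ (X *ᵏ r ^ᵏ n) *ᵏ t)
              (≡.sym (proj₂ (proj₂ (reciprocal (positive (radius D)))))))
              (solveᵏ 5 (λ w e X r r⁻¹ → w :* e :* (X :* w) :* (r :* r⁻¹) := r :* w :* (X :* r⁻¹ :* w :* e)) ≡.refl
                (r ^ᵏ n) (e n) X r r⁻¹)))
          (≼-* (bounds x≼X n) (≼-* x≼X (≼-^ (nome≼ D) n)))

      monomial-geometric : ∀ {X x} (B : MonomialBound X) → x ≼ X → ∀ n →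
        monomial D x n ≼ MonomialBound.constant B *ᵏ s ^ᵏ n
      monomial-geometric B x≼X n = ≼-mono (MonomialBound.monomial≼ B x≼X n)
        (≤-trans (*-mono-≤ (MonomialBound.0≤bound B n) 0≤1 (^≤1 (radius D) n) (MonomialBound.geometric B n))
          (≤-reflexive (solveᵏ 1 (λ t → :1 :* t := t) ≡.refl _)))

    -- ∑_{n≥0} x^n P^{n(n-1)/2}
    opaque
      partialTheta : ∀ x → ∃[ L ] Series (monomial D x) L
      partialTheta x = let a , x≼a = bounded x ; B = monomialBound a (≼⇒0≤ x≼a)
        in convergent D (MonomialBound.0≤constant B) (monomial-geometric B x≼a)

      G : Carrier → Carrier
      G x = proj₁ (partialTheta x)

      G-series : ∀ x → Series (monomial D x) (G x)
      G-series x = proj₂ (partialTheta x)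

    -- Ramanujan's f(x, y) when x y is the nome. The term of index 0 belongs to both halves, hence
    -- the subtraction of 1.
    ϑ : Carrier → Carrier → Carrier
    ϑ x y = G x + (G y - 1#)

  module _ {D D′ : Disc} (P≈P′ : nome D ≈ nome D′) where
    opaque
      monomial-cong : ∀ {x x′} → x ≈ x′ → ∀ n → monomial D x n ≈ monomial D′ x′ n
      monomial-cong x≈x′ = ∏-cong λ k → *-cong x≈x′ (^-congˡ k P≈P′)

      G-cong : ∀ {x x′} → x ≈ x′ → G D x ≈ G D′ x′
      G-cong {x} {x′} x≈x′ = limit-unique (series-cong (monomial-cong x≈x′) refl (G-series D x)) (G-series D′ x′)

      ϑ-cong : ∀ {x x′ y y′} → x ≈ x′ → y ≈ y′ → ϑ D x y ≈ ϑ D′ x′ y′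
      ϑ-cong x≈x′ y≈y′ = +-cong (G-cong x≈x′) (+-congʳ (G-cong y≈y′))

  module _ (D : Disc) where
    private
      P = nome D

    opaque
      G-step : ∀ x → G D x ≈ 1# + x * G D (x * P)
      G-step x = limit-unique {∑ (monomial D x)} (G-series D x)
        (series-cons (series-cong {λ n → x * monomial D (x * P) n} (λ n → sym (shifted n)) refl
          (series-scale x (G-series D (x * P)))))
        where
        shifted : ∀ n → monomial D x (suc n) ≈ x * monomial D (x * P) n
        shifted n = trans (∏-suc (λ j → x * P ^ j) n)
          (*-cong (*-identityʳ x) (∏-cong (λ j → sym (*-assoc x P (P ^ j))) n))

  module _ (D : Disc) where
    private
      P = nome D
      P⁴ = nome (square (square D))

    opaque
      P⁴^ : ∀ n → P⁴ ^ n ≈ P ^ (n ℕ.+ n) * P ^ (n ℕ.+ n)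
      P⁴^ n = trans (P²^ (square D) n) (trans (^-homo-* (P * P) n n) (*-cong (P²^ D n) (P²^ D n)))

    opaque
      -- The exponent of P is n(2n-1) = n + 4 n(n-1)/2, and in `monomial-odd` it is n(2n+1) = 3n + 4
      -- n(n-1)/2; hence the fourth power of the nome.
      monomial-even : ∀ x n → monomial D x (n ℕ.+ n) ≈ monomial (square (square D)) (x * x * P) n
      monomial-even x zero    = refl
      monomial-even x (suc n) rewrite ℕₚ.+-suc n n = begin
        monomial D x (n ℕ.+ n) * (x * w) * (x * (P * w))
          ≈⟨ solve 4 (λ t x P w → t :* (x :* w) :* (x :* (P :* w)) := t :* (x :* x :* P :* (w :* w))) refl _ x P w ⟩
        monomial D x (n ℕ.+ n) * (x * x * P * (w * w))
          ≈⟨ *-cong (monomial-even x n) (*-congˡ (sym (P⁴^ n))) ⟩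
        monomial (square (square D)) (x * x * P) n * (x * x * P * P⁴ ^ n) ∎
        where
        w : Carrier
        w = P ^ (n ℕ.+ n)

    opaque
      monomial-odd : ∀ x n → monomial D x (suc (n ℕ.+ n)) ≈ x * monomial (square (square D)) (x * x * P * P * P) n
      monomial-odd x zero    = solve 1 (λ x → :1 :* (x :* :1) := x :* :1) refl x
      monomial-odd x (suc n) rewrite ℕₚ.+-suc n n = begin
        monomial D x (suc (n ℕ.+ n)) * (x * (P * w)) * (x * (P * (P * w)))
          ≈⟨ solve 4 (λ t x P w → t :* (x :* (P :* w)) :* (x :* (P :* (P :* w))) := t :*
            (x :* x :* P :* P :* P :* (w :* w))) refl _ x P w ⟩
        monomial D x (suc (n ℕ.+ n)) * (x * x * P * P * P * (w * w))
          ≈⟨ *-cong (monomial-odd x n) (*-congˡ (sym (P⁴^ n))) ⟩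
        x * monomial (square (square D)) (x * x * P * P * P) n * (x * x * P * P * P * P⁴ ^ n)
          ≈⟨ *-assoc _ _ _ ⟩
        x * (monomial (square (square D)) (x * x * P * P * P) n * (x * x * P * P * P * P⁴ ^ n)) ∎
        where
        w : Carrier
        w = P ^ (n ℕ.+ n)

    opaque
      G-bisect : ∀ x → G D x ≈ G (square (square D)) (x * x * P) + x * G (square (square D)) (x * x * P * P * P)
      G-bisect x = limit-unique {λ n → ∑ (monomial D x) (n ℕ.+ n)}
        (limit-∘ (λ n → n ℕ.+ n) (λ n → ℕₚ.m≤m+n n n) (G-series D x))
        (limit-cong {λ n → ∑ (monomial (square (square D)) (x * x * P)) n + x * ∑
          (monomial (square (square D)) (x * x * P * P * P)) n}
          (λ n → sym (trans (∑-even-odd (monomial D x) n) (+-cong (∑-cong (monomial-even x) n)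
            (trans (∑-cong (monomial-odd x) n)
              (sym (∑-scale x (monomial (square (square D)) (x * x * P * P * P)) n)))))) refl
          (limit-+ (G-series (square (square D)) (x * x * P))
            (limit-scale x (G-series (square (square D)) (x * x * P * P * P)))))

    opaque
      -- z = y/x
      ϑ-bisect : ∀ {x y z} → P ≈ x * y → x * z ≈ y →
        ϑ D x y ≈ ϑ (square (square D)) (x * x * P) (y * y * P) + x * ϑ (square (square D)) z (x * x * P * P * P)
      ϑ-bisect {x} {y} {z} P≈xy xz≈y = begin
        G D x + (G D y - 1#)
          ≈⟨ +-cong (G-bisect x) (+-congʳ (G-bisect y)) ⟩
        A + x * B + (A′ + y * B′ - 1#)
          ≈⟨ solve 4 (λ A xB A′ yB′ → A :+ xB :+ (A′ :+ yB′ :- :1) := A :+ (A′ :- :1) :+ (yB′ :+ xB)) refl A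
            (x * B) A′ (y * B′) ⟩
        A + (A′ - 1#) + (y * B′ + x * B)
          -- As y² P³ = z P⁴, the odd part of the second half is x z G(z P⁴). The 1 missing from
          -- G(z) = 1 + z G(z P⁴) is the one that turns B into B - 1, the other half of a theta
          -- function.
          ≈⟨ +-congˡ (+-congʳ (*-cong (sym xz≈y) (G-cong {square (square D)} {square (square D)} refl argument))) ⟩
        A + (A′ - 1#) + (x * z * B″ + x * B)
          ≈⟨ +-congˡ (solve 4 (λ x z B″ B → x :* z :* B″ :+ x :* B := x :*
            (:1 :+ z :* B″ :+ (B :- :1))) refl x z B″ B) ⟩
        A + (A′ - 1#) + x * (1# + z * B″ + (B - 1#))
          ≈⟨ +-congˡ (*-congˡ (+-congʳ (G-step (square (square D)) z))) ⟨
        A + (A′ - 1#) + x * (G (square (square D)) z + (B - 1#)) ∎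
        where
        A A′ B B′ B″ : Carrier
        A  = G (square (square D)) (x * x * P)
        A′ = G (square (square D)) (y * y * P)
        B  = G (square (square D)) (x * x * P * P * P)
        B′ = G (square (square D)) (y * y * P * P * P)
        B″ = G (square (square D)) (z * P⁴)
        argument : y * y * P * P * P ≈ z * P⁴
        argument = begin
          y * y * P * P * P          ≈⟨ *-congʳ (*-congʳ (*-congʳ (*-congʳ xz≈y))) ⟨
          x * z * y * P * P * P      ≈⟨ solve 4
            (λ x y z P → x :* z :* y :* P :* P :* P := z :* (x :* y :* P :* (P :* P))) refl x y z P ⟩
          z * (x * y * P * (P * P))  ≈⟨ *-congˡ (*-congʳ (*-congʳ P≈xy)) ⟨
          z * P⁴                     ∎

-- The triple product

module Jacobi {F : ArchimedeanField} (𝔸 : CompleteNormedRing F) where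
  open PartialTheta 𝔸 public
  open import Relation.Binary.Reasoning.Setoid setoid
  open import Algebra.Properties.Semiring.Exp semiring using (^-homo-*; ^-congˡ)
  open import Algebra.Properties.Semiring.Exp (CommutativeRing.semiring (ArchimedeanField.commutativeRing F))
    using () renaming (^-homo-* to ^ᵏ-homo-*)

  record BilateralSeries (u : ℤ → Carrier) (L : Carrier) : Set where
    field
      {right left} : Carrier
      right-series : Series (λ n → u (+ n)) right
      left-series  : Series (λ n → u -[1+ n ]) left
      total        : L ≈ right + left

  open BilateralSeries

  opaque
    bilateral-cong : ∀ {u v L M} → (∀ k → u k ≈ v k) → L ≈ M → BilateralSeries u L → BilateralSeries v M
    bilateral-cong u≈v L≈M S = record
      { right-series = series-cong (λ n → u≈v (+ n)) refl (right-series S)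
      ; left-series  = series-cong (λ n → u≈v -[1+ n ]) refl (left-series S)
      ; total        = trans (sym L≈M) (total S)
      }

    bilateral-+ : ∀ {u v L M} → BilateralSeries u L → BilateralSeries v M → BilateralSeries (λ k → u k + v k) (L + M)
    bilateral-+ S T = record
      { right-series = series-+ (right-series S) (right-series T)
      ; left-series  = series-+ (left-series S) (left-series T)
      ; total        = trans (+-cong (total S) (total T))
          (solve 4 (λ a b c d → (a :+ b) :+ (c :+ d) := (a :+ c) :+ (b :+ d)) refl (right S) (left S) (right T)
            (left T))
      }

    bilateral-scale : ∀ {u L} c → BilateralSeries u L → BilateralSeries (λ k → c * u k) (c * L)
    bilateral-scale c S = record
      { right-series = series-scale c (right-series S)
      ; left-series  = series-scale c (left-series S)
      ; total        = trans (*-congˡ (total S)) (distribˡ c _ _)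
      }

    -- Only the term u(-1) changes sides: it becomes the first term of the right half and leaves the
    -- left half.
    bilateral-shift : ∀ {u L} → BilateralSeries u L → BilateralSeries (λ k → u (ℤ.pred k)) L
    bilateral-shift {u} {L} S = record
      { right-series = series-cons (right-series S)
      ; left-series  = series-tail (left-series S)
      ; total        = trans (total S)
          (solve 3 (λ a b c → a :+ b := (c :+ a) :+ (b :- c)) refl (right S) (left S) (u -[1+ 0 ]))
      }

    bilateral-reflect : ∀ {u L} → BilateralSeries u L → BilateralSeries (λ k → u (ℤ.- k)) L
    bilateral-reflect {u} {L} S = record
      { right-series = series-cons (left-series S)
      ; left-series  = series-tail (right-series S)
      ; total        = trans (total S)
          (solve 3 (λ a b c → a :+ b := (c :+ b) :+ (a :- c)) refl (right S) (left S) (u (+ 0)))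
      }

    bilateral-≼ : ∀ (ρ : Contraction) {u L C} → 0ᵏ ≤ C → (∀ n → u (+ n) ≼ C *ᵏ ratio ρ ^ᵏ n) →
      (∀ n → u -[1+ n ] ≼ C *ᵏ ratio ρ ^ᵏ n) → BilateralSeries u L →
      L ≼ C *ᵏ Geometric.κ ρ +ᵏ C *ᵏ Geometric.κ ρ
    bilateral-≼ ρ 0≤C right≼ left≼ S = ≼-resp-≈ (sym (total S))
      (≼-+ (Geometric.sum-≼ ρ 0≤C right≼ (right-series S)) (Geometric.sum-≼ ρ 0≤C left≼ (left-series S)))

  -⇒+ : ∀ n l {m} → + n ℤ.+ -[1+ l ] ≡ + m → n ≡ m ℕ.+ suc l
  -⇒+ n l n-l≡m = ℤₚ.+-injective (≡.trans (cancelled (+ n) (+ suc l)) (≡.cong (ℤ._+ + suc l) n-l≡m))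
    where
    cancelled : ∀ i j → i ≡ (i ℤ.- j) ℤ.+ j
    cancelled = ℤ.solve-∀

  -- Writing R i = (P^{i+1}; P)_∞ for i ≥ 0 and R i = 0 for i < 0, the Gaussian binomial [a+b, b+k] is
  -- R (a-k) R (b+k) (P; P)_{a+b} / (P; P)_∞².
  module FiniteTripleProduct (D : Disc) where
    private
      P = nome D

    opaque
      -- `Z i` is P^i R(i), the correction in R(i-1) = R(i) - P^i R(i). It is defined separately
      -- because P need not be invertible; at negative indices, where P^i would be meaningless, R
      -- vanishes anyway.
      R Z : ℤ → Carrier
      R (+ n)      = E D (P ^ suc n)
      R -[1+ n ]   = 0#
      Z (+ n)      = P ^ n * R (+ n)
      Z -[1+ n ]   = 0#

    -- For P = x y both clauses equal x^(k(k+1)/2) y^(k(k-1)/2).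
    t : Carrier → Carrier → ℤ → Carrier
    t x y (+ n)    = monomial D x n
    t x y -[1+ n ] = monomial D y (suc n)

    term : Carrier → Carrier → ℕ → ℕ → ℤ → Carrier
    term x y a b k = R (+ a ℤ.- k) * R (+ b ℤ.+ k) * t x y k

    opaque
      unfolding R

      R-pos : ∀ n → R (+ n) ≈ E D (P ^ suc n)
      R-pos n = refl

      R-neg : ∀ n → R -[1+ n ] ≈ 0#
      R-neg n = refl

      -- For i ≥ 1 this is `E-step`. At i = 0 the factor 1 - P^0 vanishes, in agreement with R(-1) =
      -- 0, so the recurrence crosses 0 without a boundary term.
      R-pred : ∀ i → R (ℤ.pred i) ≈ R i - Z i
      R-pred (+ zero)  = sym (trans (+-congˡ (-‿cong (*-identityˡ _))) (-‿inverseʳ _))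
      R-pred (+ suc n) = begin
        E D (P ^ suc n)                                          ≈⟨ E-step D (P ^ suc n) ⟩
        (1# - P ^ suc n) * E D (P ^ suc n * P)                   ≈⟨ *-congˡ
          (E-cong {D} {D} refl (*-comm (P ^ suc n) P)) ⟩
        (1# - P ^ suc n) * R (+ suc n)                           ≈⟨ solve 2
          (λ w e → (:1 :- w) :* e := e :- w :* e) refl (P ^ suc n) (R (+ suc n)) ⟩
        R (+ suc n) - P ^ suc n * R (+ suc n)                    ∎
      R-pred -[1+ n ]  = sym (-‿inverseʳ 0#)

      Z-* : ∀ i j N → i ℤ.+ j ≡ + N → Z i * Z j ≈ P ^ N * (R i * R j)
      Z-* (+ m) (+ n) _ ≡.refl = trans
        (solve 4 (λ u a v b → (u :* a) :* (v :* b) := (u :* v) :* (a :* b)) refl (P ^ m) (R (+ m)) (P ^ n) (R (+ n)))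
        (*-congʳ (sym (^-homo-* P m n)))
      Z-* (+ m) -[1+ n ] N _ = trans (zeroʳ _) (sym (trans (*-congˡ (zeroʳ _)) (zeroʳ _)))
      Z-* -[1+ m ] j N _ = trans (zeroˡ _) (sym (trans (*-congˡ (zeroˡ _)) (zeroʳ _)))

      -- The ratio t(k) / t(k-1) is x P^(k-1), and a - (k-1) = i. For k ≤ 0 the ratio is read off
      -- from y, and P = x y converts it; for i < 0 both sides vanish.
      Z-t : ∀ {x y} → P ≈ x * y → ∀ i k a → i ℤ.+ k ≡ + suc a → x * P ^ a * (R i * t x y (ℤ.pred k)) ≈ Z i * t x y k
      Z-t P≈xy -[1+ n ] k a _ = trans (trans (*-congˡ (zeroˡ _)) (zeroʳ _)) (sym (zeroˡ _))
      Z-t {x} {y} P≈xy (+ n) (+ zero) a n≡1+a rewrite ≡.trans (≡.sym (ℕₚ.+-identityʳ n)) (ℤₚ.+-injective n≡1+a) =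
        begin
        x * P ^ a * (e * (1# * (y * 1#)))  ≈⟨ solve 4
          (λ x w e y → x :* w :* (e :* (:1 :* (y :* :1))) := x :* y :* w :* e :* :1) refl x (P ^ a) e y ⟩
        x * y * P ^ a * e * 1#             ≈⟨ *-congʳ (*-congʳ (*-congʳ P≈xy)) ⟨
        P * P ^ a * e * 1#                 ∎
        where
        e : Carrier
        e = R (+ suc a)
      Z-t {x} {y} P≈xy (+ n) (+ suc l) a n+1+l≡1+a
        rewrite ≡.sym (ℕₚ.suc-injective (≡.trans (≡.sym (ℕₚ.+-suc n l)) (ℤₚ.+-injective n+1+l≡1+a))) = begin
        x * P ^ (n ℕ.+ l) * (R (+ n) * monomial D x l)      ≈⟨ *-congʳ (*-congˡ (^-homo-* P n l)) ⟩
        x * (P ^ n * P ^ l) * (R (+ n) * monomial D x l)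
          ≈⟨ solve 5 (λ x u v e m → x :* (u :* v) :* (e :* m) := u :* e :* (m :* (x :* v))) refl x (P ^ n) (P ^ l)
            (R (+ n)) (monomial D x l) ⟩
        P ^ n * R (+ n) * (monomial D x l * (x * P ^ l))    ∎
      Z-t {x} {y} P≈xy (+ n) -[1+ l ] a n-l≡1+a rewrite -⇒+ n l n-l≡1+a = begin
        x * P ^ a * (e * (monomial D y (suc l) * (y * P ^ suc l)))
          ≈⟨ solve 6 (λ x w e m y v → x :* w :* (e :* (m :* (y :* v))) := x :* y :* (w :* v) :* e :* m) refl x
            (P ^ a) e (monomial D y (suc l)) y (P ^ suc l) ⟩
        x * y * (P ^ a * P ^ suc l) * e * monomial D y (suc l)
          ≈⟨ *-congʳ (*-congʳ (*-cong P≈xy (^-homo-* P a (suc l)))) ⟨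
        P * P ^ (a ℕ.+ suc l) * e * monomial D y (suc l) ∎
        where
        e : Carrier
        e = R (+ (suc a ℕ.+ suc l))

    private
      c : ℕ → Carrier
      c = ∏ (factor D P)

      R₀ : Carrier
      R₀ = R (+ 0)

      -- The sum is finite but stated as a bilateral series: shifts need no bookkeeping of the range
      -- of k, and `error-series` can subtract the theta series term by term.
      FiniteIdentity : Carrier → Carrier → ℕ → ℕ → Set
      FiniteIdentity x y a b = BilateralSeries (λ k → c (a ℕ.+ b) * term x y a b k)
        (R₀ * R₀ * (∏ (factor D (- x)) a * ∏ (factor D (- y)) b))

    opaque
      -- Pascal's rule for Gaussian binomials, cleared of denominators. With i = a + 1 - k and j = b
      -- + k the right side is (Rᵢ - Zᵢ) Rⱼ + Zᵢ (Rⱼ - Zⱼ) = Rᵢ Rⱼ - Zᵢ Zⱼ times t(k), and Zᵢ Zⱼ =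
      -- P^(i+j) Rᵢ Rⱼ with i + j = a + b + 1.
      term-pascal : ∀ {x y} → P ≈ x * y → ∀ a b k →
        (1# - P * P ^ (a ℕ.+ b)) * term x y (suc a) b k ≈ term x y a b k + x * P ^ a * term x y a b (ℤ.pred k)
      term-pascal {x} {y} P≈xy a b k = sym (begin
        R (+ a ℤ.- k) * Rⱼ * tₖ + x * P ^ a * (R (+ a ℤ.- ℤ.pred k) * R (+ b ℤ.+ ℤ.pred k) * t x y (ℤ.pred k))
          ≡⟨ ≡.cong₂ (λ u v → R u * Rⱼ * tₖ + x * P ^ a * (R (+ a ℤ.- ℤ.pred k) * R v * t x y (ℤ.pred k)))
            (index₁ (+ a) k) (index₃ (+ b) k) ⟩
        R (ℤ.pred i) * Rⱼ * tₖ + x * P ^ a * (R (+ a ℤ.- ℤ.pred k) * R (ℤ.pred j) * t x y (ℤ.pred k))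
          ≡⟨ ≡.cong (λ u → R (ℤ.pred i) * Rⱼ * tₖ + x * P ^ a * (R u * R (ℤ.pred j) * t x y (ℤ.pred k)))
            (index₂ (+ a) k) ⟩
        R (ℤ.pred i) * Rⱼ * tₖ + x * P ^ a * (Rᵢ * R (ℤ.pred j) * t x y (ℤ.pred k))
          ≈⟨ +-congˡ (solve 4 (λ w e f m → w :* (e :* f :* m) := w :* (e :* m) :* f) refl (x * P ^ a) Rᵢ
            (R (ℤ.pred j)) (t x y (ℤ.pred k))) ⟩
        R (ℤ.pred i) * Rⱼ * tₖ + x * P ^ a * (Rᵢ * t x y (ℤ.pred k)) * R (ℤ.pred j)
          ≈⟨ +-cong (*-congʳ (*-congʳ (R-pred i))) (*-cong (Z-t P≈xy i k a (index-i+k (+ a) k)) (R-pred j)) ⟩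
        (Rᵢ - Zᵢ) * Rⱼ * tₖ + Zᵢ * tₖ * (Rⱼ - Zⱼ)
          ≈⟨ solve 5 (λ e f u v m → (e :- u) :* f :* m :+ u :* m :* (f :- v) :=
            (e :* f :- u :* v) :* m) refl Rᵢ Rⱼ Zᵢ Zⱼ tₖ ⟩
        (Rᵢ * Rⱼ - Zᵢ * Zⱼ) * tₖ
          ≈⟨ *-congʳ (+-congˡ (-‿cong (Z-* i j (suc (a ℕ.+ b)) (index-i+j (+ a) (+ b) k)))) ⟩
        (Rᵢ * Rⱼ - P ^ suc (a ℕ.+ b) * (Rᵢ * Rⱼ)) * tₖ
          ≈⟨ solve 3 (λ w e m → (e :- w :* e) :* m := (:1 :- w) :* (e :* m)) refl (P ^ suc (a ℕ.+ b)) (Rᵢ * Rⱼ) tₖ ⟩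
        (1# - P ^ suc (a ℕ.+ b)) * (Rᵢ * Rⱼ * tₖ) ∎)
        where
        i j : ℤ
        i = + suc a ℤ.- k
        j = + b ℤ.+ k
        Rᵢ Rⱼ Zᵢ Zⱼ tₖ : Carrier
        Rᵢ = R i
        Rⱼ = R j
        Zᵢ = Z i
        Zⱼ = Z j
        tₖ = t x y k
        index₁ : ∀ a k → a ℤ.- k ≡ ℤ.-1ℤ ℤ.+ (ℤ.1ℤ ℤ.+ a ℤ.- k)
        index₁ = ℤ.solve-∀
        index₂ : ∀ a k → a ℤ.- (ℤ.-1ℤ ℤ.+ k) ≡ ℤ.1ℤ ℤ.+ a ℤ.- k
        index₂ = ℤ.solve-∀
        index₃ : ∀ b k → b ℤ.+ (ℤ.-1ℤ ℤ.+ k) ≡ ℤ.-1ℤ ℤ.+ (b ℤ.+ k)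
        index₃ = ℤ.solve-∀
        index-i+k : ∀ a k → (ℤ.1ℤ ℤ.+ a ℤ.- k) ℤ.+ k ≡ ℤ.1ℤ ℤ.+ a
        index-i+k = ℤ.solve-∀
        index-i+j : ∀ a b k → (ℤ.1ℤ ℤ.+ a ℤ.- k) ℤ.+ (b ℤ.+ k) ≡ ℤ.1ℤ ℤ.+ (a ℤ.+ b)
        index-i+j = ℤ.solve-∀

    opaque
      -- Multiplying the product side by its new factor 1 + x P^a adds to the series x P^a times its
      -- shift by one; `term-pascal` recombines the two, and its left factor extends (P; P)_(a+b).
      identity-step : ∀ {x y} → P ≈ x * y → ∀ a b → FiniteIdentity x y a b → FiniteIdentity x y (suc a) b
      identity-step {x} {y} P≈xy a b S = bilateral-cong termwise value
        (bilateral-+ S (bilateral-scale (x * P ^ a) (bilateral-shift S)))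
        where
        termwise : ∀ k → c (a ℕ.+ b) * term x y a b k + x * P ^ a * (c (a ℕ.+ b) * term x y a b (ℤ.pred k))
          ≈ c (suc a ℕ.+ b) * term x y (suc a) b k
        termwise k = begin
          c (a ℕ.+ b) * term x y a b k + x * P ^ a * (c (a ℕ.+ b) * term x y a b (ℤ.pred k))
            ≈⟨ solve 4 (λ c u w v → c :* u :+ w :* (c :* v) := c :* (u :+ w :* v)) refl (c (a ℕ.+ b))
              (term x y a b k) (x * P ^ a) (term x y a b (ℤ.pred k)) ⟩
          c (a ℕ.+ b) * (term x y a b k + x * P ^ a * term x y a b (ℤ.pred k))
            ≈⟨ *-congˡ (term-pascal P≈xy a b k) ⟨
          c (a ℕ.+ b) * ((1# - P * P ^ (a ℕ.+ b)) * term x y (suc a) b k)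
            ≈⟨ *-assoc _ _ _ ⟨
          c (suc a ℕ.+ b) * term x y (suc a) b k ∎
        value : R₀ * R₀ * (∏ (factor D (- x)) a * ∏
          (factor D (- y)) b) + x * P ^ a * (R₀ * R₀ * (∏ (factor D (- x)) a * ∏ (factor D (- y)) b))
          ≈ R₀ * R₀ * (∏ (factor D (- x)) (suc a) * ∏ (factor D (- y)) b)
        value = solve 5 (λ r p q x w → r :* (p :* q) :+ x :* w :* (r :* (p :* q)) := r :*
          (p :* (:1 :- :- x :* w) :* q)) refl
          (R₀ * R₀) (∏ (factor D (- x)) a) (∏ (factor D (- y)) b) x (P ^ a)

      t-reflect : ∀ x y k → t x y (ℤ.- k) ≈ t y x k
      t-reflect x y (+ zero)  = refl
      t-reflect x y (+ suc n) = refl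
      t-reflect x y -[1+ n ]  = refl

      -- Replacing k by -k exchanges (x, a) with (y, b), so induction on b needs no second Pascal
      -- rule.
      identity-reflect : ∀ {x y} a b → FiniteIdentity x y a b → FiniteIdentity y x b a
      identity-reflect {x} {y} a b S = bilateral-cong termwise
        (*-congˡ (*-comm _ _)) (bilateral-reflect S)
        where
        termwise : ∀ k → c (a ℕ.+ b) * term x y a b (ℤ.- k) ≈ c (b ℕ.+ a) * term y x b a k
        termwise k = *-cong (reflexive (≡.cong c (ℕₚ.+-comm a b)))
          (*-cong (trans (*-congʳ (reflexive (≡.cong (λ l → R (+ a ℤ.+ l)) (ℤₚ.neg-involutive k)))) (*-comm _ _))
            (t-reflect x y k))

      identity-base : ∀ x y → FiniteIdentity x y 0 0
      -- R(-k) R(k) vanishes unless k = 0, which leaves a single term.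
      identity-base x y = bilateral-cong {λ k → δ k} termwise refl record
        { right-series = series-cons series-0
        ; left-series  = series-0
        ; total        = solve 1 (λ r → r :* (:1 :* :1) := r :+ :0 :+ :0) refl (R₀ * R₀)
        }
        where
        δ : ℤ → Carrier
        δ (+ zero)  = R₀ * R₀
        δ (+ suc n) = 0#
        δ -[1+ n ]  = 0#
        termwise : ∀ k → δ k ≈ c 0 * term x y 0 0 k
        termwise (+ zero)  = solve 1 (λ r → r := :1 :* (r :* :1)) refl (R₀ * R₀)
        termwise (+ suc n) = sym (trans (*-congˡ (*-congʳ (*-congʳ (R-neg n))))
          (solve 2 (λ u v → :1 :* (:0 :* u :* v) := :0) refl (R (+ suc n)) (monomial D x (suc n))))
        termwise -[1+ n ]  = sym (trans (*-congˡ (*-congʳ (*-congˡ (R-neg n))))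
          (solve 2 (λ u v → :1 :* (u :* :0 :* v) := :0) refl (R (+ suc n)) (monomial D y (suc n))))

      identity : ∀ {x y} → P ≈ x * y → ∀ a b → FiniteIdentity x y a b
      identity P≈xy (suc a) b       = identity-step P≈xy a b (identity P≈xy a b)
      identity P≈xy zero    (suc b) = identity-reflect (suc b) 0
        (identity-step (trans P≈xy (*-comm _ _)) b 0 (identity-reflect 0 b (identity P≈xy 0 b)))
      identity P≈xy zero    zero    = identity-base _ _

  module TripleProduct (D : Disc) where
    open FiniteTripleProduct D
    private
      P = nome D
      r = ratio (radius D)
      s = ratio (relaxed D)
      0≤r = nonneg (radius D)
      M = proj₁ (E-near-1 D)
      0≤M = proj₁ (proj₂ (E-near-1 D))

      -- From u v - 1 = (u - 1) v + (v - 1) with u, v within M r^d of 1 and v bounded by 1 + M. The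
      -- final 1 makes B ≥ 1, which `weighted` needs beyond the range of the finite sum.
      B : K
      B = M *ᵏ (1ᵏ +ᵏ M) +ᵏ M +ᵏ 1ᵏ

    opaque
      ^-antitone : ∀ (ρ : Contraction) m n → ratio ρ ^ᵏ (m ℕ.+ n) ≤ ratio ρ ^ᵏ n
      ^-antitone ρ m n = ≤-trans (≤-reflexive (^ᵏ-homo-* (ratio ρ) m n))
        (≤-trans (*-monoˡ-≤ (0≤^ (nonneg ρ) n) (^≤1 ρ m))
          (≤-reflexive (solveᵏ 1 (λ w → :1 :* w := w) ≡.refl (ratio ρ ^ᵏ n))))

      R-near-1 : ∀ n → R (+ n) - 1# ≼ M *ᵏ r ^ᵏ n
      R-near-1 n = ≼-mono
        (≼-resp-≈ (+-congʳ (sym (R-pos n)))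
          (proj₂ (proj₂ (E-near-1 D)) (≼-^ (nome≼ D) (suc n)) (^≤1 (radius D) (suc n))))
        (≤-trans (*-monoˡ-≤ 0≤M (^-antitone (radius D) 1 n))
          (≤-reflexive (solveᵏ 2 (λ w M → w :* M := M :* w) ≡.refl (r ^ᵏ n) M)))

      0≤1+M : 0ᵏ ≤ 1ᵏ +ᵏ M
      0≤1+M = 0≤+ 0≤1 0≤M

      0≤B : 0ᵏ ≤ B
      0≤B = 0≤+ (0≤+ (0≤* 0≤M 0≤1+M) 0≤M) 0≤1

      1≤B : 1ᵏ ≤ B
      1≤B = +≤ (0≤+ (0≤* 0≤M 0≤1+M) 0≤M)

      R≼ : ∀ n → R (+ n) ≼ 1ᵏ +ᵏ M
      R≼ n = ≼-mono (≼-resp-≈ (solve 1 (λ e → :1 :+ (e :- :1) := e) refl (R (+ n))) (≼-+ ≼-1 (R-near-1 n)))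
        (+-mono-≤ ≤-refl (≤-trans (*-monoʳ-≤ 0≤M (^≤1 (radius D) n)) (≤-reflexive (*ᵏ-identityʳ M))))

      RR-near-1 : ∀ d e → R (+ d) * R (+ (e ℕ.+ d)) - 1# ≼ B *ᵏ r ^ᵏ d
      RR-near-1 d e = ≼-mono
        (≼-resp-≈ (solve 2 (λ u v → (u :- :1) :* v :+ (v :- :1) := u :* v :- :1) refl (R (+ d)) (R (+ (e ℕ.+ d))))
          (≼-+ (≼-* (R-near-1 d) (R≼ (e ℕ.+ d))) (R-near-1 (e ℕ.+ d))))
        (≤-trans (+-mono-≤ ≤-refl (*-monoʳ-≤ 0≤M (^-antitone (radius D) e d)))
          (≤-by (0≤^ 0≤r d) (solveᵏ 2
            (λ M w → M :* w :* (:1 :+ M) :+ M :* w :+ w := (M :* (:1 :+ M) :+ M :+ :1) :* w) ≡.refl M (r ^ᵏ d))))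

      -- Dominated convergence with an explicit rate. For l ≤ n the coefficient is within B r^(n-l)
      -- of 1, and the term contributes r^l. For l > n the coefficient R(n-l) R(n+l) is 0, and r^l ≤
      -- r^n already suffices.
      weighted : ∀ n l {τ e} → 0ᵏ ≤ e → τ ≼ r ^ᵏ l *ᵏ e →
        (R (+ n ℤ.- + l) * R (+ n ℤ.+ + l) - 1#) * τ ≼ B *ᵏ r ^ᵏ n *ᵏ e
      weighted n l {τ} {e} 0≤e τ≼ with ℕₚ.≤-<-connex l n
      ... | inj₁ l≤n with ℕₚ.m≤n⇒∃[o]m+o≡n l≤n
      ... | o , ≡.refl = ≼-mono (≼-* (≼-resp-≈ rewritten (RR-near-1 o (l ℕ.+ l))) τ≼)
        (≤-reflexive (≡.trans (solveᵏ 4 (λ B u v e → B :* u :* (v :* e) := B :* (v :* u) :* e) ≡.refl B (r ^ᵏ o)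
          (r ^ᵏ l) e)
          (≡.cong (λ w → B *ᵏ w *ᵏ e) (≡.sym (^ᵏ-homo-* r l o)))))
        where
        index : ∀ i j → i ℤ.+ j ℤ.- i ≡ j
        index = ℤ.solve-∀
        index′ : ∀ i j → (i ℤ.+ j) ℤ.+ i ≡ (i ℤ.+ i) ℤ.+ j
        index′ = ℤ.solve-∀
        rewritten : R (+ o) * R (+ (l ℕ.+ l ℕ.+ o)) - 1# ≈ R (+ (l ℕ.+ o) ℤ.- + l) * R (+ (l ℕ.+ o) ℤ.+ + l) - 1#
        rewritten = +-congʳ (sym (*-cong (reflexive (≡.cong R (index (+ l) (+ o))))
          (reflexive (≡.cong R (index′ (+ l) (+ o))))))
      weighted n l {τ} {e} 0≤e τ≼ | inj₂ n<l with ℕₚ.m≤n⇒∃[o]m+o≡n n<l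
      ... | o , ≡.refl = ≼-mono (≼-resp-≈ rewritten (≼-neg τ≼))
        (≤-trans (*-monoˡ-≤ 0≤e (≡.subst (λ k → r ^ᵏ k ≤ r ^ᵏ n) (≡.cong suc (ℕₚ.+-comm o n))
          (^-antitone (radius D) (suc o) n)))
          (*-monoˡ-≤ 0≤e (≤-trans (≤-reflexive (solveᵏ 1 (λ w → w := :1 :* w) ≡.refl (r ^ᵏ n)))
            (*-monoˡ-≤ (0≤^ 0≤r n) 1≤B))))
        where
        index : ∀ i j → i ℤ.- (ℤ.1ℤ ℤ.+ (i ℤ.+ j)) ≡ ℤ.- (ℤ.1ℤ ℤ.+ j)
        index = ℤ.solve-∀
        rewritten : - τ ≈ (R (+ n ℤ.- + (suc n ℕ.+ o)) * R (+ n ℤ.+ + (suc n ℕ.+ o)) - 1#) * τ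
        rewritten = sym (trans (*-congʳ
          (+-congʳ (*-congʳ (trans (reflexive (≡.cong R (index (+ n) (+ o)))) (R-neg o)))))
          (solve 2 (λ u τ → (:0 :* u :- :1) :* τ := :- τ) refl (R (+ n ℤ.+ + (suc n ℕ.+ o))) τ))

    opaque
      ϑ-series : ∀ x y → BilateralSeries (t x y) (ϑ D x y)
      ϑ-series x y = record { right-series = G-series D x ; left-series = series-tail (G-series D y) ; total = refl }

    module _ {x y : Carrier} (P≈xy : P ≈ x * y) where
      private
        c : ℕ → Carrier
        c = ∏ (factor D P)

        R₀ : Carrier
        R₀ = R (+ 0)

        -- The product side of the finite identity at a = b = n, minus (P; P)_(2n) times the theta
        -- function. As a series it has the coefficients that `weighted` estimates, so it tends to
        -- 0; as a formula its limit is explicit.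
        error : ℕ → Carrier
        error n = R₀ * R₀ * (∏ (factor D (- x)) n * ∏ (factor D (- y)) n) + - c (n ℕ.+ n) * ϑ D x y

        -- A common bound for x and y, so that both halves of the series share one `MonomialBound`.
        X : K
        X = proj₁ (bounded x) +ᵏ proj₁ (bounded y)

      opaque
        error-series : ∀ n → BilateralSeries (λ k → c (n ℕ.+ n) * ((R (+ n ℤ.- k) * R (+ n ℤ.+ k) - 1#) * t x y k))
          (error n)
        error-series n = bilateral-cong
          (λ k → solve 3 (λ c e m → c :* (e :* m) :+ :- c :* m := c :* ((e :- :1) :* m)) refl (c (n ℕ.+ n))
            (R (+ n ℤ.- k) * R (+ n ℤ.+ k)) (t x y k))
          refl (bilateral-+ (identity P≈xy n n) (bilateral-scale (- c (n ℕ.+ n)) (ϑ-series x y)))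

        x≼X : x ≼ X
        x≼X = ≼-mono (proj₂ (bounded x)) (≤+ (≼⇒0≤ (proj₂ (bounded y))))

        y≼X : y ≼ X
        y≼X = ≼-mono (proj₂ (bounded y)) (+≤ (≼⇒0≤ (proj₂ (bounded x))))

        0≤X : 0ᵏ ≤ X
        0≤X = ≼⇒0≤ x≼X

      private
        open module Mono = MonomialBound (monomialBound D X 0≤X)

        A : K → K
        A b = b *ᵏ B *ᵏ constant *ᵏ κ D +ᵏ b *ᵏ B *ᵏ constant *ᵏ κ D

      opaque
        error-≼ : ∀ {b} n → c (n ℕ.+ n) ≼ b → error n ≼ A b *ᵏ r ^ᵏ n
        error-≼ {b} n c≼b = ≼-≡
          (solveᵏ 5 (λ b B w C κ → b :* (B :* w) :* C :* κ :+ b :* (B :* w) :* C :* κ :=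
            (b :* B :* C :* κ :+ b :* B :* C :* κ) :* w) ≡.refl b B (r ^ᵏ n) constant (κ D))
          (bilateral-≼ (relaxed D) (0≤* 0≤bBw 0≤constant) right-≼ left-≼ (error-series n))
          where
          0≤bBw : 0ᵏ ≤ b *ᵏ (B *ᵏ r ^ᵏ n)
          0≤bBw = 0≤* (≼⇒0≤ c≼b) (0≤* 0≤B (0≤^ 0≤r n))
          scaled : ∀ {z e l} → z ≼ B *ᵏ r ^ᵏ n *ᵏ e → e ≤ constant *ᵏ s ^ᵏ l →
            c (n ℕ.+ n) * z ≼ b *ᵏ (B *ᵏ r ^ᵏ n) *ᵏ constant *ᵏ s ^ᵏ l
          scaled {z} {e} {l} z≼ e≤ = ≼-mono (≼-* c≼b z≼)
            (≤-trans (≤-reflexive (solveᵏ 3 (λ b w e → b :* (w :* e) := b :* w :* e) ≡.refl b (B *ᵏ r ^ᵏ n) e))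
              (≤-trans (*-monoʳ-≤ 0≤bBw e≤)
                (≤-reflexive (solveᵏ 3 (λ b C w → b :* (C :* w) := b :* C :* w) ≡.refl
                  (b *ᵏ (B *ᵏ r ^ᵏ n)) constant (s ^ᵏ l)))))
          right-≼ : ∀ l → c (n ℕ.+ n) * ((R (+ n ℤ.- + l) * R (+ n ℤ.+ + l) - 1#) * monomial D x l)
            ≼ b *ᵏ (B *ᵏ r ^ᵏ n) *ᵏ constant *ᵏ s ^ᵏ l
          right-≼ l = scaled {l = l} (weighted n l (Mono.0≤bound l) (Mono.monomial≼ x≼X l)) (Mono.geometric l)
          left-≼ : ∀ l → c (n ℕ.+ n) * ((R (+ n ℤ.- -[1+ l ]) * R (+ n ℤ.+ -[1+ l ]) - 1#) * monomial D y (suc l))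
            ≼ b *ᵏ (B *ᵏ r ^ᵏ n) *ᵏ constant *ᵏ s ^ᵏ l
          left-≼ l = scaled {l = l} (≼-resp-≈ (*-congʳ (+-congʳ (*-comm _ _)))
              (weighted n (suc l) (Mono.0≤bound (suc l)) (Mono.monomial≼ y≼X (suc l))))
            (≤-trans (Mono.geometric (suc l)) (*-monoʳ-≤ 0≤constant (^-antitone (relaxed D) 1 l)))

        error-limit : Limit error (R₀ * R₀ * (E D (- x) * E D (- y)) + - E D P * ϑ D x y)
        error-limit = limit-+ (limit-scale (R₀ * R₀) (limit-* (E-product D (- x)) (E-product D (- y))))
          (limit-* (limit-cong {λ n → - 1# * c (n ℕ.+ n)} (λ n → -1* (c (n ℕ.+ n))) (-1* (E D P))
              (limit-scale (- 1#) (limit-∘ (λ n → n ℕ.+ n) (λ n → ℕₚ.m≤m+n n n) (E-product D P))))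
            (limit-const (ϑ D x y)))

        error-vanishes : R₀ * R₀ * (E D (- x) * E D (- y)) + - E D P * ϑ D x y ≈ 0#
        error-vanishes = let b , N , c≼b = limit⇒bounded (E-product D P)
                             0≤b = ≼⇒0≤ (c≼b N ℕₚ.≤-refl)
                             0≤bBCκ = 0≤* (0≤* (0≤* 0≤b 0≤B) 0≤constant) (0≤κ D)
                             0≤A = 0≤+ 0≤bBCκ 0≤bBCκ
          -- The bound on the finite products (P; P)_n is known only from N on, so the error
          -- sequence is started there.
          in limit-unique {λ n → error (N ℕ.+ n)} (limit-∘ (N ℕ.+_) (λ n → ℕₚ.m≤n+m n N) error-limit)
            (limit-vanishing {L = 0#} (λ n → ≼-resp-≈ (solve 1 (λ e → e := e :- :0) refl (error (N ℕ.+ n)))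
                (≼-mono (error-≼ (N ℕ.+ n) (c≼b _ (ℕₚ.≤-trans (ℕₚ.m≤m+n N n) (ℕₚ.m≤m+n (N ℕ.+ n) (N ℕ.+ n)))))
                  (*-monoʳ-≤ 0≤A (^-antitone (radius D) N n))))
              (geometric-vanishing (radius D) 0≤A))

        -- R(0) is (P; P)_∞, so the limit reads (P; P)_∞² (-x; P)_∞ (-y; P)_∞ = (P; P)_∞ f(x, y),
        -- and one factor is cancelled by its inverse.
        triple-product : ϑ D x y ≈ E D (- x) * E D (- y) * E D P
        triple-product = cancel (E-invertible D) (begin
          E D P * ϑ D x y
            ≈⟨ solve 3 (λ r e t → e :* t := r :- (r :+ :- e :* t)) refl (R₀ * R₀ * (E D (- x) * E D (- y))) (E D P)
              (ϑ D x y) ⟩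
          R₀ * R₀ * (E D (- x) * E D (- y)) - (R₀ * R₀ * (E D (- x) * E D (- y)) + - E D P * ϑ D x y)
            ≈⟨ +-congˡ (-‿cong error-vanishes) ⟩
          R₀ * R₀ * (E D (- x) * E D (- y)) - 0#
            ≈⟨ solve 2 (λ r e → r :* r :* e :- :0 := r :* (e :* r)) refl R₀ (E D (- x) * E D (- y)) ⟩
          R₀ * (E D (- x) * E D (- y) * R₀)
            ≈⟨ *-cong R₀≈ (*-congˡ R₀≈) ⟩
          E D P * (E D (- x) * E D (- y) * E D P) ∎)
          where
          R₀≈ : R₀ ≈ E D P
          R₀≈ = trans (R-pos 0) (E-cong {D} {D} refl (*-identityʳ P))

-- Identities between theta functions

module ThetaIdentities {F : ArchimedeanField} (𝔸 : CompleteNormedRing F) where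
  open Jacobi 𝔸 public
  open import Relation.Binary.Reasoning.Setoid setoid

  opaque
    -‿* : ∀ x y → (- x) * (- y) ≈ x * y
    -‿* = solve 2 (λ x y → :- x :* :- y := x :* y) refl

    neg-neg : ∀ x → - (- x) ≈ x
    neg-neg = solve 1 (λ x → :- :- x := x) refl

    ϑ-neg : ∀ D {x y} → nome D ≈ x * y → ϑ D (- x) (- y) ≈ E D x * E D y * E D (nome D)
    ϑ-neg D {x} {y} P≈xy = trans (TripleProduct.triple-product D (trans P≈xy (sym (-‿* x y))))
      (*-congʳ (*-cong (E-cong {D} {D} refl (neg-neg x)) (E-cong {D} {D} refl (neg-neg y))))

    -- Negating x and y preserves the nome, x², y² and z = y/x; only the sign of the odd part in
    -- `ϑ-bisect` flips.
    difference-of-squares : ∀ D {x y z} → nome D ≈ x * y → x * z ≈ y →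
      ϑ D x y * ϑ D (- x) (- y) ≈
        ϑ (square (square D)) (x * x * nome D) (y * y * nome D) * ϑ (square (square D)) (x * x * nome D)
          (y * y * nome D)
        - x * x * (ϑ (square (square D)) z (x * x * nome D * nome D * nome D) * ϑ (square (square D)) z
          (x * x * nome D * nome D * nome D))
    difference-of-squares D {x} {y} {z} P≈xy xz≈y = begin
      ϑ D x y * ϑ D (- x) (- y)
        ≈⟨ *-cong (ϑ-bisect D P≈xy xz≈y) (ϑ-bisect D (trans P≈xy (sym (-‿* x y))) -xz≈-y) ⟩
      (A + x * B) * (ϑ D⁴ (- x * - x * P) (- y * - y * P) + - x * ϑ D⁴ z (- x * - x * P * P * P))
        ≈⟨ *-congˡ (+-cong (ϑ-cong {D⁴} {D⁴} refl (*-congʳ (-‿* x x)) (*-congʳ (-‿* y y)))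
             (*-congˡ (ϑ-cong {D⁴} {D⁴} refl refl (*-congʳ (*-congʳ (*-congʳ (-‿* x x))))))) ⟩
      (A + x * B) * (A + - x * B)
        ≈⟨ solve 3 (λ A x B → (A :+ x :* B) :* (A :+ :- x :* B) := A :* A :- x :* x :* (B :* B)) refl A x B ⟩
      A * A - x * x * (B * B) ∎
      where
      D⁴ : Disc
      D⁴ = square (square D)
      P A B : Carrier
      P = nome D
      A = ϑ D⁴ (x * x * P) (y * y * P)
      B = ϑ D⁴ z (x * x * P * P * P)
      -xz≈-y : - x * z ≈ - y
      -xz≈-y = trans (solve 2 (λ x z → :- x :* z := :- (x :* z)) refl x z) (-‿cong xz≈y)

    -- The factors at x and -x merge into (x²; P²)_∞, likewise for y, and (P; P)_∞² = (P; P²)_∞²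
    -- (P²; P²)_∞². One factor (P²; P²)_∞ goes to each of the two theta functions on the right.
    product-of-conjugates : ∀ D {x y} → nome D ≈ x * y →
      ϑ D x y * ϑ D (- x) (- y) ≈ ϑ (square D) (- nome D) (- nome D) * ϑ (square D) (- (x * x)) (- (y * y))
    product-of-conjugates D {x} {y} P≈xy = begin
      ϑ D x y * ϑ D (- x) (- y)
        ≈⟨ *-cong (TripleProduct.triple-product D P≈xy) (ϑ-neg D P≈xy) ⟩
      E D (- x) * E D (- y) * e * (E D x * E D y * e)
        ≈⟨ solve 5 (λ a b c d e → a :* b :* e :* (c :* d :* e) := c :* a :* (d :* b) :* (e :* e)) refl (E D (- x))
          (E D (- y)) (E D x) (E D y) e ⟩
      E D x * E D (- x) * (E D y * E D (- y)) * (e * e)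
        ≈⟨ *-cong (*-cong (E-square D x) (E-square D y)) (*-cong (E-bisect D P) (E-bisect D P)) ⟩
      E² (x * x) * E² (y * y) * (E² P * e₂ * (E² P * e₂))
        ≈⟨ solve 4 (λ a b p e → a :* b :* (p :* e :* (p :* e)) := p :* p :* e :* (a :* b :* e)) refl (E² (x * x))
          (E² (y * y)) (E² P) e₂ ⟩
      E² P * E² P * e₂ * (E² (x * x) * E² (y * y) * e₂)
        ≈⟨ *-cong (ϑ-neg (square D) refl) (ϑ-neg (square D) P²≈) ⟨
      ϑ (square D) (- P) (- P) * ϑ (square D) (- (x * x)) (- (y * y)) ∎
      where
      P e e₂ : Carrier
      P = nome D
      e = E D P
      e₂ = E (square D) (P * P)
      E² : Carrier → Carrier
      E² = E (square D)
      P²≈ : P * P ≈ x * x * (y * y)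
      P²≈ = trans (*-cong P≈xy P≈xy) (solve 2 (λ x y → x :* y :* (x :* y) := x :* x :* (y :* y)) refl x y)

    -- ψ(P) (P; P)_∞ = (P²; P²)_∞²
    ψ-product : ∀ D → ϑ (square (square D)) (nome D) (nome D * nome D * nome D) * E D (nome D)
      ≈ E (square D) (nome (square D)) * E (square D) (nome (square D))
    ψ-product D = begin
      ϑ D⁴ P (P * P * P) * E D P
        ≈⟨ *-cong (TripleProduct.triple-product D⁴
          (solve 1 (λ P → P :* P :* (P :* P) := P :* (P :* P :* P)) refl P)) (E-bisect D P) ⟩
      E D⁴ (- P) * E D⁴ (- (P * P * P)) * E D⁴ (nome D⁴) * (E D² P * E D² (P * P))
        ≈⟨ *-congʳ (*-congʳ (*-congˡ
          (E-cong {D⁴} {D⁴} refl (solve 1 (λ P → :- (P :* P :* P) := :- P :* (P :* P)) refl P)))) ⟩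
      E D⁴ (- P) * E D⁴ (- P * nome D²) * E D⁴ (nome D⁴) * (E D² P * E D² (P * P))
        ≈⟨ *-congʳ (*-congʳ (E-bisect D² (- P))) ⟨
      E D² (- P) * E D⁴ (nome D⁴) * (E D² P * E D² (P * P))
        ≈⟨ solve 4 (λ a b c d → a :* b :* (c :* d) := c :* a :* b :* d) refl (E D² (- P)) (E D⁴ (nome D⁴)) (E D² P)
          (E D² (P * P)) ⟩
      E D² P * E D² (- P) * E D⁴ (nome D⁴) * E D² (P * P)
        ≈⟨ *-congʳ (*-congʳ (E-square D² P)) ⟩
      E D⁴ (P * P) * E D⁴ (nome D⁴) * E D² (P * P)
        ≈⟨ *-congʳ (E-bisect D² (P * P)) ⟨
      E D² (P * P) * E D² (P * P) ∎
      where
      P : Carrier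
      P = nome D
      D² D⁴ : Disc
      D² = square D
      D⁴ = square D²

  -- `b` stands for 1/s and may be large. The moduli p², p⁴ and p⁸ of the theta functions do not
  -- involve s.
  module Quotient (D : Disc) {s b : Carrier} (sb≈1 : s * b ≈ 1#) where
    D² D⁴ : Disc
    D² = square D
    D⁴ = square D²

    p e₄ num den ψ ϑ₀ : Carrier
    p   = nome D
    e₄  = E D⁴ (nome D⁴)
    num = E D⁴ (p * (b * b)) * E D⁴ (p * p * p * (s * s))
    den = E D⁴ (p * (s * s)) * E D⁴ (p * p * p * (b * b))
    -- ψ(p²) = f(p², p⁶) has nome p⁸, the square of the nome of `D⁴`.
    ψ   = ϑ (square D⁴) (p * p) (p * p * (p * p) * (p * p))
    ϑ₀  = ϑ D² (- (p * (b * b))) (- (p * (s * s)))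

    opaque
      s²b²≈1 : s * s * (b * b) ≈ 1#
      s²b²≈1 = trans (solve 2 (λ s b → s :* s :* (b :* b) := s :* b :* (s :* b)) refl s b)
        (trans (*-cong sb≈1 sb≈1) (*-identityˡ 1#))

      ϑ-num : ϑ D⁴ (- (p * (b * b))) (- (p * p * p * (s * s))) ≈ num * e₄
      ϑ-num = ϑ-neg D⁴ (sym (trans
        (solve 3 (λ p s b → p :* b :* (p :* p :* p :* s) := p :* p :* (p :* p) :* (s :* b)) refl p (s * s) (b * b))
        (trans (*-congˡ s²b²≈1) (*-identityʳ _))))

      ϑ-den : ϑ D⁴ (- (p * (s * s))) (- (p * p * p * (b * b))) ≈ den * e₄
      ϑ-den = ϑ-neg D⁴ (sym (trans
        (solve 3 (λ p s b → p :* s :* (p :* p :* p :* b) := p :* p :* (p :* p) :* (s :* b)) refl p (s * s) (b * b))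
        (trans (*-congˡ s²b²≈1) (*-identityʳ _))))

      -- Bisecting the two products of modulus p² in `ϑ₀` yields exactly the four products of
      -- modulus p⁴ in `num` and `den`. The remaining (p²; p²)_∞ combines with ψ(p²) by `ψ-product`.
      ψ-ϑ₀ : ψ * ϑ₀ ≈ e₄ * e₄ * (num * den)
      ψ-ϑ₀ = begin
        ψ * ϑ₀
          ≈⟨ *-congˡ (ϑ-neg D² (sym (trans
            (solve 3 (λ p b s → p :* b :* (p :* s) := p :* p :* (s :* b)) refl p (b * b) (s * s))
               (trans (*-congˡ s²b²≈1) (*-identityʳ _))))) ⟩
        ψ * (E D² (p * (b * b)) * E D² (p * (s * s)) * e₂)
          ≈⟨ *-congˡ (*-congʳ (*-cong (E-bisect′ (b * b)) (E-bisect′ (s * s)))) ⟩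
        ψ * (E D⁴ (p * (b * b)) * E D⁴ (p * p * p * (b * b)) * (E D⁴ (p * (s * s)) * E D⁴ (p * p * p * (s * s))) * e₂)
          ≈⟨ *-congˡ (*-congʳ (solve 4 (λ a b c d → a :* b :* (c :* d) := a :* d :* (c :* b)) refl
            (E D⁴ (p * (b * b))) (E D⁴ (p * p * p * (b * b))) (E D⁴ (p * (s * s))) (E D⁴ (p * p * p * (s * s))))) ⟩
        ψ * (num * den * e₂)
          ≈⟨ solve 3 (λ a b c → a :* (b :* c) := a :* c :* b) refl ψ (num * den) e₂ ⟩
        ψ * e₂ * (num * den)
          ≈⟨ *-congʳ (ψ-product D²) ⟩
        e₄ * e₄ * (num * den) ∎
        where
        e₂ : Carrier
        e₂ = E D² (nome D²)
        E-bisect′ : ∀ c → E D² (p * c) ≈ E D⁴ (p * c) * E D⁴ (p * p * p * c)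
        E-bisect′ c = trans (E-bisect D² (p * c))
          (*-congˡ (E-cong {D⁴} {D⁴} refl (solve 2 (λ p c → p :* c :* (p :* p) := p :* p :* p :* c) refl p c)))

      -- Both (x, y) = (s, -p/s) and (x, y) = (√-1 s, -√-1 p/s) satisfy the hypotheses.
      numerator : ∀ D′ {x y} → nome D² ≈ nome (square D′) → nome D′ ≈ x * y → x * - (p * (b * b)) ≈ y →
        x * x * nome D′ ≈ - (p * (s * s)) → y * y * nome D′ ≈ - (p * p * p * (b * b)) →
        x * x * nome D′ * nome D′ * nome D′ ≈ - (p * p * p * (s * s)) →
        e₄ * e₄ * (den * den - x * x * (num * num)) ≈ ϑ D² (- nome D′) (- nome D′) * ϑ D² (- (x * x)) (- (y * y))
      numerator D′ {x} {y} same-square P≈xy xz≈y arg₁ arg₂ arg₃ = begin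
        e₄ * e₄ * (den * den - x * x * (num * num))
          ≈⟨ solve 4 (λ e d n x → e :* e :* (d :* d :- x :* (n :* n)) := d :* e :* (d :* e) :- x :*
            (n :* e :* (n :* e))) refl e₄ den num (x * x) ⟩
        den * e₄ * (den * e₄) - x * x * (num * e₄ * (num * e₄))
          ≈⟨ +-cong (*-cong A≈ A≈) (-‿cong (*-congˡ (*-cong B≈ B≈))) ⟨
        _ ≈⟨ difference-of-squares D′ P≈xy xz≈y ⟨
        ϑ D′ x y * ϑ D′ (- x) (- y)
          ≈⟨ product-of-conjugates D′ P≈xy ⟩
        ϑ (square D′) (- nome D′) (- nome D′) * ϑ (square D′) (- (x * x)) (- (y * y))
          ≈⟨ *-cong (ϑ-cong {D²} {square D′} same-square refl refl) (ϑ-cong {D²} {square D′} same-square refl refl) ⟨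
        ϑ D² (- nome D′) (- nome D′) * ϑ D² (- (x * x)) (- (y * y)) ∎
        where
        same-fourth : nome (square (square D′)) ≈ nome D⁴
        same-fourth = sym (*-cong same-square same-square)
        A≈ : ϑ (square (square D′)) (x * x * nome D′) (y * y * nome D′) ≈ den * e₄
        A≈ = trans (ϑ-cong {square (square D′)} {D⁴} same-fourth arg₁ arg₂) ϑ-den
        B≈ : ϑ (square (square D′)) (- (p * (b * b))) (x * x * nome D′ * nome D′ * nome D′) ≈ num * e₄
        B≈ = trans (ϑ-cong {square (square D′)} {D⁴} same-fourth refl arg₃) ϑ-num

    -- The pair x = s, y = -p/s has product -p, so the difference is obtained over the nome -p,
    -- whose square is again p². The pair with √-1 has product p and stays over `D`.
    negated : Disc
    negated = record { nome = - p ; radius = radius D ; nome≼ = ≼-neg (nome≼ D) }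

    opaque
      numerator-difference : e₄ * e₄ * (den * den - s * s * (num * num)) ≈ ϑ D² p p * ϑ D² (- (s * s))
        (- (p * p * (b * b)))
      numerator-difference = trans
        (numerator negated {s} { - (p * b) } (sym (-‿* p p))
          (sym (trans (solve 3 (λ s p b → s :* :- (p :* b) := :- p :* (s :* b)) refl s p b)
            (trans (*-congˡ sb≈1) (*-identityʳ _))))
          (trans (solve 3 (λ s p b → s :* :- (p :* (b :* b)) := :- (p :* b) :* (s :* b)) refl s p b)
            (trans (*-congˡ sb≈1) (*-identityʳ _)))
          (solve 2 (λ s p → s :* s :* :- p := :- (p :* (s :* s))) refl s p)
          (solve 2 (λ b p → :- (p :* b) :* :- (p :* b) :* :- p := :- (p :* p :* p :* (b :* b))) refl b p)
          (solve 2 (λ s p → s :* s :* :- p :* :- p :* :- p := :- (p :* p :* p :* (s :* s))) refl s p))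
        (*-cong (ϑ-cong {D²} {D²} refl (neg-neg p) (neg-neg p))
          (ϑ-cong {D²} {D²} refl refl
            (-‿cong (solve 2 (λ b p → :- (p :* b) :* :- (p :* b) := p :* p :* (b :* b)) refl b p))))

      numerator-sum : ∀ {i} → i * i ≈ - 1# →
        e₄ * e₄ * (den * den + s * s * (num * num)) ≈ ϑ D² (- p) (- p) * ϑ D² (s * s) (p * p * (b * b))
      numerator-sum {i} i²≈-1 = trans
        (*-congˡ (+-congˡ (sym (trans (-‿cong (*-congʳ is²))
          (solve 2 (λ s n → :- (:- s :* n) := s :* n) refl (s * s) (num * num))))))
        (trans (numerator D {i * s} { - (i * (p * b)) } refl
          (sym (trans (solve 4 (λ i s p b → i :* s :* :- (i :* (p :* b)) := :- (i :* i) :* p :*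
            (s :* b)) refl i s p b)
            (trans (*-cong (*-congʳ (-‿cong i²≈-1)) sb≈1) (solve 1 (λ p → :- :- :1 :* p :* :1 := p) refl p))))
          (trans (solve 4 (λ i s p b → i :* s :* :- (p :* (b :* b)) := :- (i :* (p :* b)) :*
            (s :* b)) refl i s p b) (trans (*-congˡ sb≈1) (*-identityʳ _)))
          (trans (*-congʳ is²) (solve 2 (λ s p → :- (s :* s) :* p := :- (p :* (s :* s))) refl s p))
          (trans (*-congʳ ipb²) (solve 2
            (λ b p → :- (p :* p :* (b :* b)) :* p := :- (p :* p :* p :* (b :* b))) refl b p))
          (trans (*-congʳ (*-congʳ (*-congʳ is²)))
            (solve 2 (λ s p → :- (s :* s) :* p :* p :* p := :- (p :* p :* p :* (s :* s))) refl s p)))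
        (*-congˡ (ϑ-cong {D²} {D²} refl (trans (-‿cong is²) (neg-neg (s * s)))
          (trans (-‿cong ipb²) (neg-neg (p * p * (b * b)))))))
        where
        is² : i * s * (i * s) ≈ - (s * s)
        is² = trans (solve 2 (λ i s → i :* s :* (i :* s) := i :* i :* (s :* s)) refl i s)
          (trans (*-congʳ i²≈-1) (solve 1 (λ s → :- :1 :* s := :- s) refl (s * s)))
        ipb² : - (i * (p * b)) * - (i * (p * b)) ≈ - (p * p * (b * b))
        ipb² = trans (solve 3 (λ i p b → :- (i :* (p :* b)) :* :- (i :* (p :* b)) := i :* i :*
          (p :* p :* (b :* b))) refl i p b)
          (trans (*-congʳ i²≈-1) (solve 1 (λ s → :- :1 :* s := :- s) refl (p * p * (b * b))))

    opaque
      e₄-invertible : Invertible e₄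
      e₄-invertible = E-invertible D⁴

      s-invertible : Invertible s
      s-invertible = b , sb≈1

      -- By `ψ-ϑ₀` the common denominator is s e₄² num den. This is why nonvanishing of the two
      -- assumed products is enough for the right-hand sides to have values.
      denominator-invertible : Invertible num → Invertible den → Invertible (s * ψ * ϑ₀)
      denominator-invertible num-inv den-inv = invertible-≈ (trans (*-congˡ (sym ψ-ϑ₀)) (sym (*-assoc s ψ ϑ₀)))
        (invertible-* s-invertible
          (invertible-* (invertible-* e₄-invertible e₄-invertible) (invertible-* num-inv den-inv)))

    module _ {den⁻¹ S⁻¹ w⁻¹ : Carrier} (den-inverse : den * den⁻¹ ≈ 1#) (S-inverse : s * (num * den⁻¹) * S⁻¹ ≈ 1#)
             (w-inverse : s * ψ * ϑ₀ * w⁻¹ ≈ 1#) where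
      private
        S w : Carrier
        S = s * (num * den⁻¹)
        w = s * ψ * ϑ₀

      opaque
        -- With w = s e₄² num den and S = s num / den, dividing w by S leaves e₄² den², and in
        -- `scaled-quotient` multiplying leaves e₄² s² num². Both numerators can thus be compared
        -- over w.
        scaled-reciprocal : w * S⁻¹ ≈ e₄ * e₄ * (den * den)
        scaled-reciprocal = begin
          s * ψ * ϑ₀ * S⁻¹                                  ≈⟨ solve 4
            (λ s ψ t v → s :* ψ :* t :* v := s :* (ψ :* t) :* v) refl s ψ ϑ₀ S⁻¹ ⟩
          s * (ψ * ϑ₀) * S⁻¹                                ≈⟨ *-congʳ (*-congˡ ψ-ϑ₀) ⟩
          s * (e₄ * e₄ * (num * den)) * S⁻¹                 ≈⟨ solve 5
            (λ s e n d v → s :* (e :* (n :* d)) :* v := e :* d :* (s :* n :* v)) refl s (e₄ * e₄) num den S⁻¹ ⟩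
          e₄ * e₄ * den * (s * num * S⁻¹)                   ≈⟨ *-congˡ snS⁻¹ ⟩
          e₄ * e₄ * den * den                               ≈⟨ *-assoc _ _ _ ⟩
          e₄ * e₄ * (den * den)                             ∎
          where
          snS⁻¹ : s * num * S⁻¹ ≈ den
          snS⁻¹ = begin
            s * num * S⁻¹                      ≈⟨ *-identityʳ _ ⟨
            s * num * S⁻¹ * 1#                 ≈⟨ *-congˡ den-inverse ⟨
            s * num * S⁻¹ * (den * den⁻¹)      ≈⟨ solve 5
              (λ s n v d d′ → s :* n :* v :* (d :* d′) := d :* (s :* (n :* d′) :* v)) refl s num S⁻¹ den den⁻¹ ⟩
            den * (s * (num * den⁻¹) * S⁻¹)    ≈⟨ *-congˡ S-inverse ⟩
            den * 1#                           ≈⟨ *-identityʳ den ⟩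
            den                                ∎

        scaled-quotient : w * S ≈ e₄ * e₄ * (s * s * (num * num))
        scaled-quotient = begin
          s * ψ * ϑ₀ * (s * (num * den⁻¹))                  ≈⟨ solve 4
            (λ s ψ t v → s :* ψ :* t :* v := s :* (ψ :* t) :* v) refl s ψ ϑ₀ S ⟩
          s * (ψ * ϑ₀) * (s * (num * den⁻¹))                ≈⟨ *-congʳ (*-congˡ ψ-ϑ₀) ⟩
          s * (e₄ * e₄ * (num * den)) * (s * (num * den⁻¹)) ≈⟨ solve 5
            (λ s e n d d′ → s :* (e :* (n :* d)) :* (s :* (n :* d′)) := e :* (s :* s :* (n :* n)) :*
              (d :* d′)) refl s (e₄ * e₄) num den den⁻¹ ⟩
          e₄ * e₄ * (s * s * (num * num)) * (den * den⁻¹)   ≈⟨ *-congˡ den-inverse ⟩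
          e₄ * e₄ * (s * s * (num * num)) * 1#              ≈⟨ *-identityʳ _ ⟩
          e₄ * e₄ * (s * s * (num * num))                   ∎

        divide : ∀ {u v} → w * u ≈ v → u ≈ v * w⁻¹
        divide {u} {v} wu≈v = cancel (w⁻¹ , w-inverse) (begin
          w * u          ≈⟨ wu≈v ⟩
          v              ≈⟨ *-identityʳ v ⟨
          v * 1#         ≈⟨ *-congˡ w-inverse ⟨
          v * (w * w⁻¹)  ≈⟨ solve 3 (λ v w w′ → v :* (w :* w′) := w :* (v :* w′)) refl v w w⁻¹ ⟩
          w * (v * w⁻¹)  ∎)

        reciprocal-difference : S⁻¹ - S ≈ ϑ D² p p * ϑ D² (- (s * s)) (- (p * p * (b * b))) * w⁻¹
        reciprocal-difference = divide (begin
          w * (S⁻¹ - S)        ≈⟨ solve 3 (λ w u v → w :* (u :- v) := w :* u :- w :* v) refl w S⁻¹ S ⟩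
          w * S⁻¹ - w * S      ≈⟨ +-cong scaled-reciprocal (-‿cong scaled-quotient) ⟩
          e₄ * e₄ * (den * den) - e₄ * e₄ * (s * s * (num * num))
                               ≈⟨ solve 3 (λ e u v → e :* u :- e :* v := e :* (u :- v)) refl (e₄ * e₄) (den * den)
                                 (s * s * (num * num)) ⟩
          e₄ * e₄ * (den * den - s * s * (num * num)) ≈⟨ numerator-difference ⟩
          ϑ D² p p * ϑ D² (- (s * s)) (- (p * p * (b * b))) ∎)

        reciprocal-sum : ∀ {i} → i * i ≈ - 1# → S⁻¹ + S ≈ ϑ D² (- p) (- p) * ϑ D² (s * s) (p * p * (b * b)) * w⁻¹
        reciprocal-sum i²≈-1 = divide (begin
          w * (S⁻¹ + S)        ≈⟨ distribˡ w S⁻¹ S ⟩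
          w * S⁻¹ + w * S      ≈⟨ +-cong scaled-reciprocal scaled-quotient ⟩
          e₄ * e₄ * (den * den) + e₄ * e₄ * (s * s * (num * num))
                               ≈⟨ distribˡ (e₄ * e₄) _ _ ⟨
          e₄ * e₄ * (den * den + s * s * (num * num)) ≈⟨ numerator-sum i²≈-1 ⟩
          ϑ D² (- p) (- p) * ϑ D² (s * s) (p * p * (b * b)) ∎)

-- Integer powers of a unit and triangular exponents

module IntegerPowers (R : CommutativeRing 0ℓ 0ℓ) where
  open CommutativeRing R
  open import Algebra.Properties.Semiring.Exp semiring using (_^_; ^-homo-*)
  open import Relation.Binary.Reasoning.Setoid setoid
  open IntegerRingSolver R
  open PolynomialSyntax

  power : Carrier → Carrier → ℤ → Carrier
  power u v (+ n)    = u ^ n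
  power u v -[1+ n ] = v ^ suc n

  module _ {u v : Carrier} (uv≈1 : u * v ≈ 1#) where
    opaque
      power-⊖ : ∀ m n → power u v (m ℤ.⊖ n) ≈ u ^ m * v ^ n
      power-⊖ m       zero    = sym (*-identityʳ _)
      power-⊖ zero    (suc n) = sym (*-identityˡ _)
      power-⊖ (suc m) (suc n) = begin
        power u v (suc m ℤ.⊖ suc n)      ≡⟨ ≡.cong (power u v) (ℤₚ.[1+m]⊖[1+n]≡m⊖n m n) ⟩
        power u v (m ℤ.⊖ n)              ≈⟨ power-⊖ m n ⟩
        u ^ m * v ^ n                  ≈⟨ *-identityˡ _ ⟨
        1# * (u ^ m * v ^ n)           ≈⟨ *-congʳ uv≈1 ⟨
        u * v * (u ^ m * v ^ n)        ≈⟨ solve 4 (λ u v x y → u :* v :* (x :* y) := u :* x :* (v :* y)) refl u v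
          (u ^ m) (v ^ n) ⟩
        u * u ^ m * (v * v ^ n)        ∎

      power-+ : ∀ i j → power u v (i ℤ.+ j) ≈ power u v i * power u v j
      power-+ (+ m)    (+ n)    = ^-homo-* u m n
      power-+ (+ m)    -[1+ n ] = power-⊖ m (suc n)
      power-+ -[1+ m ] (+ n)    = trans (power-⊖ n (suc m)) (*-comm _ _)
      power-+ -[1+ m ] -[1+ n ] = trans (reflexive (≡.cong (λ l → v ^ suc l) (≡.sym (ℕₚ.+-suc m n))))
        (^-homo-* v (suc m) (suc n))

-- n(n-1)/2 rather than n(n+1)/2, given by recursion to avoid the division.
triangle : ℕ → ℕ
triangle zero    = 0
triangle (suc n) = triangle n ℕ.+ n

opaque
  triangle*2 : ∀ n → suc n ℕ.* n ≡ triangle (suc n) ℕ.* 2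
  triangle*2 zero    = ≡.refl
  triangle*2 (suc n) = ≡.trans (step n)
    (≡.trans (≡.cong (ℕ._+ suc n ℕ.* 2) (triangle*2 n)) (≡.sym (ℕₚ.*-distribʳ-+ 2 (triangle (suc n)) (suc n))))
    where
    step : ∀ n → suc (suc n) ℕ.* suc n ≡ suc n ℕ.* n ℕ.+ suc n ℕ.* 2
    step = ℕ.solve-∀

  half-product : ∀ {a b} n → a ≡ suc n → b ≡ n → (a ℕ.* b) ℕ./ 2 ≡ triangle (suc n)
  half-product n ≡.refl ≡.refl = ≡.trans (≡.cong (ℕ._/ 2) (triangle*2 n)) (ℕ.m*n/n≡m (triangle (suc n)) 2)

  tri-product : ∀ i j {a b} n → ℤ.∣ i ∣ ≡ a → ℤ.∣ j ∣ ≡ b → a ≡ suc n → b ≡ n → ℤ.∣ i ℤ.* j ∣ ℕ./ 2 ≡ triangle (suc n)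
  tri-product i j n ≡.refl ≡.refl p q = ≡.trans (≡.cong (ℕ._/ 2) (ℤₚ.abs-* i j)) (half-product n p q)

  tri⁺-pos : ∀ n → tri⁺ (+ n) ≡ triangle (suc n)
  tri⁺-pos n = ≡.trans (≡.cong (λ i → ℤ.∣ i ∣ ℕ./ 2) (ℤₚ.*-comm (+ n) (+ n ℤ.+ + 1)))
    (tri-product (+ n ℤ.+ + 1) (+ n) n ≡.refl ≡.refl (ℕₚ.+-comm n 1) ≡.refl)

  tri⁻-pos : ∀ n → tri⁻ (+ n) ≡ triangle n
  tri⁻-pos zero    = ≡.refl
  tri⁻-pos (suc n) = tri-product (+ suc n) (+ n) n ≡.refl ≡.refl ≡.refl ≡.refl

  tri⁺-neg : ∀ n → tri⁺ -[1+ n ] ≡ triangle (suc n)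
  tri⁺-neg n = tri-product -[1+ n ] (-[1+ n ] ℤ.+ + 1) n ≡.refl (∣1⊖1+n∣ n) ≡.refl ≡.refl
    where
    ∣1⊖1+n∣ : ∀ n → ℤ.∣ 1 ℤ.⊖ suc n ∣ ≡ n
    ∣1⊖1+n∣ zero    = ≡.refl
    ∣1⊖1+n∣ (suc n) = ≡.refl

  tri⁻-neg : ∀ n → tri⁻ -[1+ n ] ≡ triangle (suc (suc n))
  tri⁻-neg n = ≡.trans (≡.cong (λ i → ℤ.∣ i ∣ ℕ./ 2) (ℤₚ.*-comm -[1+ n ] (-[1+ n ] ℤ.- + 1)))
    (tri-product (-[1+ n ] ℤ.- + 1) -[1+ n ] (suc n) ≡.refl ≡.refl
      (≡.cong (λ l → suc (suc l)) (ℕₚ.+-identityʳ n)) ≡.refl)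

-- Theta functions and q-products at powers of the fourth root of q

module Evaluation {F : ArchimedeanField} (𝔸 : CompleteNormedRing F) where
  open ThetaIdentities 𝔸 public
  open IntegerPowers commutativeRing public
  open import Relation.Binary.Reasoning.Setoid setoid
  open import Algebra.Properties.Semiring.Exp semiring using (^-homo-*; ^-congˡ)
  open import Algebra.Properties.CommutativeSemiring.Exp commutativeSemiring using (^-distrib-*)

  opaque
    Theta : Carrier → Carrier → Carrier → Set
    Theta a b = BilateralSeries (λ k → a ^ tri⁺ k * b ^ tri⁻ k)

    Pochhammer : Carrier → Carrier → Carrier → Set
    Pochhammer a q = Product (λ n → 1# - a * q ^ n)

  opaque
    unfolding Theta Pochhammer

    monomial-closed : ∀ D {x y} → nome D ≈ x * y → ∀ n → x ^ triangle (suc n) * y ^ triangle n ≈ monomial D x n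
    monomial-closed D {x} {y} P≈xy zero    = *-identityˡ 1#
    monomial-closed D {x} {y} P≈xy (suc n) = begin
      x ^ (triangle (suc n) ℕ.+ suc n) * y ^ (triangle n ℕ.+ n)
        ≈⟨ *-cong (^-homo-* x (triangle (suc n)) (suc n)) (^-homo-* y (triangle n) n) ⟩
      x ^ triangle (suc n) * (x * x ^ n) * (y ^ triangle n * y ^ n)
        ≈⟨ solve 5 (λ a x b c d → a :* (x :* b) :* (c :* d) := a :* c :* (x :* (b :* d))) refl
          (x ^ triangle (suc n)) x (x ^ n) (y ^ triangle n) (y ^ n) ⟩
      x ^ triangle (suc n) * y ^ triangle n * (x * (x ^ n * y ^ n))
        ≈⟨ *-cong (monomial-closed D P≈xy n) (*-congˡ (trans (sym (^-distrib-* x y n)) (^-congˡ n (sym P≈xy)))) ⟩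
      monomial D x n * (x * nome D ^ n) ∎

    pochhammer-product : ∀ D {a x q} → a ≈ x → q ≈ nome D → Pochhammer a q (E D x)
    pochhammer-product D {a} {x} a≈x q≈P = limit-cong
      (∏-cong λ n → +-congˡ (-‿cong (*-cong (sym a≈x) (^-congˡ n (sym q≈P))))) refl (E-product D x)

    theta-series : ∀ D {a b x y} → a ≈ x → b ≈ y → nome D ≈ x * y → Theta a b (ϑ D x y)
    theta-series D {a} {b} {x} {y} a≈x b≈y P≈xy = bilateral-cong termwise refl (TripleProduct.ϑ-series D x y)
      where
      powers : ∀ {i j i′ j′} → i ≡ i′ → j ≡ j′ → a ^ i * b ^ j ≈ x ^ i′ * y ^ j′
      powers {i} {j} ≡.refl ≡.refl = *-cong (^-congˡ i a≈x) (^-congˡ j b≈y)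
      termwise : ∀ k → FiniteTripleProduct.t D x y k ≈ a ^ tri⁺ k * b ^ tri⁻ k
      termwise (+ n)    = sym (trans (powers (tri⁺-pos n) (tri⁻-pos n)) (monomial-closed D P≈xy n))
      termwise -[1+ n ] = sym (trans (powers (tri⁺-neg n) (tri⁻-neg n))
        (trans (*-comm _ _) (monomial-closed D (trans P≈xy (*-comm x y)) (suc n))))

  -- Powers, sums and products of the definitions agree with those used here only up to a proof.
  module Transport (_^′_ : Carrier → ℕ → Carrier) (^′-zero : ∀ x → x ^′ 0 ≡ 1#)
    (^′-suc : ∀ x n → x ^′ suc n ≡ x * (x ^′ n)) where
    opaque
      unfolding Theta Pochhammer

      ^′≡^ : ∀ x n → x ^′ n ≡ x ^ n
      ^′≡^ x zero    = ^′-zero x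
      ^′≡^ x (suc n) = ≡.trans (^′-suc x n) (≡.cong (x *_) (^′≡^ x n))

      power′ : ∀ u v (f : ℤ → Carrier) → (∀ n → f (+ n) ≡ u ^′ n) → (∀ n → f -[1+ n ] ≡ v ^′ suc n) → ∀ r →
        power u v r ≡ f r
      power′ u v f f-pos f-neg (+ n)    = ≡.sym (≡.trans (f-pos n) (^′≡^ u n))
      power′ u v f f-pos f-neg -[1+ n ] = ≡.sym (≡.trans (f-neg n) (^′≡^ v (suc n)))

      ∏-unique : ∀ {u} (f : ℕ → Carrier) → f 0 ≈ 1# → (∀ n → f (suc n) ≈ f n * u n) → ∀ n → f n ≈ ∏ u n
      ∏-unique {u} f f0 f-suc zero    = f0
      ∏-unique {u} f f0 f-suc (suc n) = trans (f-suc n) (*-congʳ (∏-unique f f0 f-suc n))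

      ∑-unique : ∀ {u} (f : ℕ → Carrier) → f 0 ≈ 0# → (∀ n → f (suc n) ≈ f n + u n) → ∀ n → f n ≈ ∑ u n
      ∑-unique {u} f f0 f-suc zero    = f0
      ∑-unique {u} f f0 f-suc (suc n) = trans (f-suc n) (+-congʳ (∑-unique f f0 f-suc n))

      pochhammer-close : ∀ {a q L} (f : ℕ → Carrier) → f 0 ≈ 1# → (∀ n → f (suc n) ≈ f n * (1# - a * (q ^′ n))) →
        Pochhammer a q L → ∀ ε → Positive ε → ∃[ N ] (∀ n → N ℕ.≤ n → f n - L ≼ ε)
      pochhammer-close {a} {q} {L} f f0 f-suc ∏→L ε 0<ε =
        let N , near = close ∏→L ε 0<ε
        in N , λ n N≤n → ≼-resp-≈ (+-congʳ (sym (∏-unique f f0 step n))) (near n N≤n)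
        where
        step : ∀ n → f (suc n) ≈ f n * (1# - a * q ^ n)
        step n = trans (f-suc n) (*-congˡ (+-congˡ (-‿cong (*-congˡ (reflexive (^′≡^ q n))))))

      theta-close : ∀ {a b L} (f g : ℕ → Carrier) → f 0 ≈ 0# → g 0 ≈ 0# →
        (∀ n → f (suc n) ≈ f n + (a ^′ tri⁺ (+ n)) * (b ^′ tri⁻ (+ n))) →
        (∀ n → g (suc n) ≈ g n + (a ^′ tri⁺ -[1+ n ]) * (b ^′ tri⁻ -[1+ n ])) →
        Theta a b L → ∀ ε → Positive ε → ∃[ N ] (∀ m n → N ℕ.≤ m → N ℕ.≤ n → f n + g m - L ≼ ε)
      theta-close {a} {b} {L} f g f0 g0 f-suc g-suc S ε 0<ε =
        let δ , 0<δ , 2δ≡ε = half 0<ε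
            M , right-near = close (right-series S) δ 0<δ
            N , left-near = close (left-series S) δ 0<δ
        in M ℕ.⊔ N , λ m n p q → ≼-≡ 2δ≡ε (≼-resp-≈ (regroup m n)
             (≼-+ (right-near n (ℕₚ.≤-trans (ℕₚ.m≤m⊔n M N) q)) (left-near m (ℕₚ.≤-trans (ℕₚ.m≤n⊔m M N) p))))
        where
        open BilateralSeries
        u : ℤ → Carrier
        u k = a ^ tri⁺ k * b ^ tri⁻ k
        powers : ∀ k → (a ^′ tri⁺ k) * (b ^′ tri⁻ k) ≈ u k
        powers k = reflexive (≡.cong₂ _*_ (^′≡^ a (tri⁺ k)) (^′≡^ b (tri⁻ k)))
        f≈ : ∀ n → f n ≈ ∑ (λ j → u (+ j)) n
        f≈ = ∑-unique f f0 λ n → trans (f-suc n) (+-congˡ (powers (+ n)))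
        g≈ : ∀ n → g n ≈ ∑ (λ j → u -[1+ j ]) n
        g≈ = ∑-unique g g0 λ n → trans (g-suc n) (+-congˡ (powers -[1+ n ]))
        regroup : ∀ m n → ∑ (λ j → u (+ j)) n - right S + (∑ (λ j → u -[1+ j ]) m - left S) ≈ f n + g m - L
        regroup m n = trans (solve 4 (λ a b x y → (a :- x) :+ (b :- y) := a :+ b :- (x :+ y)) refl _ _ (right S)
          (left S))
          (+-cong (+-cong (sym (f≈ n)) (sym (g≈ m))) (-‿cong (sym (total S))))

  module Powers {u v : Carrier} (uv≈1 : u * v ≈ 1#) {ρ : Contraction} (u≼ρ : u ≼ ratio ρ)
    (Q : ℤ → Carrier) (Q≡ : ∀ r → power u v r ≡ Q r) (k m : ℕ) (0<k : 0 ℕ.< k) where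

    -- For i = m/2 these are 2i-1, 4i-2 and k. Since `Q r` is q^(r/4), an exponent e of q appears as
    -- 4e, and q^(k/4) is `Q Kᶻ`.
    c d Kᶻ : ℤ
    c = + m ℤ.- + 1
    d = + 2 ℤ.* + m ℤ.- + 2
    Kᶻ = + k

    opaque
      -- A positive power of u is no larger than u, so the contraction found for the fourth root of
      -- q serves for the nome q^(k/4).
      ^≼ratio : ∀ {k} → 0 ℕ.< k → u ^ k ≼ ratio ρ
      ^≼ratio {suc k} _ = ≼-mono (≼-^ u≼ρ (suc k))
        (≤-trans (*-monoʳ-≤ (nonneg ρ) (^≤1 ρ k)) (≤-reflexive (*ᵏ-identityʳ (ratio ρ))))

      nome≼ratio : Q Kᶻ ≼ ratio ρ
      nome≼ratio = ≼-resp-≈ (reflexive (Q≡ Kᶻ)) (^≼ratio 0<k)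

      Q-homo : ∀ i j → Q (i ℤ.+ j) ≈ Q i * Q j
      Q-homo i j = trans (reflexive (≡.sym (Q≡ (i ℤ.+ j))))
        (trans (power-+ uv≈1 i j) (*-cong (reflexive (Q≡ i)) (reflexive (Q≡ j))))

    D : Disc
    D = record { nome = Q Kᶻ ; radius = ρ ; nome≼ = nome≼ratio }

    s b : Carrier
    s = Q (+ 4 ℤ.* c)
    b = Q (ℤ.- (+ 4 ℤ.* c))

    opaque
      sb≈1 : s * b ≈ 1#
      sb≈1 = trans (sym (Q-homo (+ 4 ℤ.* c) (ℤ.- (+ 4 ℤ.* c))))
        (reflexive (≡.trans (≡.cong Q (ℤₚ.+-inverseʳ (+ 4 ℤ.* c))) (≡.sym (Q≡ (+ 0)))))

    open Quotient D sb≈1 public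

    opaque
      Q-+ : ∀ {l} i j {x y} → l ≡ i ℤ.+ j → Q i ≈ x → Q j ≈ y → Q l ≈ x * y
      Q-+ i j ≡.refl i≈x j≈y = trans (Q-homo i j) (*-cong i≈x j≈y)

      Q-4d : Q (+ 4 ℤ.* d) ≈ s * s
      Q-4d = Q-+ (+ 4 ℤ.* c) (+ 4 ℤ.* c) (index (+ m)) refl refl
        where
        index : ∀ m → + 4 ℤ.* (+ 2 ℤ.* m ℤ.- + 2) ≡ + 4 ℤ.* (m ℤ.- + 1) ℤ.+ + 4 ℤ.* (m ℤ.- + 1)
        index = ℤ.solve-∀

      Q-neg4d : Q (ℤ.- (+ 4 ℤ.* d)) ≈ b * b
      Q-neg4d = Q-+ (ℤ.- (+ 4 ℤ.* c)) (ℤ.- (+ 4 ℤ.* c)) (index (+ m)) refl refl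
        where
        index : ∀ m → ℤ.- (+ 4 ℤ.* (+ 2 ℤ.* m ℤ.- + 2)) ≡ ℤ.- (+ 4 ℤ.* (m ℤ.- + 1)) ℤ.+ ℤ.- (+ 4 ℤ.* (m ℤ.- + 1))
        index = ℤ.solve-∀

      Q-2K : Q (+ 2 ℤ.* Kᶻ) ≈ p * p
      Q-2K = Q-+ Kᶻ Kᶻ (index Kᶻ) refl refl
        where
        index : ∀ Kᶻ → + 2 ℤ.* Kᶻ ≡ Kᶻ ℤ.+ Kᶻ
        index = ℤ.solve-∀

      Q-3K : Q (+ 3 ℤ.* Kᶻ) ≈ p * p * p
      Q-3K = Q-+ (+ 2 ℤ.* Kᶻ) Kᶻ (index Kᶻ) Q-2K refl
        where
        index : ∀ Kᶻ → + 3 ℤ.* Kᶻ ≡ + 2 ℤ.* Kᶻ ℤ.+ Kᶻ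
        index = ℤ.solve-∀

      Q-4K : Q (+ 4 ℤ.* Kᶻ) ≈ p * p * (p * p)
      Q-4K = Q-+ (+ 2 ℤ.* Kᶻ) (+ 2 ℤ.* Kᶻ) (index Kᶻ) Q-2K Q-2K
        where
        index : ∀ Kᶻ → + 4 ℤ.* Kᶻ ≡ + 2 ℤ.* Kᶻ ℤ.+ + 2 ℤ.* Kᶻ
        index = ℤ.solve-∀

      Q-K-4d : Q (Kᶻ ℤ.- + 4 ℤ.* d) ≈ p * (b * b)
      Q-K-4d = Q-+ Kᶻ (ℤ.- (+ 4 ℤ.* d)) ≡.refl refl Q-neg4d

      Q-K+4d : Q (Kᶻ ℤ.+ + 4 ℤ.* d) ≈ p * (s * s)
      Q-K+4d = Q-+ Kᶻ (+ 4 ℤ.* d) ≡.refl refl Q-4d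

      Q-3K-4d : Q (+ 3 ℤ.* Kᶻ ℤ.- + 4 ℤ.* d) ≈ p * p * p * (b * b)
      Q-3K-4d = Q-+ (+ 3 ℤ.* Kᶻ) (ℤ.- (+ 4 ℤ.* d)) ≡.refl Q-3K Q-neg4d

      Q-3K+4d : Q (+ 3 ℤ.* Kᶻ ℤ.+ + 4 ℤ.* d) ≈ p * p * p * (s * s)
      Q-3K+4d = Q-+ (+ 3 ℤ.* Kᶻ) (+ 4 ℤ.* d) ≡.refl Q-3K Q-4d

      Q-2K-4d : Q (+ 2 ℤ.* Kᶻ ℤ.- + 4 ℤ.* d) ≈ p * p * (b * b)
      Q-2K-4d = Q-+ (+ 2 ℤ.* Kᶻ) (ℤ.- (+ 4 ℤ.* d)) ≡.refl Q-2K Q-neg4d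

      s²b²-cancel : ∀ x → x * (s * s * (b * b)) ≈ x
      s²b²-cancel x = trans (*-congˡ s²b²≈1) (*-identityʳ x)

    opaque
      num₁ : Pochhammer (Q (Kᶻ ℤ.- + 4 ℤ.* d)) (Q (+ 4 ℤ.* Kᶻ)) (E D⁴ (p * (b * b)))
      num₁ = pochhammer-product D⁴ Q-K-4d Q-4K

      num₂ : Pochhammer (Q (+ 3 ℤ.* Kᶻ ℤ.+ + 4 ℤ.* d)) (Q (+ 4 ℤ.* Kᶻ)) (E D⁴ (p * p * p * (s * s)))
      num₂ = pochhammer-product D⁴ Q-3K+4d Q-4K

      den₁ : Pochhammer (Q (Kᶻ ℤ.+ + 4 ℤ.* d)) (Q (+ 4 ℤ.* Kᶻ)) (E D⁴ (p * (s * s)))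
      den₁ = pochhammer-product D⁴ Q-K+4d Q-4K

      den₂ : Pochhammer (Q (+ 3 ℤ.* Kᶻ ℤ.- + 4 ℤ.* d)) (Q (+ 4 ℤ.* Kᶻ)) (E D⁴ (p * p * p * (b * b)))
      den₂ = pochhammer-product D⁴ Q-3K-4d Q-4K

      θ-num : Theta (- Q (Kᶻ ℤ.- + 4 ℤ.* d)) (- Q (+ 3 ℤ.* Kᶻ ℤ.+ + 4 ℤ.* d))
        (ϑ D⁴ (- (p * (b * b))) (- (p * p * p * (s * s))))
      θ-num = theta-series D⁴ (-‿cong Q-K-4d) (-‿cong Q-3K+4d) (sym (trans
        (solve 3 (λ p s b → :- (p :* b) :* :- (p :* p :* p :* s) := p :* p :* (p :* p) :* (s :* b)) refl p (s * s)
          (b * b)) (s²b²-cancel _)))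

      θ-den : Theta (- Q (Kᶻ ℤ.+ + 4 ℤ.* d)) (- Q (+ 3 ℤ.* Kᶻ ℤ.- + 4 ℤ.* d))
        (ϑ D⁴ (- (p * (s * s))) (- (p * p * p * (b * b))))
      θ-den = theta-series D⁴ (-‿cong Q-K+4d) (-‿cong Q-3K-4d) (sym (trans
        (solve 3 (λ p s b → :- (p :* s) :* :- (p :* p :* p :* b) := p :* p :* (p :* p) :* (s :* b)) refl p (s * s)
          (b * b)) (s²b²-cancel _)))

      θ-ϑ₀ : Theta (- Q (Kᶻ ℤ.- + 4 ℤ.* d)) (- Q (Kᶻ ℤ.+ + 4 ℤ.* d)) ϑ₀
      θ-ϑ₀ = theta-series D² (-‿cong Q-K-4d) (-‿cong Q-K+4d) (sym (trans
        (solve 3 (λ p s b → :- (p :* b) :* :- (p :* s) := p :* p :* (s :* b)) refl p (s * s) (b * b))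
          (s²b²-cancel _)))

      φ₊ : Theta (Q Kᶻ) (Q Kᶻ) (ϑ D² p p)
      φ₊ = theta-series D² refl refl refl

      φ₋ : Theta (- Q Kᶻ) (- Q Kᶻ) (ϑ D² (- p) (- p))
      φ₋ = theta-series D² refl refl (sym (-‿* p p))

      ψ₂ : Theta (Q (+ 2 ℤ.* Kᶻ)) (Q (+ 2 ℤ.* Kᶻ) ^ 3) ψ
      ψ₂ = theta-series (square D⁴) Q-2K
        (trans (^-congˡ 3 Q-2K) (solve 1 (λ r → r :* (r :* (r :* :1)) := r :* r :* r) refl (p * p)))
        (solve 1 (λ r → r :* r :* (r :* r) := r :* (r :* r :* r)) refl (p * p))

      θ₋ : Theta (- Q (+ 4 ℤ.* d)) (- Q (+ 2 ℤ.* Kᶻ ℤ.- + 4 ℤ.* d)) (ϑ D² (- (s * s)) (- (p * p * (b * b))))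
      θ₋ = theta-series D² (-‿cong Q-4d) (-‿cong Q-2K-4d) (sym (trans
        (solve 3 (λ p s b → :- s :* :- (p :* p :* b) := p :* p :* (s :* b)) refl p (s * s) (b * b)) (s²b²-cancel _)))

      θ₊ : Theta (Q (+ 4 ℤ.* d)) (Q (+ 2 ℤ.* Kᶻ ℤ.- + 4 ℤ.* d)) (ϑ D² (s * s) (p * p * (b * b)))
      θ₊ = theta-series D² Q-4d Q-2K-4d (sym (trans
        (solve 3 (λ p s b → s :* (p :* p :* b) := p :* p :* (s :* b)) refl p (s * s) (b * b)) (s²b²-cancel _)))

      -- By the triple product both theta functions carry the same extra factor `e₄`, which cancels
      -- in the quotient.
      cancelled-quotient : ∀ {den⁻¹ y⁻¹} → den * den⁻¹ ≈ 1# →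
        ϑ D⁴ (- (p * (s * s))) (- (p * p * p * (b * b))) * y⁻¹ ≈ 1# →
        s * (num * den⁻¹) ≈ s * (ϑ D⁴ (- (p * (b * b))) (- (p * p * p * (s * s))) * y⁻¹)
      cancelled-quotient {den⁻¹} {y⁻¹} den-inverse y-inverse = *-congˡ (begin
        num * den⁻¹                             ≈⟨ *-identityʳ _ ⟨
        num * den⁻¹ * 1#                        ≈⟨ *-congˡ (trans (*-congʳ (sym ϑ-den)) y-inverse) ⟨
        num * den⁻¹ * (den * e₄ * y⁻¹)          ≈⟨ solve 5
          (λ n d′ d e y → n :* d′ :* (d :* e :* y) := n :* e :* y :* (d :* d′)) refl num den⁻¹ den e₄ y⁻¹ ⟩
        num * e₄ * y⁻¹ * (den * den⁻¹)          ≈⟨ *-cong (*-congʳ (sym ϑ-num)) den-inverse ⟩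
        ϑ D⁴ (- (p * (b * b))) (- (p * p * p * (s * s))) * y⁻¹ * 1# ≈⟨ *-identityʳ _ ⟩
        ϑ D⁴ (- (p * (b * b))) (- (p * p * p * (s * s))) * y⁻¹ ∎)

      ϑ-den-invertible : Invertible den → Invertible (ϑ D⁴ (- (p * (s * s))) (- (p * p * p * (b * b))))
      ϑ-den-invertible den-inv = invertible-≈ (sym ϑ-den) (invertible-* den-inv e₄-invertible)

      S-invertible : ∀ {den⁻¹} → Invertible num → den * den⁻¹ ≈ 1# → Invertible (s * (num * den⁻¹))
      S-invertible {den⁻¹} num-inv den-inverse = invertible-* s-invertible
        (invertible-* num-inv (den , trans (*-comm den⁻¹ den) den-inverse))

  -- P/a, P³a, ... are independent variables because type checking the theorem over ℂ becomes intractable once their actual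
  -- values have to be compared.
  record ThetaQuotient (P P² P⁴ s a P/a Pa P³/a P³a P²/a : Carrier) : Set where
    no-eta-equality
    field
      n₁ n₂ d₁ d₂ N Δ φ₊ φ₋ ψ₂ ϑ₀ ϑ₊ ϑ₋ : Carrier
      n₁-value : Pochhammer P/a P⁴ n₁
      n₂-value : Pochhammer P³a P⁴ n₂
      d₁-value : Pochhammer Pa P⁴ d₁
      d₂-value : Pochhammer P³/a P⁴ d₂
      N-value  : Theta (- P/a) (- P³a) N
      Δ-value  : Theta (- Pa) (- P³/a) Δ
      φ₊-value : Theta P P φ₊
      φ₋-value : Theta (- P) (- P) φ₋
      ψ₂-value : Theta P² (P² ^ 3) ψ₂
      ϑ₀-value : Theta (- P/a) (- Pa) ϑ₀
      ϑ₊-value : Theta a P²/a ϑ₊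
      ϑ₋-value : Theta (- a) (- P²/a) ϑ₋
      Δ-invertible : Invertible (d₁ * d₂) → Invertible Δ
      w-invertible : Invertible (n₁ * n₂) → Invertible (d₁ * d₂) → Invertible (s * ψ₂ * ϑ₀)
      S-invertible : ∀ {den⁻¹} → Invertible (n₁ * n₂) → d₁ * d₂ * den⁻¹ ≈ 1# → Invertible (s * (n₁ * n₂ * den⁻¹))
      quotient     : ∀ {den⁻¹ Δ⁻¹} → d₁ * d₂ * den⁻¹ ≈ 1# → Δ * Δ⁻¹ ≈ 1# → s * (n₁ * n₂ * den⁻¹) ≈ s * (N * Δ⁻¹)
      difference   : ∀ {den⁻¹ S⁻¹ w⁻¹} → d₁ * d₂ * den⁻¹ ≈ 1# → s * (n₁ * n₂ * den⁻¹) * S⁻¹ ≈ 1# →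
        s * ψ₂ * ϑ₀ * w⁻¹ ≈ 1# →
        S⁻¹ - s * (n₁ * n₂ * den⁻¹) ≈ φ₊ * ϑ₋ * w⁻¹
      sum          : ∀ {i den⁻¹ S⁻¹ w⁻¹} → i * i ≈ - 1# → d₁ * d₂ * den⁻¹ ≈ 1# → s * (n₁ * n₂ * den⁻¹) * S⁻¹ ≈ 1# →
        s * ψ₂ * ϑ₀ * w⁻¹ ≈ 1# →
        S⁻¹ + s * (n₁ * n₂ * den⁻¹) ≈ φ₋ * ϑ₊ * w⁻¹

  opaque
    thetaQuotient : ∀ {u v} → u * v ≈ 1# → (ρ : Contraction) → u ≼ ratio ρ → (Q : ℤ → Carrier) →
      (∀ r → power u v r ≡ Q r) →
      ∀ k m → 0 ℕ.< k →
      let c = + m ℤ.- + 1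
          d = + 2 ℤ.* + m ℤ.- + 2
          Kᶻ = + k
      in ThetaQuotient (Q Kᶻ) (Q (+ 2 ℤ.* Kᶻ)) (Q (+ 4 ℤ.* Kᶻ)) (Q (+ 4 ℤ.* c)) (Q (+ 4 ℤ.* d))
           (Q (Kᶻ ℤ.- + 4 ℤ.* d)) (Q (Kᶻ ℤ.+ + 4 ℤ.* d)) (Q (+ 3 ℤ.* Kᶻ ℤ.- + 4 ℤ.* d)) (Q (+ 3 ℤ.* Kᶻ ℤ.+ + 4 ℤ.* d))
           (Q (+ 2 ℤ.* Kᶻ ℤ.- + 4 ℤ.* d))
    thetaQuotient uv≈1 ρ u≼ρ Q Q≡ k m 0<k = record
      { n₁-value = num₁ ; n₂-value = num₂ ; d₁-value = den₁ ; d₂-value = den₂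
      ; N-value = θ-num ; Δ-value = θ-den ; φ₊-value = φ₊ ; φ₋-value = φ₋ ; ψ₂-value = ψ₂ ; ϑ₀-value = θ-ϑ₀
      ; ϑ₊-value = θ₊ ; ϑ₋-value = θ₋
      ; Δ-invertible = ϑ-den-invertible
      ; w-invertible = denominator-invertible
      ; S-invertible = S-invertible
      ; quotient     = cancelled-quotient
      ; difference   = reciprocal-difference
      ; sum          = λ i²≈-1 den-inverse S-inverse w-inverse → reciprocal-sum den-inverse S-inverse w-inverse i²≈-1
      }
      where open Powers uv≈1 {ρ} u≼ρ Q Q≡ k m 0<k

-- The complex numbers as a complete normed ring

module ComplexNumbers where
  open import Data.Rational
  open import Data.Rational.Properties
  import Data.Rational.Unnormalised as ℚᵘ
  import Data.Rational.Unnormalised.Properties as ℚᵘₚ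
  open import Defs
  open ℝ
  open ℂ
  open import Relation.Binary.PropositionalEquality using (refl; sym; trans; cong; subst; subst₂)
  open import Tactic.RingSolver using (solve-∀)
  open import Algebra.Definitions.RawMonoid +-0-rawMonoid using () renaming (_×_ to _·_)

  opaque
    toℚᵘ-·1 : ∀ n → toℚᵘ (n · 1ℚ) ℚᵘ.≃ ℚᵘ.mkℚᵘ (+ n) 0
    toℚᵘ-·1 zero    = ℚᵘₚ.≃-refl
    toℚᵘ-·1 (suc n) = ℚᵘₚ.≃-trans (toℚᵘ-homo-+ 1ℚ (n · 1ℚ))
      (ℚᵘₚ.≃-trans (ℚᵘₚ.+-congʳ ℚᵘ.1ℚᵘ (toℚᵘ-·1 n))
        (ℚᵘ.*≡* (cong (λ i → (+ 1 ℤ.+ i) ℤ.* + 1) (ℤₚ.*-identityʳ (+ n)))))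

    -- The absolute value of the numerator suffices, the denominator being at least 1.
    ℚ-archimedean : ∀ a → ∃[ n ] a ≤ n · 1ℚ
    ℚ-archimedean a@record{} = ℤ.∣ ↥ a ∣ , toℚᵘ-cancel-≤
      (ℚᵘₚ.≤-respʳ-≃ (ℚᵘₚ.≃-sym (toℚᵘ-·1 ℤ.∣ ↥ a ∣)) (ℚᵘ.*≤* numerators))
      where
      i≤∣i∣ : ∀ i → i ℤ.≤ + ℤ.∣ i ∣
      i≤∣i∣ (+ n)    = ℤₚ.≤-refl
      i≤∣i∣ -[1+ n ] = ℤ.-≤+
      numerators : ↥ a ℤ.* + 1 ℤ.≤ + ℤ.∣ ↥ a ∣ ℤ.* ↧ a
      numerators = ℤₚ.≤-trans (ℤₚ.≤-reflexive (ℤₚ.*-identityʳ (↥ a)))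
        (ℤₚ.≤-trans (i≤∣i∣ (↥ a)) (subst (+ ℤ.∣ ↥ a ∣ ℤ.≤_) (ℤₚ.pos-* ℤ.∣ ↥ a ∣ (↧ₙ a))
          (ℤ.+≤+ (ℕₚ.m≤m*n ℤ.∣ ↥ a ∣ (↧ₙ a)))))

    0≤*₀ : ∀ {a b} → 0ℚ ≤ a → 0ℚ ≤ b → 0ℚ ≤ a * b
    0≤*₀ {a} {b} 0≤a 0≤b = subst (_≤ a * b) (*-zeroʳ a) (*-monoˡ-≤-nonNeg a {{nonNegative 0≤a}} 0≤b)

  ℚ-field : ArchimedeanField
  ℚ-field = record
    { Carrier = ℚ ; _+_ = _+_ ; _*_ = _*_ ; -_ = -_ ; 0# = 0ℚ ; 1# = 1ℚ
    ; isCommutativeRing = +-*-isCommutativeRing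
    ; _≤_         = _≤_
    ; ≤-refl      = ≤-refl
    ; ≤-trans     = ≤-trans
      ; +-monoˡ-≤   = +-monoˡ-≤
    ; 0≤*         = 0≤*₀
    ; Positive    = 0ℚ <_
    ; positive⇒0≤ = <⇒≤
    ; positive-1  = positive⁻¹ 1ℚ
    ; positive-*  = 0<*
    ; positive-≤  = <-≤-trans
    ; reciprocal  = λ {a} 0<a → recip a , 0<recip 0<a , recip-inverse (0<⇒≢0 0<a)
    ; archimedean = ℚ-archimedean
    }

  opaque
    ≈ℝ-pointwise : ∀ x y → (∀ n → seq x n ≡ seq y n) → x ≈ℝ y
    ≈ℝ-pointwise x y x≡y ε 0<ε = 0 , λ n _ →
      subst (λ t → ∣ t ∣ < ε) (sym (trans (cong (_- seq y n) (x≡y n)) (+-inverseʳ (seq y n)))) 0<ε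

    ≈ℝ-sym : ∀ x y → x ≈ℝ y → y ≈ℝ x
    ≈ℝ-sym x y xy ε 0<ε with xy ε 0<ε
    ... | N , near = N , λ n N≤n → subst (_< ε)
      (trans (sym (∣-p∣≡∣p∣ (seq x n - seq y n))) (cong ∣_∣ (id-flip (seq y n) (seq x n)))) (near n N≤n)

    ≈ℝ-trans : ∀ x y z → x ≈ℝ y → y ≈ℝ z → x ≈ℝ z
    ≈ℝ-trans x y z xy yz ε 0<ε with xy (½ * ε) (0<½* 0<ε) | yz (½ * ε) (0<½* 0<ε)
    ... | M , near₁ | N , near₂ = M ℕ.⊔ N , λ n p → subst (λ t → ∣ t ∣ < ε) (telescope (seq x n) (seq y n) (seq z n))
      (∣+∣< {seq x n - seq y n} {seq y n - seq z n} (near₁ n (⊔ˡ p)) (near₂ n (⊔ʳ {M} p)))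
      where
      telescope : ∀ a b c → (a + - b) + (b + - c) ≡ a + - c
      telescope = solve-∀ ℚ-ring

    -ℝ-cong : ∀ x y → x ≈ℝ y → -ℝ x ≈ℝ -ℝ y
    -ℝ-cong x y xy ε 0<ε with xy ε 0<ε
    ... | N , near = N , λ n N≤n → subst (_< ε)
      (trans (sym (∣-p∣≡∣p∣ (seq x n - seq y n))) (cong ∣_∣ (id-neg (seq x n) (seq y n)))) (near n N≤n)

    -- Operations on Cauchy sequences act termwise, so each ring law of ℂ reduces to an identity of
    -- rationals at every index.
    ≈-pointwise : ∀ z w → (∀ n → seq (re z) n ≡ seq (re w) n) → (∀ n → seq (im z) n ≡ seq (im w) n) → z ≈ w
    ≈-pointwise z w p q = ≈ℝ-pointwise (re z) (re w) p , ≈ℝ-pointwise (im z) (im w) q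

    ≈-refl : ∀ {z} → z ≈ z
    ≈-refl {z} = ≈-pointwise z z (λ _ → refl) (λ _ → refl)

    ≈-sym : ∀ {z w} → z ≈ w → w ≈ z
    ≈-sym {z} {w} (p , q) = ≈ℝ-sym (re z) (re w) p , ≈ℝ-sym (im z) (im w) q

    ≈-trans : ∀ {z w v} → z ≈ w → w ≈ v → z ≈ v
    ≈-trans {z} {w} {v} (p , q) (p′ , q′) = ≈ℝ-trans (re z) (re w) (re v) p p′ , ≈ℝ-trans (im z) (im w) (im v) q q′

    +ℂ-cong : ∀ {z z′ w w′} → z ≈ z′ → w ≈ w′ → z +ℂ w ≈ z′ +ℂ w′
    +ℂ-cong {z} {z′} {w} {w′} (p , q) (p′ , q′) =
      +ℝ-cong {re z} {re z′} {re w} {re w′} p p′ , +ℝ-cong {im z} {im z′} {im w} {im w′} q q′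

    -ℂ-cong : ∀ {z w} → z ≈ w → -ℂ z ≈ -ℂ w
    -ℂ-cong {z} {w} (p , q) = -ℝ-cong (re z) (re w) p , -ℝ-cong (im z) (im w) q

    *ℂ-cong : ∀ {z z′ w w′} → z ≈ z′ → w ≈ w′ → z *ℂ w ≈ z′ *ℂ w′
    *ℂ-cong {a +i b} {a′ +i b′} {c +i d} {c′ +i d′} (p , q) (p′ , q′) =
      +ℝ-cong {a *ℝ c} {a′ *ℝ c′} { -ℝ (b *ℝ d)} { -ℝ (b′ *ℝ d′)}
        (*ℝ-cong {a} {a′} {c} {c′} p p′) (-ℝ-cong (b *ℝ d) (b′ *ℝ d′) (*ℝ-cong {b} {b′} {d} {d′} q q′)) ,
      +ℝ-cong {a *ℝ d} {a′ *ℝ d′} {b *ℝ c} {b′ *ℝ c′}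
        (*ℝ-cong {a} {a′} {d} {d′} p q′) (*ℝ-cong {b} {b′} {c} {c′} q p′)

    +ℂ-assoc : ∀ z w v → (z +ℂ w) +ℂ v ≈ z +ℂ (w +ℂ v)
    +ℂ-assoc z w v = ≈-pointwise ((z +ℂ w) +ℂ v) (z +ℂ (w +ℂ v))
      (λ n → +-assoc (seq (re z) n) (seq (re w) n) (seq (re v) n))
      (λ n → +-assoc (seq (im z) n) (seq (im w) n) (seq (im v) n))

    +ℂ-comm : ∀ z w → z +ℂ w ≈ w +ℂ z
    +ℂ-comm z w = ≈-pointwise (z +ℂ w) (w +ℂ z)
      (λ n → +-comm (seq (re z) n) (seq (re w) n)) (λ n → +-comm (seq (im z) n) (seq (im w) n))

    +ℂ-identityˡ : ∀ z → 0ℂ +ℂ z ≈ z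
    +ℂ-identityˡ z = ≈-pointwise (0ℂ +ℂ z) z (λ n → +-identityˡ (seq (re z) n)) (λ n → +-identityˡ (seq (im z) n))

    -ℂ-inverseˡ : ∀ z → -ℂ z +ℂ z ≈ 0ℂ
    -ℂ-inverseˡ z = ≈-pointwise (-ℂ z +ℂ z) 0ℂ (λ n → +-inverseˡ (seq (re z) n)) (λ n → +-inverseˡ (seq (im z) n))

    *ℂ-comm : ∀ z w → z *ℂ w ≈ w *ℂ z
    *ℂ-comm z w = ≈-pointwise (z *ℂ w) (w *ℂ z)
      (λ n → re-comm (seq (re z) n) (seq (im z) n) (seq (re w) n) (seq (im w) n))
      (λ n → im-comm (seq (re z) n) (seq (im z) n) (seq (re w) n) (seq (im w) n))
      where
      re-comm : ∀ a b c d → a * c + - (b * d) ≡ c * a + - (d * b)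
      re-comm = solve-∀ ℚ-ring
      im-comm : ∀ a b c d → a * d + b * c ≡ c * b + d * a
      im-comm = solve-∀ ℚ-ring

    *ℂ-assoc : ∀ z w v → (z *ℂ w) *ℂ v ≈ z *ℂ (w *ℂ v)
    *ℂ-assoc z w v = ≈-pointwise ((z *ℂ w) *ℂ v) (z *ℂ (w *ℂ v))
      (λ n → re-assoc (seq (re z) n) (seq (im z) n) (seq (re w) n) (seq (im w) n) (seq (re v) n) (seq (im v) n))
      (λ n → im-assoc (seq (re z) n) (seq (im z) n) (seq (re w) n) (seq (im w) n) (seq (re v) n) (seq (im v) n))
      where
      re-assoc : ∀ a b c d e f → (a * c + - (b * d)) * e + - ((a * d + b * c) * f)
        ≡ a * (c * e + - (d * f)) + - (b * (c * f + d * e))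
      re-assoc = solve-∀ ℚ-ring
      im-assoc : ∀ a b c d e f → (a * c + - (b * d)) * f + (a * d + b * c) * e
        ≡ a * (c * f + d * e) + b * (c * e + - (d * f))
      im-assoc = solve-∀ ℚ-ring

    *ℂ-identityˡ : ∀ z → 1ℂ *ℂ z ≈ z
    *ℂ-identityˡ z = ≈-pointwise (1ℂ *ℂ z) z
      (λ n → re-identity (seq (re z) n) (seq (im z) n)) (λ n → im-identity (seq (re z) n) (seq (im z) n))
      where
      re-identity : ∀ a b → 1ℚ * a + - (0ℚ * b) ≡ a
      re-identity = solve-∀ ℚ-ring
      im-identity : ∀ a b → 1ℚ * b + 0ℚ * a ≡ b
      im-identity = solve-∀ ℚ-ring

    *ℂ-distribʳ-+ℂ : ∀ z w v → (w +ℂ v) *ℂ z ≈ (w *ℂ z) +ℂ (v *ℂ z)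
    *ℂ-distribʳ-+ℂ z w v = ≈-pointwise ((w +ℂ v) *ℂ z) ((w *ℂ z) +ℂ (v *ℂ z))
      (λ n → re-distrib (seq (re z) n) (seq (im z) n) (seq (re w) n) (seq (im w) n) (seq (re v) n) (seq (im v) n))
      (λ n → im-distrib (seq (re z) n) (seq (im z) n) (seq (re w) n) (seq (im w) n) (seq (re v) n) (seq (im v) n))
      where
      re-distrib : ∀ a b c d e f → (c + e) * a + - ((d + f) * b) ≡ (c * a + - (d * b)) + (e * a + - (f * b))
      re-distrib = solve-∀ ℚ-ring
      im-distrib : ∀ a b c d e f → (c + e) * b + (d + f) * a ≡ (c * b + d * a) + (e * b + f * a)
      im-distrib = solve-∀ ℚ-ring

  ℂ-commutativeRing : CommutativeRing _ _
  ℂ-commutativeRing = record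
    { Carrier = ℂ ; _≈_ = _≈_ ; _+_ = _+ℂ_ ; _*_ = _*ℂ_ ; -_ = -ℂ_ ; 0# = 0ℂ ; 1# = 1ℂ
    ; isCommutativeRing = record
      { isRing = record
        { +-isAbelianGroup = record
          { isGroup = record
            { isMonoid = record
              { isSemigroup = record
                { isMagma = record
                  { isEquivalence = record { refl = λ {z} → ≈-refl {z} ; sym = λ {z} {w} → ≈-sym {z} {w} ; trans =
                    λ {z} {w} {v} → ≈-trans {z} {w} {v} }
                  ; ∙-cong = λ {z} {z′} {w} {w′} → +ℂ-cong {z} {z′} {w} {w′} }
                ; assoc = +ℂ-assoc }
              ; identity = +ℂ-identityˡ , λ z → ≈-trans {z +ℂ 0ℂ} {0ℂ +ℂ z} {z} (+ℂ-comm z 0ℂ) (+ℂ-identityˡ z) }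
            ; inverse = -ℂ-inverseˡ , λ z → ≈-trans {z +ℂ -ℂ z} { -ℂ z +ℂ z} {0ℂ} (+ℂ-comm z (-ℂ z)) (-ℂ-inverseˡ z)
            ; ⁻¹-cong = λ {z} {w} → -ℂ-cong {z} {w} }
          ; comm = +ℂ-comm }
        ; *-cong = λ {z} {z′} {w} {w′} → *ℂ-cong {z} {z′} {w} {w′}
        ; *-assoc = *ℂ-assoc
        ; *-identity = *ℂ-identityˡ , λ z → ≈-trans {z *ℂ 1ℂ} {1ℂ *ℂ z} {z} (*ℂ-comm z 1ℂ) (*ℂ-identityˡ z)
        ; distrib = (λ z w v → ≈-trans {z *ℂ (w +ℂ v)} {(w +ℂ v) *ℂ z} {(z *ℂ w) +ℂ (z *ℂ v)} (*ℂ-comm z (w +ℂ v))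
              (≈-trans {(w +ℂ v) *ℂ z} {(w *ℂ z) +ℂ (v *ℂ z)} {(z *ℂ w) +ℂ (z *ℂ v)} (*ℂ-distribʳ-+ℂ z w v)
                (+ℂ-cong {w *ℂ z} {z *ℂ w} {v *ℂ z} {z *ℂ v} (*ℂ-comm w z) (*ℂ-comm v z))))
          , *ℂ-distribʳ-+ℂ }
      ; *-comm = *ℂ-comm } }

  -- Rational bounds for the norm of a complex number

  Eventually : (ℕ → Set) → Set
  Eventually A = ∃[ N ] (∀ n → N ℕ.≤ n → A n)

  infix 4 _≼ℂ_
  -- Squares replace the square root. Demanding the estimate for every s > r, and only eventually,
  -- makes the relation independent of the representing sequences and closed under limits of r.
  _≼ℂ_ : ℂ → ℚ → Set
  z ≼ℂ r = 0ℚ ≤ r × (∀ s → r < s → Eventually (λ n → seq ∣ z ∣² n ≤ s * s))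

  opaque
    eventually₁ : ∀ {A B : ℕ → Set} → (∀ n → A n → B n) → Eventually A → Eventually B
    eventually₁ f (N , a) = N , λ n N≤n → f n (a n N≤n)

    eventually₂ : ∀ {A B C : ℕ → Set} → (∀ n → A n → B n → C n) → Eventually A → Eventually B → Eventually C
    eventually₂ f (M , a) (N , b) = M ℕ.⊔ N , λ n p → f n (a n (⊔ˡ p)) (b n (⊔ʳ {M} p))

    ≤-diff : ∀ a b → a ≤ b → 0ℚ ≤ b - a
    ≤-diff a b a≤b = subst (_≤ b - a) (+-inverseʳ a) (+-monoˡ-≤ (- a) a≤b)

    <-diff : ∀ a b → a < b → 0ℚ < b - a
    <-diff a b a<b = subst (_< b - a) (+-inverseʳ a) (+-monoˡ-< (- a) a<b)

    ≤-from-diff : ∀ a b c → 0ℚ ≤ c → a + c ≡ b → a ≤ b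
    ≤-from-diff a b c 0≤c e = subst₂ _≤_ (+-identityʳ a) e (+-monoʳ-≤ a 0≤c)

    <-from-diff : ∀ a b c → 0ℚ < c → a + c ≡ b → a < b
    <-from-diff a b c 0<c e = subst₂ _<_ (+-identityʳ a) e (+-monoʳ-< a 0<c)

    square-≤⇒≤ : ∀ x y → 0ℚ ≤ y → x * x ≤ y * y → x ≤ y
    square-≤⇒≤ x y 0≤y x²≤y² with x ≤? y
    ... | yes x≤y = x≤y
    ... | no  x≰y = ⊥-elim (<⇒≢ (<-≤-trans (*-mono-<₀ 0≤y 0≤y (≰⇒> x≰y) (≰⇒> x≰y)) x²≤y²) refl)

    square-mono-≤ : ∀ x y → 0ℚ ≤ x → x ≤ y → x * x ≤ y * y
    square-mono-≤ x y 0≤x x≤y = *-mono-≤₀ 0≤x (≤-trans 0≤x x≤y) x≤y x≤y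

    r+[s-r]≡s : ∀ r s → r + (s + - r) ≡ s
    r+[s-r]≡s = solve-∀ ℚ-ring

    s²t²≡[st]² : ∀ s t → (s * s) * (t * t) ≡ (s * t) * (s * t)
    s²t²≡[st]² = solve-∀ ℚ-ring

    abc≡a[cb] : ∀ a b c → a * b * c ≡ a * (c * b)
    abc≡a[cb] = solve-∀ ℚ-ring

    1-2h+h²≡[1-h]² : ∀ h → 1ℚ + - (h + h) + h * h ≡ (1ℚ + - h) * (1ℚ + - h)
    1-2h+h²≡[1-h]² = solve-∀ ℚ-ring

    midpoint : ∀ r s → r < s → ∃[ t ] (r < t × t < s)
    midpoint r s r<s = r + ½ * (s - r) , <-from-diff r (r + ½ * (s - r)) (½ * (s - r)) 0<h refl ,
      <-from-diff (r + ½ * (s - r)) s (½ * (s - r)) 0<h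
        (trans (+-assoc r (½ * (s - r)) (½ * (s - r)))
          (trans (cong (λ t → r + t) (half+half (s - r))) (r+[s-r]≡s r s)))
      where
      0<h : 0ℚ < ½ * (s - r)
      0<h = 0<½* (<-diff r s r<s)

    -- The triangle inequality. The cross term satisfies ac + bd ≤ st by Cauchy-Schwarz, which
    -- Lagrange's identity supplies.
    ∣∣²-+ : ∀ a b c d s t → 0ℚ ≤ s → 0ℚ ≤ t → a * a + b * b ≤ s * s → c * c + d * d ≤ t * t →
      (a + c) * (a + c) + (b + d) * (b + d) ≤ (s + t) * (s + t)
    ∣∣²-+ a b c d s t 0≤s 0≤t p q = ≤-from-diff _ _
      ((s * s - (a * a + b * b)) + (t * t - (c * c + d * d)) + ((s * t - (a * c + b * d)) + (s * t - (a * c + b * d))))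
      (+-mono-≤ (+-mono-≤ (≤-diff _ _ p) (≤-diff _ _ q)) (+-mono-≤ cross cross))
      (expand a b c d s t)
      where
      expand : ∀ a b c d s t → ((a + c) * (a + c) + (b + d) * (b + d)) +
        ((s * s + - (a * a + b * b)) + (t * t + - (c * c + d * d)) + ((s * t + - (a * c + b * d)) + (s * t + - (a * c + b * d))))
        ≡ (s + t) * (s + t)
      expand = solve-∀ ℚ-ring
      lagrange : ∀ a b c d → (a * c + b * d) * (a * c + b * d) + (a * d + - (b * c)) * (a * d + - (b * c)) ≡
        (a * a + b * b) * (c * c + d * d)
      lagrange = solve-∀ ℚ-ring
      cross : 0ℚ ≤ s * t - (a * c + b * d)
      cross = ≤-diff _ _ (square-≤⇒≤ (a * c + b * d) (s * t) (0≤*₀ 0≤s 0≤t)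
        (≤-trans (≤-from-diff _ _ _ (0≤² (a * d - b * c)) (lagrange a b c d))
          (≤-trans (*-mono-≤₀ (+-mono-≤ (0≤² c) (0≤² d)) (0≤² s) p q) (≤-reflexive (s²t²≡[st]² s t)))))

    -- A midpoint t between r and s leaves the tolerance s² - t² for passing from one representative
    -- to the other.
    ≼ℂ-resp-≈ : ∀ {z w r} → z ≈ w → z ≼ℂ r → w ≼ℂ r
    ≼ℂ-resp-≈ {z} {w} {r} z≈w (0≤r , z≼r) = 0≤r , λ s r<s →
      let t , r<t , t<s = midpoint r s r<s
          0≤t = ≤-trans 0≤r (<⇒≤ r<t)
          t²<s² = *-mono-<₀ 0≤t 0≤t t<s t<s
      in eventually₂ (λ n z²≤t² near → ≤-from-diff _ _ _ (+-mono-≤ (≤-diff _ _ z²≤t²) (≤-diff _ _ (<⇒≤ near)))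
             (combine (seq ∣ z ∣² n) (seq ∣ w ∣² n) (t * t) (s * s)))
           (z≼r t r<t) (eventually₁ (λ n → ≤-<-trans (p≤∣p∣ (seq ∣ w ∣² n - seq ∣ z ∣² n)))
             (∣∣²-cong {w} {z} (≈-sym {z} {w} z≈w) (s * s - t * t) (<-diff _ _ t²<s²)))
      where
      combine : ∀ z w t s → w + ((t + - z) + ((s + - t) + - (w + - z))) ≡ s
      combine = solve-∀ ℚ-ring

    ≼ℂ-mono : ∀ {z r s} → z ≼ℂ r → r ≤ s → z ≼ℂ s
    ≼ℂ-mono (0≤r , z≼r) r≤s = ≤-trans 0≤r r≤s , λ t s<t → z≼r t (≤-<-trans r≤s s<t)

    ≼ℂ-0 : 0ℂ ≼ℂ 0ℚ
    ≼ℂ-0 = ≤-refl , λ s _ → 0 , λ _ _ → 0≤² s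

    ≼ℂ-1 : 1ℂ ≼ℂ 1ℚ
    ≼ℂ-1 = <⇒≤ (positive⁻¹ 1ℚ) , λ s 1<s → 0 , λ _ _ → square-mono-≤ 1ℚ s (<⇒≤ (positive⁻¹ 1ℚ)) (<⇒≤ 1<s)

    ≼ℂ-+ : ∀ {z w r s} → z ≼ℂ r → w ≼ℂ s → z +ℂ w ≼ℂ r + s
    ≼ℂ-+ {z} {w} {r} {s} (0≤r , z≼r) (0≤s , w≼s) = +-mono-≤ 0≤r 0≤s , λ t r+s<t →
      let η = ½ * (t - (r + s))
          0<η = 0<½* (<-diff _ _ r+s<t)
      in eventually₂ (λ n p q → subst (λ u → seq ∣ z +ℂ w ∣² n ≤ u * u) (total r s t)
           (∣∣²-+ (seq (re z) n) (seq (im z) n) (seq (re w) n) (seq (im w) n) (r + η) (s + η)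
             (+-mono-≤ 0≤r (<⇒≤ 0<η)) (+-mono-≤ 0≤s (<⇒≤ 0<η)) p q))
         (z≼r (r + η) (<-from-diff r _ η 0<η refl)) (w≼s (s + η) (<-from-diff s _ η 0<η refl))
      where
      regroup : ∀ r s h → (r + h) + (s + h) ≡ (r + s) + (h + h)
      regroup = solve-∀ ℚ-ring
      total : ∀ r s t → (r + ½ * (t - (r + s))) + (s + ½ * (t - (r + s))) ≡ t
      total r s t = trans (regroup r s (½ * (t - (r + s))))
        (trans (cong (λ t → r + s + t) (half+half (t - (r + s)))) (r+[s-r]≡s (r + s) t))

    ≼ℂ-* : ∀ {z w r s} → z ≼ℂ r → w ≼ℂ s → z *ℂ w ≼ℂ r * s
    ≼ℂ-* {z} {w} {r} {s} (0≤r , z≼r) (0≤s , w≼s) = 0≤*₀ 0≤r 0≤s , λ t rs<t →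
      let gap = t - r * s
          A = r + s + 1ℚ
          0<gap = <-diff _ _ rs<t
          0≤A = +-mono-≤ (+-mono-≤ 0≤r 0≤s) (<⇒≤ (positive⁻¹ 1ℚ))
          0<A+gap = +-mono-≤-< 0≤A 0<gap
          -- Chosen so that η ≤ 1 and η (A + gap) = gap; then (r + η)(s + η) ≤ r s + η (r + s + 1) ≤
          -- r s + gap = t.
          η = gap * recip (A + gap)
          0<η = 0<* 0<gap (0<recip 0<A+gap)
          η*[A+gap] : η * (A + gap) ≡ gap
          η*[A+gap] = trans (abc≡a[cb] gap (recip (A + gap)) (A + gap))
            (trans (cong (gap *_) (recip-inverse (0<⇒≢0 0<A+gap))) (*-identityʳ gap))
          η≤1 : η ≤ 1ℚ
          η≤1 = *-cancelʳ-≤-pos (A + gap) {{positive 0<A+gap}}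
            (subst₂ _≤_ (sym η*[A+gap]) (sym (*-identityˡ (A + gap)))
                  (≤-from-diff gap (A + gap) A 0≤A (+-comm gap A)))
          bound≤t : (r + η) * (s + η) ≤ t
          bound≤t = ≤-from-diff _ _ (η * (1ℚ - η) + η * gap)
            (+-mono-≤ (0≤*₀ (<⇒≤ 0<η) (≤-diff _ _ η≤1)) (0≤*₀ (<⇒≤ 0<η) (<⇒≤ 0<gap)))
            (trans (expand r s η gap) (trans (cong (λ t → r * s + t) η*[A+gap]) (r+[s-r]≡s (r * s) t)))
          0≤r+η = +-mono-≤ 0≤r (<⇒≤ 0<η)
          0≤s+η = +-mono-≤ 0≤s (<⇒≤ 0<η)
      in eventually₂ (λ n p q →
           ≤-trans (≤-reflexive (id-norm (seq (re z) n) (seq (im z) n) (seq (re w) n) (seq (im w) n)))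
             (≤-trans (*-mono-≤₀ (0≤∣∣² w n) (0≤² (r + η)) p q)
               (≤-trans (≤-reflexive (s²t²≡[st]² (r + η) (s + η)))
                 (square-mono-≤ ((r + η) * (s + η)) t (0≤*₀ 0≤r+η 0≤s+η) bound≤t))))
         (z≼r (r + η) (<-from-diff r _ η 0<η refl)) (w≼s (s + η) (<-from-diff s _ η 0<η refl))
      where
      expand : ∀ r s h g → (r + h) * (s + h) + (h * (1ℚ + - h) + h * g) ≡ r * s + h * (r + s + 1ℚ + g)
      expand = solve-∀ ℚ-ring

    ≼ℂ-neg : ∀ {z r} → z ≼ℂ r → -ℂ z ≼ℂ r
    ≼ℂ-neg {z} (0≤r , z≼r) = 0≤r , λ s r<s →
      eventually₁ (λ n → subst (_≤ s * s) (neg² (seq (re z) n) (seq (im z) n))) (z≼r s r<s)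
      where
      neg² : ∀ a b → a * a + b * b ≡ - a * - a + - b * - b
      neg² = solve-∀ ℚ-ring

    ≼ℂ-closed : ∀ {z r} → 0ℚ ≤ r → (∀ ε → 0ℚ < ε → z ≼ℂ r + ε) → z ≼ℂ r
    ≼ℂ-closed {z} {r} 0≤r z≼r+ε = 0≤r , λ s r<s →
      let t , r<t , t<s = midpoint r s r<s
      in proj₂ (z≼r+ε (t - r) (<-diff r t r<t)) s (subst (_< s) (sym (r+[s-r]≡s r t)) t<s)

    ∣∣≤ : ∀ a s → 0ℚ ≤ s → a * a ≤ s * s → ∣ a ∣ ≤ s
    ∣∣≤ a s 0≤s a²≤s² = square-≤⇒≤ ∣ a ∣ s 0≤s
      (subst (_≤ s * s) (trans (sym (0≤p⇒∣p∣≡p (0≤² a))) (∣p*q∣≡∣p∣*∣q∣ a a)) a²≤s²)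

    ≤∣∣ : ∀ a s → ∣ a ∣ ≤ s → a * a ≤ s * s
    ≤∣∣ a s ∣a∣≤s = subst (_≤ s * s) (trans (sym (∣p*q∣≡∣p∣*∣q∣ a a)) (0≤p⇒∣p∣≡p (0≤² a)))
      (square-mono-≤ ∣ a ∣ s (0≤∣∣ a) ∣a∣≤s)

    re≤ : ∀ z {s} n → 0ℚ ≤ s → seq ∣ z ∣² n ≤ s * s → ∣ seq (re z) n ∣ ≤ s
    re≤ z {s} n 0≤s z≤ = ∣∣≤ (seq (re z) n) s 0≤s (≤-trans (≤-from-diff _ _ _ (0≤² (seq (im z) n)) refl) z≤)

    im≤ : ∀ z {s} n → 0ℚ ≤ s → seq ∣ z ∣² n ≤ s * s → ∣ seq (im z) n ∣ ≤ s
    im≤ z {s} n 0≤s z≤ = ∣∣≤ (seq (im z) n) s 0≤s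
      (≤-trans (≤-from-diff _ _ _ (0≤² (seq (re z) n))
        (+-comm (seq (im z) n * seq (im z) n) (seq (re z) n * seq (re z) n))) z≤)

    ∣∣²≤ : ∀ a b s t → ∣ a ∣ ≤ s → ∣ b ∣ ≤ t → a * a + b * b ≤ (s + t) * (s + t)
    ∣∣²≤ a b s t a≤s b≤t = ≤-from-diff _ _ ((s * s - a * a) + (t * t - b * b) + (s * t + s * t))
      (+-mono-≤ (+-mono-≤ (≤-diff _ _ (≤∣∣ a s a≤s)) (≤-diff _ _ (≤∣∣ b t b≤t))) (+-mono-≤ 0≤st 0≤st))
      (expand a b s t)
      where
      0≤st : 0ℚ ≤ s * t
      0≤st = 0≤*₀ (≤-trans (0≤∣∣ a) a≤s) (≤-trans (0≤∣∣ b) b≤t)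
      expand : ∀ a b s t → (a * a + b * b) + ((s * s + - (a * a)) + (t * t + - (b * b)) + (s * t + s * t)) ≡
        (s + t) * (s + t)
      expand = solve-∀ ℚ-ring

    ½*<ε : ∀ ε → 0ℚ < ε → ½ * ε < ε
    ½*<ε ε 0<ε = <-from-diff (½ * ε) ε (½ * ε) (0<½* 0<ε) (half+half ε)

    x≡x-0 : ∀ x → x ≡ x - 0ℚ
    x≡x-0 = solve-∀ ℚ-ring

    ≼ℂ0⇒≈0 : ∀ {z} → z ≼ℂ 0ℚ → z ≈ 0ℂ
    ≼ℂ0⇒≈0 {z} (_ , z≼0) =
      (λ ε 0<ε → eventually₁ (λ n z≤ → small (seq (re z) n) ε 0<ε (re≤ z n (<⇒≤ (0<½* 0<ε)) z≤))
        (z≼0 (½ * ε) (0<½* 0<ε))) ,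
      (λ ε 0<ε → eventually₁ (λ n z≤ → small (seq (im z) n) ε 0<ε (im≤ z n (<⇒≤ (0<½* 0<ε)) z≤))
        (z≼0 (½ * ε) (0<½* 0<ε)))
      where
      small : ∀ x ε → 0ℚ < ε → ∣ x ∣ ≤ ½ * ε → ∣ x - 0ℚ ∣ < ε
      small x ε 0<ε x≤ = subst (λ y → ∣ y ∣ < ε) (x≡x-0 x) (≤-<-trans x≤ (½*<ε ε 0<ε))

    ≼ℂ-bounded : ∀ z → ∃[ r ] z ≼ℂ r
    ≼ℂ-bounded z with bound (re z) | bound (im z)
    ... | B , 0<B , evB | C , 0<C , evC = B + C , +-mono-≤ (<⇒≤ 0<B) (<⇒≤ 0<C) , λ s B+C<s →
      eventually₂ (λ n b c → ≤-trans (∣∣²≤ (seq (re z) n) (seq (im z) n) B C (<⇒≤ b) (<⇒≤ c))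
          (square-mono-≤ (B + C) s (+-mono-≤ (<⇒≤ 0<B) (<⇒≤ 0<C)) (<⇒≤ B+C<s)))
        evB evC

  -- Completeness of the complex numbers

  open ArchimedeanFieldProperties ℚ-field using (Contraction; geometric-vanishing)
  open ArchimedeanField ℚ-field using () renaming (_^_ to _^ᵏ_)

  halving : Contraction
  halving = record { ratio = ½ ; positive = positive⁻¹ ½ ; below-1 = positive⁻¹ ½ }

  precision : ℕ → ℚ
  precision k = 1ℚ * ½ ^ᵏ k

  opaque
    0<precision : ∀ k → 0ℚ < precision k
    0<precision k = 0<* (positive⁻¹ 1ℚ) (0<½^ k)
      where
      0<½^ : ∀ k → 0ℚ < ½ ^ᵏ k
      0<½^ zero    = positive⁻¹ 1ℚ
      0<½^ (suc k) = 0<* (positive⁻¹ ½) (0<½^ k)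

    precision-vanishing : ∀ ε → 0ℚ < ε → Eventually (λ k → precision k ≤ ε)
    precision-vanishing = geometric-vanishing halving (<⇒≤ (positive⁻¹ 1ℚ))

    telescope : ∀ {a b c d ε} → ∣ a - b ∣ < ½ * (½ * ε) → ∣ b - c ∣ < ½ * (½ * ε) → ∣ c - d ∣ < ½ * ε → ∣ a - d ∣ < ε
    telescope {a} {b} {c} {d} {ε} p q r = subst (λ t → ∣ t ∣ < ε) (sum a b c d)
      (∣+∣< {(a - b) + (b - c)} {c - d} (∣+∣< {a - b} {b - c} p q) r)
      where
      sum : ∀ a b c d → ((a + - b) + (b + - c)) + (c + - d) ≡ a + - d
      sum = solve-∀ ℚ-ring

    ∣-∣-sym : ∀ a b → ∣ a - b ∣ ≡ ∣ b - a ∣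
    ∣-∣-sym a b = trans (sym (∣-p∣≡∣p∣ (a - b))) (cong ∣_∣ (id-flip b a))

  module _ (x : ℕ → ℝ)
    (x-cauchy : ∀ ε → 0ℚ < ε → ∃[ N ]
      (∀ m n → N ℕ.≤ m → N ℕ.≤ n → Eventually (λ j → ∣ seq (x m) j - seq (x n) j ∣ ≤ ε))) where
    private
      index : ℕ → ℕ
      index k = proj₁ (cauchy (x k) (precision k) (0<precision k))

      -- The entry is taken from the k-th sequence at an index after which that sequence varies by
      -- less than 2^(-k).
      diagonal : ℕ → ℚ
      diagonal k = seq (x k) (index k)

      opaque
        near-diagonal : ∀ k j → index k ℕ.≤ j → ∣ seq (x k) j - diagonal k ∣ < precision k
        near-diagonal k j p = proj₂ (cauchy (x k) (precision k) (0<precision k)) j (index k) p ℕₚ.≤-refl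

        -- Two diagonal entries lie in different sequences at different indices. Both sequences are
        -- compared at a common index j, beyond both diagonal indices and far enough for the two to
        -- be close to each other.
        diagonal-cauchy : ∀ ε → 0ℚ < ε → ∃[ N ] (∀ m n → N ℕ.≤ m → N ℕ.≤ n → ∣ diagonal m - diagonal n ∣ < ε)
        diagonal-cauchy ε 0<ε =
          let e = ½ * (½ * ε)
              0<½ε = 0<½* 0<ε
              0<e = 0<½* 0<½ε
              M , small = precision-vanishing e 0<e
              N , close = x-cauchy (½ * e) (0<½* 0<e)
          in M ℕ.⊔ N , λ m n p q →
            let K , xₘ≈xₙ = close m n (⊔ʳ {M} p) (⊔ʳ {M} q)
                j = index m ℕ.⊔ (index n ℕ.⊔ K)
                m≤j = ℕₚ.m≤m⊔n (index m) (index n ℕ.⊔ K)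
                n≤j = ℕₚ.≤-trans (ℕₚ.m≤m⊔n (index n) K) (ℕₚ.m≤n⊔m (index m) (index n ℕ.⊔ K))
                K≤j = ℕₚ.≤-trans (ℕₚ.m≤n⊔m (index n) K) (ℕₚ.m≤n⊔m (index m) (index n ℕ.⊔ K))
            in telescope {diagonal m} {seq (x m) j} {seq (x n) j} {diagonal n}
              (subst (_< e) (∣-∣-sym (seq (x m) j) (diagonal m)) (<-≤-trans (near-diagonal m j m≤j) (small m (⊔ˡ p))))
              (≤-<-trans (xₘ≈xₙ j K≤j) (½*<ε e 0<e))
              (<-trans (<-≤-trans (near-diagonal n j n≤j) (small n (⊔ˡ q))) (½*<ε (½ * ε) 0<½ε))

    limitℝ : ℝ
    limitℝ = mkℝ diagonal diagonal-cauchy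

    opaque
      -- At index j the limit is an entry of the j-th sequence, not of the n-th. The comparison goes
      -- through a later index i at which the n-th and j-th sequences are close to each other.
      limitℝ-close : ∀ ε → 0ℚ < ε → ∃[ N ] (∀ n → N ℕ.≤ n → Eventually (λ j → ∣ seq (x n) j - seq limitℝ j ∣ ≤ ε))
      limitℝ-close ε 0<ε =
        let e = ½ * (½ * ε)
            0<½ε = 0<½* 0<ε
            0<e = 0<½* 0<½ε
            M , small = precision-vanishing e 0<e
            N , close = x-cauchy (½ * e) (0<½* 0<e)
        in M ℕ.⊔ N , λ n p →
          let C , xₙ-cauchy = cauchy (x n) e 0<e
          in C ℕ.⊔ (M ℕ.⊔ N) , λ j q →
            let M⊔N≤j = ⊔ʳ {C} {M ℕ.⊔ N} q
                K , xₙ≈xⱼ = close n j (⊔ʳ {M} p) (⊔ʳ {M} M⊔N≤j)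
                i = C ℕ.⊔ (index j ℕ.⊔ K)
                C≤i = ℕₚ.m≤m⊔n C (index j ℕ.⊔ K)
                j≤i = ℕₚ.≤-trans (ℕₚ.m≤m⊔n (index j) K) (ℕₚ.m≤n⊔m C (index j ℕ.⊔ K))
                K≤i = ℕₚ.≤-trans (ℕₚ.m≤n⊔m (index j) K) (ℕₚ.m≤n⊔m C (index j ℕ.⊔ K))
            in <⇒≤ (telescope {seq (x n) j} {seq (x n) i} {seq (x j) i} {diagonal j}
              (xₙ-cauchy j i (⊔ˡ q) C≤i)
              (≤-<-trans (xₙ≈xⱼ i K≤i) (½*<ε e 0<e))
              (<-trans (<-≤-trans (near-diagonal j i j≤i) (small j (⊔ˡ M⊔N≤j))) (½*<ε (½ * ε) 0<½ε)))

  module _ (z : ℕ → ℂ)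
    (z-cauchy : ∀ ε → 0ℚ < ε → ∃[ N ] (∀ m n → N ℕ.≤ m → N ℕ.≤ n → z m +ℂ -ℂ z n ≼ℂ ε)) where
    private
      opaque
        ∣z∣²-cauchy : ∀ ε → 0ℚ < ε → ∃[ N ]
          (∀ m n → N ℕ.≤ m → N ℕ.≤ n → Eventually (λ j → seq ∣ z m +ℂ -ℂ z n ∣² j ≤ ε * ε))
        ∣z∣²-cauchy ε 0<ε = let N , close = z-cauchy (½ * ε) (0<½* 0<ε)
          in N , λ m n p q → proj₂ (close m n p q) ε (½*<ε ε 0<ε)

        re-cauchy : ∀ ε → 0ℚ < ε → ∃[ N ]
          (∀ m n → N ℕ.≤ m → N ℕ.≤ n → Eventually (λ j → ∣ seq (re (z m)) j - seq (re (z n)) j ∣ ≤ ε))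
        re-cauchy ε 0<ε = let N , close = ∣z∣²-cauchy ε 0<ε
          in N , λ m n p q → eventually₁ (λ j → re≤ (z m +ℂ -ℂ z n) j (<⇒≤ 0<ε)) (close m n p q)

        im-cauchy : ∀ ε → 0ℚ < ε → ∃[ N ]
          (∀ m n → N ℕ.≤ m → N ℕ.≤ n → Eventually (λ j → ∣ seq (im (z m)) j - seq (im (z n)) j ∣ ≤ ε))
        im-cauchy ε 0<ε = let N , close = ∣z∣²-cauchy ε 0<ε
          in N , λ m n p q → eventually₁ (λ j → im≤ (z m +ℂ -ℂ z n) j (<⇒≤ 0<ε)) (close m n p q)

    opaque
      ℂ-complete : ∃[ L ] (∀ ε → 0ℚ < ε → ∃[ N ] (∀ n → N ℕ.≤ n → z n +ℂ -ℂ L ≼ℂ ε))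
      ℂ-complete = (limitℝ (λ n → re (z n)) re-cauchy +i limitℝ (λ n → im (z n)) im-cauchy) , λ ε 0<ε →
        let M , re-close = limitℝ-close (λ n → re (z n)) re-cauchy (½ * ε) (0<½* 0<ε)
            N , im-close = limitℝ-close (λ n → im (z n)) im-cauchy (½ * ε) (0<½* 0<ε)
        in M ℕ.⊔ N , λ n p → <⇒≤ 0<ε , λ s ε<s →
          eventually₂ (λ j a b → ≤-trans (∣∣²≤ _ _ (½ * ε) (½ * ε) a b)
              (≤-trans (≤-reflexive (cong (λ t → t * t) (half+half ε))) (square-mono-≤ ε s (<⇒≤ 0<ε) (<⇒≤ ε<s))))
            (re-close n (⊔ˡ p)) (im-close n (⊔ʳ {M} p))

  ℂ-normed : CompleteNormedRing ℚ-field
  ℂ-normed = record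
    { commutativeRing = ℂ-commutativeRing
    ; _≼_      = _≼ℂ_
    ; ≼-resp-≈ = λ {z} {w} → ≼ℂ-resp-≈ {z} {w}
    ; ≼-mono   = λ {z} → ≼ℂ-mono {z}
    ; ≼⇒0≤     = proj₁
    ; ≼-0      = ≼ℂ-0
    ; ≼-1      = ≼ℂ-1
    ; ≼-+      = λ {z} {w} → ≼ℂ-+ {z} {w}
    ; ≼-*      = λ {z} {w} → ≼ℂ-* {z} {w}
    ; ≼-neg    = λ {z} → ≼ℂ-neg {z}
    ; ≼-closed = λ {z} → ≼ℂ-closed {z}
    ; ≼0⇒≈0    = λ {z} → ≼ℂ0⇒≈0 {z}
    ; bounded  = ≼ℂ-bounded
    ; complete = ℂ-complete
    }

  opaque
    ≼ℂ⇒∣∣< : ∀ {z r s} → z ≼ℂ r → r < s → ∣ z ∣< s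
    ≼ℂ⇒∣∣< {z} {r} {s} (0≤r , z≼r) r<s =
      let t , r<t , t<s = midpoint r s r<s
          0≤t = ≤-trans 0≤r (<⇒≤ r<t)
      in s * s - t * t , <-diff _ _ (*-mono-<₀ 0≤t 0≤t t<s t<s) ,
         eventually₁ (λ n z²≤t² → +-monoʳ-≤ (s * s) (neg-antimono-≤ z²≤t²)) (z≼r t r<t)

    inv-inverse : ∀ z (z≉0 : z ≉0) → z *ℂ inv z z≉0 ≈ 1ℂ
    inv-inverse z@(a +i b) z≉0@(δ , 0<δ , N , δ≤) =
      -- The real part is exactly 1 only from N on, where the squared norm is at least δ and `recip`
      -- does not take its default value 0. The imaginary part vanishes at every index.
      (λ ε 0<ε → N , λ n N≤n → subst (λ t → ∣ t ∣ < ε) (sym (re-part n N≤n)) 0<ε) ,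
      ≈ℝ-pointwise (im (z *ℂ inv z z≉0)) 0ℝ (λ n → im-identity (seq a n) (seq b n) (recip (seq ∣ z ∣² n)))
      where
      re-identity : ∀ a b r → a * (a * r) + - (b * (- b * r)) ≡ (a * a + b * b) * r
      re-identity = solve-∀ ℚ-ring
      im-identity : ∀ a b r → a * (- b * r) + b * (a * r) ≡ 0ℚ
      im-identity = solve-∀ ℚ-ring
      re-part : ∀ n → N ℕ.≤ n → seq (re (z *ℂ inv z z≉0)) n - 1ℚ ≡ 0ℚ
      re-part n N≤n = cong (_- 1ℚ) (trans (re-identity (seq a n) (seq b n) (recip (seq ∣ z ∣² n)))
        (recip-inverse (0<⇒≢0 (<-≤-trans 0<δ (subst (δ ≤_) (+-identityʳ (seq ∣ z ∣² n)) (δ≤ n N≤n))))))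

    1≉0 : 1ℂ ≉0
    1≉0 = 1ℚ , positive⁻¹ 1ℚ , 0 , λ _ _ → ≤-refl

    -- Apartness needs a positive lower bound: from |z|² |w|² ≥ δ and, eventually, |w|² ≤ s² follows
    -- |z|² ≥ δ / s².
    *≉0⇒≉0 : ∀ z w → z *ℂ w ≉0 → z ≉0
    *≉0⇒≉0 z w (δ , 0<δ , δ≤) = δ * recip (s * s) , 0<* 0<δ (0<recip 0<s²) ,
      eventually₂ lower-bound δ≤ (proj₂ (proj₂ (≼ℂ-bounded w)) s B<s)
      where
      B s : ℚ
      B = proj₁ (≼ℂ-bounded w)
      s = B + 1ℚ
      0≤B : 0ℚ ≤ B
      0≤B = proj₁ (proj₂ (≼ℂ-bounded w))
      B<s : B < s
      B<s = <-from-diff B s 1ℚ (positive⁻¹ 1ℚ) refl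
      0<s² : 0ℚ < s * s
      0<s² = 0<* (≤-<-trans 0≤B B<s) (≤-<-trans 0≤B B<s)
      δ-scaled : δ * recip (s * s) * (s * s) ≡ δ
      δ-scaled = trans (abc≡a[cb] δ (recip (s * s)) (s * s))
        (trans (cong (δ *_) (recip-inverse (0<⇒≢0 0<s²))) (*-identityʳ δ))
      below-product : ∀ n → δ ≤ seq ∣ z *ℂ w ∣² n - 0ℚ → δ ≤ seq ∣ z ∣² n * seq ∣ w ∣² n
      below-product n δ≤zw = ≤-trans δ≤zw (≤-reflexive (trans (sym (x≡x-0 (seq ∣ z *ℂ w ∣² n)))
        (id-norm (seq (re z) n) (seq (im z) n) (seq (re w) n) (seq (im w) n))))
      cleared : ∀ u v → 0ℚ ≤ u → v ≤ s * s → δ ≤ u * v → δ * recip (s * s) ≤ u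
      cleared u v 0≤u v≤s² δ≤uv = *-cancelʳ-≤-pos (s * s) {{positive 0<s²}}
        (≤-trans (≤-reflexive δ-scaled) (≤-trans δ≤uv (*-monoˡ-≤-nonNeg u {{nonNegative 0≤u}} v≤s²)))
      lower-bound : ∀ n → δ ≤ seq ∣ z *ℂ w ∣² n - 0ℚ → seq ∣ w ∣² n ≤ s * s → δ * recip (s * s) ≤ seq ∣ z ∣² n - 0ℚ
      lower-bound n δ≤zw w²≤s² = ≤-trans
        (cleared (seq ∣ z ∣² n) (seq ∣ w ∣² n) (0≤∣∣² z n) w²≤s² (below-product n δ≤zw))
        (≤-reflexive (x≡x-0 (seq ∣ z ∣² n)))

    *≈1⇒≉0 : ∀ z w → z *ℂ w ≈ 1ℂ → z ≉0
    *≈1⇒≉0 z w zw≈1 = *≉0⇒≉0 z w (0<-cong {∣ z *ℂ w ∣²} {∣ 1ℂ ∣²} (∣∣²-cong {z *ℂ w} {1ℂ} zw≈1) 1≉0)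

    -- (1 - δ/2)² exceeds 1 - δ by δ²/4.
    sqrt-below-1 : ∀ x δ → δ ≤ 1ℚ → 0ℚ ≤ δ → x * x ≤ 1ℚ - δ → x ≤ 1ℚ - ½ * δ
    sqrt-below-1 x δ δ≤1 0≤δ x²≤ = square-≤⇒≤ x (1ℚ - ½ * δ)
      (≤-diff (½ * δ) 1ℚ (≤-trans (≤-from-diff (½ * δ) δ (½ * δ) 0≤½δ (half+half δ)) δ≤1))
      (≤-trans x²≤ (≤-from-diff _ _ (½ * δ * (½ * δ)) (0≤² (½ * δ))
        (trans (cong (λ t → 1ℚ - t + ½ * δ * (½ * δ)) (sym (half+half δ))) (1-2h+h²≡[1-h]² (½ * δ)))))
      where
      0≤½δ : 0ℚ ≤ ½ * δ
      0≤½δ = 0≤*₀ (<⇒≤ (positive⁻¹ ½)) 0≤δ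

    -- For x = |z|² the hypothesis bounds x⁴ by 1 - δ. Two applications of `sqrt-below-1` give x ≤ 1
    -- - δ/4, which is at most (1 - δ/8)²; hence r = 1 - δ/8 bounds |z|.
    root-contraction : ∀ z w → z ^ 4 ≈ w → ∣ w ∣< 1ℚ → ∃[ ρ ] z ≼ℂ Contraction.ratio ρ
    root-contraction z w z⁴≈w (δ₀ , 0<δ₀ , N , δ₀≤) = record
        { ratio    = r
        ; positive = <-diff e 1ℚ (<-≤-trans e<δ δ≤1)
        ; below-1  = subst (0ℚ <_) (sym (flip e)) 0<e
        } , <⇒≤ (<-diff e 1ℚ (<-≤-trans e<δ δ≤1)) , λ s r<s → K , λ n K≤n →
          ≤-trans (x≤r² n K≤n) (square-mono-≤ r s (<⇒≤ (<-diff e 1ℚ (<-≤-trans e<δ δ≤1))) (<⇒≤ r<s))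
      where
      close : ∃[ M ] (∀ n → M ℕ.≤ n → ∣ seq ∣ z ^ 4 ∣² n - seq ∣ w ∣² n ∣ < ½ * δ₀)
      close = ∣∣²-cong {z ^ 4} {w} z⁴≈w (½ * δ₀) (0<½* 0<δ₀)
      K : ℕ
      K = N ℕ.⊔ proj₁ close
      δ e r : ℚ
      -- Half of the gap δ₀ between |w|² and 1 is spent on replacing w by z⁴.
      δ = ½ * δ₀
      e = ½ * (½ * (½ * δ))
      r = 1ℚ - e
      flip : ∀ e → 1ℚ + - (1ℚ + - e) ≡ e
      flip = solve-∀ ℚ-ring
      0<δ : 0ℚ < δ
      0<δ = 0<½* 0<δ₀
      0<½δ : 0ℚ < ½ * δ
      0<½δ = 0<½* 0<δ
      0<¼δ : 0ℚ < ½ * (½ * δ)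
      0<¼δ = 0<½* 0<½δ
      0<e : 0ℚ < e
      0<e = 0<½* 0<¼δ
      ½δ≤δ : ½ * δ ≤ δ
      ½δ≤δ = <⇒≤ (½*<ε δ 0<δ)
      ¼δ≤½δ : ½ * (½ * δ) ≤ ½ * δ
      ¼δ≤½δ = <⇒≤ (½*<ε (½ * δ) 0<½δ)
      e<δ : e < δ
      e<δ = <-≤-trans (½*<ε (½ * (½ * δ)) 0<¼δ) (≤-trans ¼δ≤½δ ½δ≤δ)
      x : ℕ → ℚ
      x = seq ∣ z ∣²
      fourth : ∀ x → (x * x) * (x * x) ≡ x * (x * (x * (x * 1ℚ)))
      fourth = solve-∀ ℚ-ring
      combine : ∀ v w d → v + ((1ℚ * 1ℚ + - w + - (d + d)) + (d + - (v + - w))) ≡ 1ℚ + - d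
      combine = solve-∀ ℚ-ring
      x⁴≤ : ∀ n → K ℕ.≤ n → (x n * x n) * (x n * x n) ≤ 1ℚ - δ
      x⁴≤ n K≤n = subst (_≤ 1ℚ - δ) (sym (trans (fourth (x n)) (sym (∣^∣² z 4 n))))
        (≤-from-diff _ _ ((1ℚ * 1ℚ - seq ∣ w ∣² n - (δ + δ)) + (δ - (seq ∣ z ^ 4 ∣² n - seq ∣ w ∣² n)))
          (+-mono-≤ (≤-diff _ _ (subst (_≤ 1ℚ * 1ℚ - seq ∣ w ∣² n) (sym (half+half δ₀)) (δ₀≤ n (⊔ˡ K≤n))))
            (≤-diff _ _ (≤-trans (p≤∣p∣ _) (<⇒≤ (proj₂ close n (⊔ʳ {N} K≤n))))))
          (combine (seq ∣ z ^ 4 ∣² n) (seq ∣ w ∣² n) δ))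
      δ≤1 : δ ≤ 1ℚ
      δ≤1 = ≤-from-diff δ 1ℚ (1ℚ - δ) (≤-trans (0≤² (x K * x K)) (x⁴≤ K ℕₚ.≤-refl)) (r+[s-r]≡s δ 1ℚ)
      x≤r² : ∀ n → K ℕ.≤ n → x n ≤ r * r
      x≤r² n K≤n = ≤-trans
        (sqrt-below-1 (x n) (½ * δ) (≤-trans ½δ≤δ δ≤1) (<⇒≤ 0<½δ)
          (sqrt-below-1 (x n * x n) δ δ≤1 (<⇒≤ 0<δ) (x⁴≤ n K≤n)))
        (≤-from-diff _ _ (e * e) (0≤² e)
          (trans (cong (λ t → 1ℚ - t + e * e) (sym (half+half (½ * (½ * δ))))) (1-2h+h²≡[1-h]² e)))

-- Values of the expressions in the theorem

open ComplexNumbers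
import Defs
open import Data.Nat using (ℕ) renaming (_≤_ to _≤ℕ_; _<_ to _<ℕ_)
open import Data.Nat.Divisibility using (_∣_)
open import Data.Integer using (ℤ; +_; _+_; _-_; _*_)
open import Data.Rational using (1ℚ)
open import Data.Product using (_×_)
open import Defs using (ℂ; _≈_; 1ℂ; -ℂ_; _^_; ∣_∣<_; _≉0; root≉0; _^[_]_; ⌜_⌝; _⊕_; _⊖_; _⊗_; _⊘_; _≐_; Nonzero; poch₂; θ; φ; ψ)
open import Defs using (Expr; poch; ∏<; ∑<; 0<½*; half+half; inv)

module 𝔼 = Evaluation ℂ-normed

module 𝕋 = 𝔼.Transport _^_ (λ _ → ≡.refl) (λ _ _ → ≡.refl)

opaque
  pochhammer-step : ∀ f a q → f Defs.*ℂ (1ℂ Defs.-ℂ a Defs.*ℂ q) 𝔼.≈ f 𝔼.* (𝔼.1# 𝔼.- a 𝔼.* q)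
  pochhammer-step f a q = ≈-pointwise (f Defs.*ℂ (1ℂ Defs.-ℂ a Defs.*ℂ q)) (f 𝔼.* (𝔼.1# 𝔼.- a 𝔼.* q))
    (λ _ → ≡.refl) (λ _ → ≡.refl)

  theta-step : ∀ f a q → f Defs.+ℂ (a Defs.*ℂ q) 𝔼.≈ f 𝔼.+ (a 𝔼.* q)
  theta-step f a q = ≈-pointwise (f Defs.+ℂ (a Defs.*ℂ q)) (f 𝔼.+ (a 𝔼.* q)) (λ _ → ≡.refl) (λ _ → ≡.refl)

  -- The bound `_≼ℂ_` is not strict while the required one is, so closeness is requested at ε/2.
  pochhammer⇒poch : ∀ {a q L} → 𝔼.Pochhammer a q L → poch a q L
  pochhammer⇒poch {a} {q} {L} P ε 0<ε =
    let f = λ n → ∏< n (λ j → 1ℂ Defs.-ℂ a Defs.*ℂ q ^ j)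
        N , near = 𝕋.pochhammer-close {a} {q} {L} f (≈-refl {1ℂ}) (λ n → pochhammer-step (f n) a (q ^ n)) P
          (ℚ.½ ℚ.* ε) (0<½* 0<ε)
    in N , λ n N≤n → ≼ℂ⇒∣∣< {f n Defs.-ℂ L} (near n N≤n) (½*<ε ε 0<ε)

  theta⇒θ : ∀ {a b L} → 𝔼.Theta a b L → θ a b L
  theta⇒θ {a} {b} {L} T ε 0<ε =
    let u = λ k → a ^ tri⁺ k Defs.*ℂ b ^ tri⁻ k
        f = λ n → ∑< n (λ j → u (+ j))
        g = λ n → ∑< n (λ j → u -[1+ j ])
        N , near = 𝕋.theta-close {a} {b} {L} f g (≈-refl {Defs.0ℂ}) (≈-refl {Defs.0ℂ})
                     (λ n → theta-step (f n) (a ^ tri⁺ (+ n)) (b ^ tri⁻ (+ n)))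
                     (λ n → theta-step (g n) (a ^ tri⁺ -[1+ n ]) (b ^ tri⁻ -[1+ n ])) T (ℚ.½ ℚ.* ε) (0<½* 0<ε)
    in N , λ m n p q → ≼ℂ⇒∣∣< {(f n Defs.+ℂ g m) Defs.-ℂ L} (near m n p q) (½*<ε ε 0<ε)

  power≡ : ∀ z (z≉0 : z ≉0) r → 𝔼.power z (inv z z≉0) r ≡ z ^[ z≉0 ] r
  power≡ z z≉0 = 𝕋.power′ z (inv z z≉0) (z ^[ z≉0 ]_) (λ _ → ≡.refl) (λ _ → ≡.refl)

  ≉0⇒invertible : ∀ {z} → z ≉0 → 𝔼.Invertible z
  ≉0⇒invertible {z} z≉0 = inv z z≉0 , inv-inverse z z≉0

  invertible⇒≉0 : ∀ {z} → 𝔼.Invertible z → z ≉0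
  invertible⇒≉0 {z} (w , zw≈1) = *≈1⇒≉0 z w zw≈1

  negation≡ : ∀ z → 𝔼.- z ≡ -ℂ z
  negation≡ z = ≡.refl

  theta⇒θ⁻ : ∀ x y L {x⁻ y⁻} → x⁻ ≡ -ℂ x → y⁻ ≡ -ℂ y → 𝔼.Theta x⁻ y⁻ L → θ (-ℂ x) (-ℂ y) L
  theta⇒θ⁻ x y L {x⁻} {y⁻} x⁻≡ y⁻≡ T = transported x⁻≡ y⁻≡
    where
    transported : ∀ {b c} → x⁻ ≡ b → y⁻ ≡ c → θ b c L
    transported ≡.refl ≡.refl = theta⇒θ {x⁻} {y⁻} {L} T

  theta⇒ψ : ∀ x L {x³} → x³ ≡ x ^ 3 → 𝔼.Theta x x³ L → ψ x L
  theta⇒ψ x L {x³} x³≡ T = transported x³≡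
    where
    transported : ∀ {b} → x³ ≡ b → θ x b L
    transported ≡.refl = theta⇒θ {x} {x³} {L} T

  *≈*ℂ : ∀ z w → z 𝔼.* w 𝔼.≈ z Defs.*ℂ w
  *≈*ℂ z w = ≈-pointwise (z 𝔼.* w) (z Defs.*ℂ w) (λ _ → ≡.refl) (λ _ → ≡.refl)

  +≈+ℂ : ∀ z w → z 𝔼.+ w 𝔼.≈ z Defs.+ℂ w
  +≈+ℂ z w = ≈-pointwise (z 𝔼.+ w) (z Defs.+ℂ w) (λ _ → ≡.refl) (λ _ → ≡.refl)

  -≈-ℂ : ∀ z w → z 𝔼.- w 𝔼.≈ z Defs.-ℂ w
  -≈-ℂ z w = ≈-pointwise (z 𝔼.- w) (z Defs.-ℂ w) (λ _ → ≡.refl) (λ _ → ≡.refl)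

imaginary : ℂ
imaginary = Defs.0ℝ Defs.+i Defs.1ℝ

opaque
  imaginary² : imaginary 𝔼.* imaginary 𝔼.≈ 𝔼.- 𝔼.1#
  imaginary² = ≈-pointwise (imaginary 𝔼.* imaginary) (𝔼.- 𝔼.1#) (λ _ → ≡.refl) (λ _ → ≡.refl)

module Assembly {P P² P⁴ s a P/a Pa P³/a P³a P²/a : ℂ} (V : 𝔼.ThetaQuotient P P² P⁴ s a P/a Pa P³/a P³a P²/a) where
  open 𝔼.ThetaQuotient V

  private
    opaque
      φ₊-value′ : φ P φ₊
      φ₊-value′ = theta⇒θ {P} {P} {φ₊} φ₊-value

      φ₋-value′ : φ (-ℂ P) φ₋
      φ₋-value′ = theta⇒θ⁻ P P φ₋ {𝔼.- P} {𝔼.- P} (negation≡ P) (negation≡ P) φ₋-value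

      ψ₂-value′ : ψ P² ψ₂
      ψ₂-value′ = theta⇒ψ P² ψ₂ {P² 𝔼.^ 3} (≡.sym (𝕋.^′≡^ P² 3)) ψ₂-value

      N-value′ : θ (-ℂ P/a) (-ℂ P³a) N
      N-value′ = theta⇒θ⁻ P/a P³a N {𝔼.- P/a} {𝔼.- P³a} (negation≡ P/a) (negation≡ P³a) N-value

      Δ-value′ : θ (-ℂ Pa) (-ℂ P³/a) Δ
      Δ-value′ = theta⇒θ⁻ Pa P³/a Δ {𝔼.- Pa} {𝔼.- P³/a} (negation≡ Pa) (negation≡ P³/a) Δ-value

      ϑ₀-value′ : θ (-ℂ P/a) (-ℂ Pa) ϑ₀
      ϑ₀-value′ = theta⇒θ⁻ P/a Pa ϑ₀ {𝔼.- P/a} {𝔼.- Pa} (negation≡ P/a) (negation≡ Pa) ϑ₀-value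

      ϑ₊-value′ : θ a P²/a ϑ₊
      ϑ₊-value′ = theta⇒θ {a} {P²/a} {ϑ₊} ϑ₊-value

      ϑ₋-value′ : θ (-ℂ a) (-ℂ P²/a) ϑ₋
      ϑ₋-value′ = theta⇒θ⁻ a P²/a ϑ₋ {𝔼.- a} {𝔼.- P²/a} (negation≡ a) (negation≡ P²/a) ϑ₋-value

    num den : ℂ
    num = n₁ 𝔼.* n₂
    den = d₁ 𝔼.* d₂

    opaque
      num-value : poch₂ P/a P³a P⁴ num
      num-value = n₁ , n₂ , pochhammer⇒poch {P/a} {P⁴} {n₁} n₁-value ,
        pochhammer⇒poch {P³a} {P⁴} {n₂} n₂-value , *≈*ℂ n₁ n₂

      den-value : poch₂ Pa P³/a P⁴ den
      den-value = d₁ , d₂ , pochhammer⇒poch {Pa} {P⁴} {d₁} d₁-value ,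
        pochhammer⇒poch {P³/a} {P⁴} {d₂} d₂-value , *≈*ℂ d₁ d₂

    S-expression : Expr
    S-expression = ⌜ s ⌝ ⊗ (poch₂ P/a P³a P⁴ ⊘ poch₂ Pa P³/a P⁴)

    module _ (num≉0 : num ≉0) (den≉0 : den ≉0) where
      den⁻¹ S w : ℂ
      den⁻¹ = inv den den≉0
      S = s 𝔼.* (num 𝔼.* den⁻¹)
      w = s 𝔼.* ψ₂ 𝔼.* ϑ₀

      opaque
        num-invertible : 𝔼.Invertible num
        num-invertible = ≉0⇒invertible {num} num≉0

        den-invertible : 𝔼.Invertible den
        den-invertible = ≉0⇒invertible {den} den≉0

        den-inverse : den 𝔼.* den⁻¹ 𝔼.≈ 𝔼.1#
        den-inverse = inv-inverse den den≉0

        -- A quotient has a value only where its denominator is apart from zero. This and the next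
        -- two facts supply that for 1/S, for the right-hand sides and for the quotient of theta
        -- functions.
        S≉0 : S ≉0
        S≉0 = invertible⇒≉0 {S} (S-invertible {den⁻¹} num-invertible den-inverse)

        w≉0 : w ≉0
        w≉0 = invertible⇒≉0 {w} (w-invertible num-invertible den-invertible)

        Δ≉0 : Δ ≉0
        Δ≉0 = invertible⇒≉0 {Δ} (Δ-invertible den-invertible)

      S⁻¹ w⁻¹ Δ⁻¹ : ℂ
      S⁻¹ = inv S S≉0
      w⁻¹ = inv w w≉0
      Δ⁻¹ = inv Δ Δ≉0

      opaque
        S-value : S-expression S
        S-value = s , num 𝔼.* den⁻¹ , ≈-refl {s} , (num , den , num-value , den-value , den≉0 , *≈*ℂ num den⁻¹) ,
          *≈*ℂ s (num 𝔼.* den⁻¹)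

        S⁻¹-value : (⌜ 1ℂ ⌝ ⊘ S-expression) S⁻¹
        S⁻¹-value = 1ℂ , S , ≈-refl {1ℂ} , S-value , S≉0 , ≈-sym {1ℂ Defs.*ℂ S⁻¹} {S⁻¹} (*ℂ-identityˡ S⁻¹)

        w-value : (⌜ s ⌝ ⊗ ψ P² ⊗ θ (-ℂ P/a) (-ℂ Pa)) w
        w-value = s 𝔼.* ψ₂ , ϑ₀ , (s , ψ₂ , ≈-refl {s} , ψ₂-value′ , *≈*ℂ s ψ₂) , ϑ₀-value′ , *≈*ℂ (s 𝔼.* ψ₂) ϑ₀

        S-as-thetas : S-expression ≐ ⌜ s ⌝ ⊗ (θ (-ℂ P/a) (-ℂ P³a) ⊘ θ (-ℂ Pa) (-ℂ P³/a))
        S-as-thetas = S , S-value , s , N 𝔼.* Δ⁻¹ , ≈-refl {s} , (N , Δ , N-value′ , Δ-value′ , Δ≉0 , *≈*ℂ N Δ⁻¹) ,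
          ≈-trans {S} {s 𝔼.* (N 𝔼.* Δ⁻¹)} {s Defs.*ℂ (N 𝔼.* Δ⁻¹)}
            (quotient {den⁻¹} {Δ⁻¹} den-inverse (inv-inverse Δ Δ≉0)) (*≈*ℂ s (N 𝔼.* Δ⁻¹))

        difference-value : (⌜ 1ℂ ⌝ ⊘ S-expression) ⊖ S-expression
          ≐ (φ P ⊗ θ (-ℂ a) (-ℂ P²/a)) ⊘ (⌜ s ⌝ ⊗ ψ P² ⊗ θ (-ℂ P/a) (-ℂ Pa))
        difference-value = S⁻¹ 𝔼.- S , (S⁻¹ , S , S⁻¹-value , S-value , -≈-ℂ S⁻¹ S) ,
          φ₊ 𝔼.* ϑ₋ , w , (φ₊ , ϑ₋ , φ₊-value′ , ϑ₋-value′ , *≈*ℂ φ₊ ϑ₋) , w-value , w≉0 ,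
          ≈-trans {S⁻¹ 𝔼.- S} {φ₊ 𝔼.* ϑ₋ 𝔼.* w⁻¹} {(φ₊ 𝔼.* ϑ₋) Defs.*ℂ w⁻¹}
            (difference {den⁻¹} {S⁻¹} {w⁻¹} den-inverse (inv-inverse S S≉0) (inv-inverse w w≉0))
              (*≈*ℂ (φ₊ 𝔼.* ϑ₋) w⁻¹)

        sum-value : (⌜ 1ℂ ⌝ ⊘ S-expression) ⊕ S-expression
          ≐ (φ (-ℂ P) ⊗ θ a P²/a) ⊘ (⌜ s ⌝ ⊗ ψ P² ⊗ θ (-ℂ P/a) (-ℂ Pa))
        sum-value = S⁻¹ 𝔼.+ S , (S⁻¹ , S , S⁻¹-value , S-value , +≈+ℂ S⁻¹ S) ,
          φ₋ 𝔼.* ϑ₊ , w , (φ₋ , ϑ₊ , φ₋-value′ , ϑ₊-value′ , *≈*ℂ φ₋ ϑ₊) , w-value , w≉0 ,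
          ≈-trans {S⁻¹ 𝔼.+ S} {φ₋ 𝔼.* ϑ₊ 𝔼.* w⁻¹} {(φ₋ 𝔼.* ϑ₊) Defs.*ℂ w⁻¹}
            (sum {imaginary} {den⁻¹} {S⁻¹} {w⁻¹} imaginary² den-inverse (inv-inverse S S≉0) (inv-inverse w w≉0))
              (*≈*ℂ (φ₋ 𝔼.* ϑ₊) w⁻¹)

  assembled : Nonzero (poch₂ P/a P³a P⁴) → Nonzero (poch₂ Pa P³/a P⁴) →
    let S = ⌜ s ⌝ ⊗ (poch₂ P/a P³a P⁴ ⊘ poch₂ Pa P³/a P⁴) in
      (S ≐ ⌜ s ⌝ ⊗ (θ (-ℂ P/a) (-ℂ P³a) ⊘ θ (-ℂ Pa) (-ℂ P³/a)))
      ×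
      ((⌜ 1ℂ ⌝ ⊘ S) ⊖ S ≐ (φ P ⊗ θ (-ℂ a) (-ℂ P²/a)) ⊘ (⌜ s ⌝ ⊗ ψ P² ⊗ θ (-ℂ P/a) (-ℂ Pa)))
      ×
      ((⌜ 1ℂ ⌝ ⊘ S) ⊕ S ≐ (φ (-ℂ P) ⊗ θ a P²/a) ⊘ (⌜ s ⌝ ⊗ ψ P² ⊗ θ (-ℂ P/a) (-ℂ Pa)))
  assembled num≉0 den≉0 =
    -- The nonvanishing hypotheses concern every value of the two products, and are applied to the
    -- values constructed above.
    S-as-thetas (num≉0 num num-value) (den≉0 den den-value) ,
    difference-value (num≉0 num num-value) (den≉0 den den-value) ,
    sum-value (num≉0 num num-value) (den≉0 den den-value)

theorem1p1 : (k m : ℕ) → 0 <ℕ k → 2 ∣ k → 1 ≤ℕ m →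
    (q q¼ : ℂ) → (q¼⁴≈q : q¼ ^ 4 ≈ q) → (q≉0 : q ≉0) → ∣ q ∣< 1ℚ →
    let
    Q : ℤ → ℂ
    Q r = q¼ ^[ root≉0 q¼ q 3 q¼⁴≈q q≉0 ] r
    c = + m - + 1
    d = + 2 * + m - + 2
    K = + k
    num = poch₂ (Q (K - + 4 * d)) (Q (+ 3 * K + + 4 * d)) (Q (+ 4 * K))
    den = poch₂ (Q (K + + 4 * d)) (Q (+ 3 * K - + 4 * d)) (Q (+ 4 * K))
    S   = ⌜ Q (+ 4 * c) ⌝ ⊗ (num ⊘ den)
    in
    Nonzero num → Nonzero den →
    (S ≐ ⌜ Q (+ 4 * c) ⌝ ⊗ (θ (-ℂ Q (K - + 4 * d)) (-ℂ Q (+ 3 * K + + 4 * d)) ⊘ θ (-ℂ Q (K + + 4 * d)) (-ℂ Q (+ 3 * K - + 4 * d))))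
    ×
    ((⌜ 1ℂ ⌝ ⊘ S) ⊖ S
    ≐ (φ (Q K) ⊗ θ (-ℂ Q (+ 4 * d)) (-ℂ Q (+ 2 * K - + 4 * d)))
    ⊘ (⌜ Q (+ 4 * c) ⌝ ⊗ ψ (Q (+ 2 * K)) ⊗ θ (-ℂ Q (K - + 4 * d)) (-ℂ Q (K + + 4 * d))))
    ×
    ((⌜ 1ℂ ⌝ ⊘ S) ⊕ S
    ≐ (φ (-ℂ Q K) ⊗ θ (Q (+ 4 * d)) (Q (+ 2 * K - + 4 * d)))
    ⊘ (⌜ Q (+ 4 * c) ⌝ ⊗ ψ (Q (+ 2 * K)) ⊗ θ (-ℂ Q (K - + 4 * d)) (-ℂ Q (K + + 4 * d))))
theorem1p1 k m 0<k _ _ q q¼ q¼⁴≈q q≉0 ∣q∣<1 =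
  let
  Q : ℤ → ℂ
  Q r = q¼ ^[ root≉0 q¼ q 3 q¼⁴≈q q≉0 ] r
  c = + m - + 1
  d = + 2 * + m - + 2
  K = + k
  -- The hypothesis bounds q, but the powers `Q` are built from its fourth root, so the bound is
  -- first carried over to the root.
  contraction = root-contraction q¼ q q¼⁴≈q ∣q∣<1
  in
  Assembly.assembled
    {Q K} {Q (+ 2 * K)} {Q (+ 4 * K)} {Q (+ 4 * c)} {Q (+ 4 * d)}
    {Q (K - + 4 * d)} {Q (K + + 4 * d)} {Q (+ 3 * K - + 4 * d)} {Q (+ 3 * K + + 4 * d)} {Q (+ 2 * K - + 4 * d)}
    (𝔼.thetaQuotient {q¼} {inv q¼ (root≉0 q¼ q 3 q¼⁴≈q q≉0)} (inv-inverse q¼ (root≉0 q¼ q 3 q¼⁴≈q q≉0))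
      (proj₁ contraction) (proj₂ contraction) Q (power≡ q¼ (root≉0 q¼ q 3 q¼⁴≈q q≉0)) k m 0<k)
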